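{- For indeterminates $t,u,x_1,\dots,x_n,y_1,\dots,y_n$, writing $\bar y_i=1/y_i$, $$\sum_{\lambda}\prod_{i=1}^{n}(1-ut^{\lambda_i-i+n})\,s_\lambda(x_1,\dots,x_n)\,sp_\lambda(y_1^{\pm1},\dots,y_n^{\pm1})=\frac{\det_{1\le i,j\le n}\left[\dfrac{1-u+(u-t)(x_iy_j+x_i\bar y_j)+(t^2-u)x_i^2}{(1-x_iy_j)(1-tx_iy_j)(1-x_i\bar y_j)(1-tx_i\bar y_j)}\right]}{\prod_{1\le i<j\le n}(x_i-x_j)(y_i-y_j)(1-\bar y_i\bar y_j)},$$ where the sum is over all partitions $\lambda$ of length at most $n$.
   Context: $s_\lambda$ is the Schur polynomial and $sp_\lambda(y_1^{\pm1},\dots,y_n^{\pm1})$ is the symplectic Schur polynomial (irreducible $Sp_{2n}$ character), given by $sp_\lambda=\det_{i,j}[y_j^{\lambda_i-i+n+1}-y_j^{ -(\lambda_i-i+n+1)}]\big/\det_{i,j}[y_j^{n-i+1}-y_j^{ -(n-i+1)}]$. Identity of formal power series in the $x$'s. -}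

module Defs where

open import Data.Nat as ℕ using (ℕ; zero; suc; _∸_)
open import Data.Integer as ℤ using (ℤ)
open import Data.Fin as Fin using (Fin; toℕ; punchIn)
open import Data.Vec as Vec using (Vec; []; _∷_)
open import Data.Vec.Properties as VecP using ()
open import Data.List as List using (List; []; _∷_)
open import Data.Product using (_×_; _,_)
open import Data.Product.Properties as ProdP using ()
open import Data.Bool using (Bool; true; false; if_then_else_; _∧_; T)
open import Relation.Nullary.Decidable using (⌊_⌋)
open import Relation.Binary.PropositionalEquality using (_≡_)

module Ops {A : Set} (0# 1# : A) (_+_ _*_ : A → A → A) (-_ : A → A) where
  sumL : List A → A
  sumL = List.foldr _+_ 0#

  prodL : List A → A
  prodL = List.foldr _*_ 1#

  sign : ℕ → A
  sign zero    = 1#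
  sign (suc k) = - (sign k)

  det : ∀ {n} → (Fin n → Fin n → A) → A
  det {zero}  M = 1#
  det {suc n} M = sumL (List.map
    (λ j → sign (toℕ j) * (M Fin.zero j * det (λ r c → M (Fin.suc r) (punchIn j c))))
    (List.allFin (suc n)))

-- Laurent polynomials over ℤ in t, u (polynomial) and y₁..yₙ (Laurent)

-- a monomial t^a u^b y^e  with e ∈ ℤⁿ
Mono : ℕ → Set
Mono n = ℕ × ℕ × Vec ℤ n

monoEq : ∀ {n} → Mono n → Mono n → Bool
monoEq m m' = ⌊ ProdP.≡-dec ℕ._≟_ (ProdP.≡-dec ℕ._≟_ (VecP.≡-dec ℤ._≟_)) m m' ⌋

monoMul : ∀ {n} → Mono n → Mono n → Mono n
monoMul (a , b , e) (a' , b' , e') = (a ℕ.+ a' , b ℕ.+ b' , Vec.zipWith ℤ._+_ e e')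

infixl 6 _+L_ _-L_ _+P_ _-P_
infixl 7 _*L_ _*P_
infix 4 _≈L_ _≈P_

-- a Laurent polynomial as a finite formal sum of terms
Laur : ℕ → Set
Laur n = List (ℤ × Mono n)

coeffL : ∀ {n} → Laur n → Mono n → ℤ
coeffL []             m = ℤ.0ℤ
coeffL ((c , m') ∷ p) m = (if monoEq m' m then c else ℤ.0ℤ) ℤ.+ coeffL p m

_≈L_ : ∀ {n} → Laur n → Laur n → Set
p ≈L q = ∀ m → coeffL p m ≡ coeffL q m

0L : ∀ {n} → Laur n
0L = []

1L : ∀ {n} → Laur n
1L = (ℤ.1ℤ , 0 , 0 , Vec.replicate _ ℤ.0ℤ) ∷ []

_+L_ : ∀ {n} → Laur n → Laur n → Laur n
p +L q = p List.++ q

_*L_ : ∀ {n} → Laur n → Laur n → Laur n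
p *L q = List.concatMap (λ { (a , m) → List.map (λ { (b , m') → (a ℤ.* b , monoMul m m') }) q }) p

-L_ : ∀ {n} → Laur n → Laur n
-L p = List.map (λ { (a , m) → (ℤ.- a , m) }) p

_-L_ : ∀ {n} → Laur n → Laur n → Laur n
p -L q = p +L (-L q)

module OpsL {n : ℕ} = Ops {Laur n} 0L 1L _+L_ _*L_ -L_

tuPow : ∀ {n} → ℕ → ℕ → Laur n
tuPow a b = (ℤ.1ℤ , a , b , Vec.replicate _ ℤ.0ℤ) ∷ []

tL uL : ∀ {n} → Laur n
tL = tuPow 1 0
uL = tuPow 0 1

yPow : ∀ {n} → Fin n → ℤ → Laur n
yPow j k = (ℤ.1ℤ , 0 , 0 , Vec.tabulate (λ l → if ⌊ l Fin.≟ j ⌋ then k else ℤ.0ℤ)) ∷ []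

yL : ∀ {n} → Fin n → Laur n
yL j = yPow j ℤ.1ℤ

ybarL : ∀ {n} → Fin n → Laur n
ybarL j = yPow j ℤ.-1ℤ

-- Formal power series in x₁..xₙ with coefficients in Laur n

PS : ℕ → Set
PS n = Vec ℕ n → Laur n

_≈P_ : ∀ {n} → PS n → PS n → Set
f ≈P g = ∀ α → f α ≈L g α

below : ∀ {n} → Vec ℕ n → List (Vec ℕ n)
below []      = [] ∷ []
below (a ∷ α) = List.concatMap (λ b → List.map (b ∷_) (below α)) (List.upTo (suc a))

_+P_ : ∀ {n} → PS n → PS n → PS n
(f +P g) α = f α +L g α

-P_ : ∀ {n} → PS n → PS n
(-P f) α = -L (f α)

_-P_ : ∀ {n} → PS n → PS n → PS n
f -P g = f +P (-P g)

_*P_ : ∀ {n} → PS n → PS n → PS n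
(f *P g) α = OpsL.sumL (List.map (λ β → f β *L g (Vec.zipWith _∸_ α β)) (below α))

monoP : ∀ {n} → Vec ℕ n → Laur n → PS n
monoP e c α = if ⌊ VecP.≡-dec ℕ._≟_ α e ⌋ then c else 0L

constP : ∀ {n} → Laur n → PS n
constP c = monoP (Vec.replicate _ 0) c

0P 1P : ∀ {n} → PS n
0P = constP 0L
1P = constP 1L

module OpsP {n : ℕ} = Ops {PS n} 0P 1P _+P_ _*P_ -P_

xPow : ∀ {n} → Fin n → ℕ → PS n
xPow i k = monoP (Vec.tabulate (λ l → if ⌊ l Fin.≟ i ⌋ then k else 0)) 1L

xP : ∀ {n} → Fin n → PS n
xP i = xPow i 1

-- Partitions of length ≤ n : weakly decreasing λ ∈ ℕⁿ (0-indexed λ₀ ≥ λ₁ ≥ …)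

decB : ∀ {n} → Vec ℕ n → Bool
decB []            = true
decB (a ∷ [])      = true
decB (a ∷ b ∷ v)   = (b ℕ.≤ᵇ a) ∧ decB (b ∷ v)

IsPartition : ∀ {n} → Vec ℕ n → Set
IsPartition λ′ = T (decB λ′)

filterB : ∀ {A : Set} → (A → Bool) → List A → List A
filterB p []       = []
filterB p (x ∷ xs) = if p x then x ∷ filterB p xs else filterB p xs

partitionsUpTo : (n d : ℕ) → List (Vec ℕ n)
partitionsUpTo n d =
  filterB (λ l → decB l ∧ (Vec.sum l ℕ.≤ᵇ d)) (below (Vec.replicate n d))

-- Σ_λ F λ over all partitions of length ≤ n, as an x-adically convergent
-- sum: F λ has x-order ≥ |λ|, so the coefficient of x^α only receives
-- contributions from λ with |λ| ≤ |α|.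
sumPartitions : ∀ {n} → (Vec ℕ n → PS n) → PS n
sumPartitions {n} F α = OpsL.sumL (List.map (λ l → F l α) (partitionsUpTo n (Vec.sum α)))

-- Ingredients of Theorem 9 (indices are 0-based: i ↦ i+1)

-- alternant  det_{i,j}[ x_j^{λ_i - i + n} ]  (1-based i); Vandermonde for λ = 0
alternant : ∀ {n} → Vec ℕ n → PS n
alternant {n} l = OpsP.det (λ i j → xPow j (Vec.lookup l i ℕ.+ (n ∸ suc (toℕ i))))

spNumerator : ∀ {n} → Vec ℕ n → Laur n
spNumerator {n} l = OpsL.det (λ i j →
  let e = Vec.lookup l i ℕ.+ (n ∸ toℕ i) in
  yPow j (ℤ.+ e) -L yPow j (ℤ.- (ℤ.+ e)))

spDenominator : ∀ {n} → Laur n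
spDenominator = spNumerator (Vec.replicate _ 0)

coeffFactor : ∀ {n} → Vec ℕ n → Laur n
coeffFactor {n} l = OpsL.prodL (List.map
  (λ i → 1L -L tuPow (Vec.lookup l i ℕ.+ (n ∸ suc (toℕ i))) 1)
  (List.allFin n))

entryNum : ∀ {n} → Fin n → Fin n → PS n
entryNum i j =
  constP (1L -L uL)
  +P (constP (uL -L tL) *P ((xP i *P constP (yL j)) +P (xP i *P constP (ybarL j))))
  +P (constP (tuPow 2 0 -L uL) *P xPow i 2)

entryDen : ∀ {n} → Fin n → Fin n → PS n
entryDen i j =
  (1P -P (xP i *P constP (yL j)))
  *P ((1P -P (xP i *P constP (tL *L yL j)))
  *P ((1P -P (xP i *P constP (ybarL j)))
  *P  (1P -P (xP i *P constP (tL *L ybarL j)))))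

pairsLt : (n : ℕ) → List (Fin n × Fin n)
pairsLt n = List.concatMap
  (λ i → List.concatMap (λ j → if toℕ i ℕ.<ᵇ toℕ j then (i , j) ∷ [] else [])
                        (List.allFin n))
  (List.allFin n)

rhsDenominator : ∀ {n} → PS n
rhsDenominator {n} = OpsP.prodL (List.map
  (λ { (i , j) → (xP i -P xP j) *P constP ((yL i -L yL j) *L (1L -L (ybarL i *L ybarL j))) })
  (pairsLt n))

{-# OPTIONS --safe #-}

-- Multiply both sides by ∏ (yⱼ − ȳⱼ), which is not a zero divisor.  The factors
-- ∏ (xᵢ − xⱼ) and ∏ (yⱼ − ȳⱼ) ∏ (yᵢ − yⱼ) (1 − ȳᵢ ȳⱼ) then clear the denominators of
-- s_λ and sp_λ (the latter is a Vandermonde determinant in yⱼ + ȳⱼ), and after the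
-- substitution mᵢ = λᵢ + n − i the left side is a sum over strictly decreasing m of
-- products of two determinants.  By Cauchy–Binet it equals the determinant of
-- Σ_m (1 − u t^m) xᵢ^m (yⱼ^(m+1) − ȳⱼ^(m+1)), which is the partial fraction expansion
-- of (yⱼ − ȳⱼ) times the given entry.  All sums become finite modulo terms of
-- total degree at least k in the x's; this uses that s_λ has order at least |λ|.
module Submission where

open import Defs
open import Data.Nat using (ℕ)
open import Data.Fin using (Fin)
open import Data.Vec using (Vec; replicate)
open import Data.Product using (_,_)
open import Relation.Binary.PropositionalEquality as ≡ using (_≡_)
import Data.Nat as ℕ
import Data.Nat.Properties as ℕP
import Data.Vec as Vec
import Data.List.Properties as ListP
open import Algebra.Bundles using (CommutativeRing)
open import Level using (0ℓ)

-- The families `s`, `sp` and the entries `M` are not constructed: they are known only through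
-- equations of the form quotient times denominator equals numerator. Hence nothing is ever divided;
-- every step multiplies through by a denominator and cancels a factor known to be regular. Even the
-- order of `s l` has to be won this way, by cancelling the factors xᵢ - xⱼ of the Vandermonde
-- product one at a time. It is needed because the coefficient of x^α in the sum over partitions
-- only takes |λ| ≤ |α| into account. Series modulo degree k form a commutative ring for each k, on
-- the same elements with a coarser equality. Determinants, Cauchy-Binet and the Vandermonde lemma
-- are therefore proved once over an arbitrary commutative ring and used both for Laurent
-- polynomials and for truncated series. In such a ring 2 may be a zero divisor, so vanishing is
-- never deduced from antisymmetry. Since `det` is defined by expansion along the top row, sign
-- arguments are made on ordered pairs of columns instead of permutations.

-- Polynomial identities with integer coefficients in any commutative ring

module RingSolver (R : CommutativeRing 0ℓ 0ℓ) where

  open import Algebra.Bundles using (RawRing)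
  open import Data.Nat as ℕ using (ℕ)
  open import Data.Product as Prod using (_,_)
  open import Data.Maybe as Maybe using (Maybe)
  open import Relation.Nullary.Decidable using (dec⇒maybe)
  open import Algebra.Solver.Ring.AlmostCommutativeRing
    using (fromCommutativeRing; _-Raw-AlmostCommutative⟶_)
  open import Relation.Binary.PropositionalEquality using (_≡_)
  import Algebra.Solver.Ring
  import Algebra.Properties.Semiring.Mult
  import Algebra.Properties.Ring
  import Algebra.Properties.AbelianGroup
  import Algebra.Properties.CommutativeSemigroup
  import Relation.Binary.Reasoning.Setoid

  open CommutativeRing R
  open Algebra.Properties.Semiring.Mult semiring
  open Algebra.Properties.Ring ring
  open Algebra.Properties.AbelianGroup +-abelianGroup using (⁻¹-∙-comm; ⁻¹-involutive)
  open Algebra.Properties.CommutativeSemigroup +-commutativeSemigroup using (interchange)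
  open Relation.Binary.Reasoning.Setoid setoid

  -- Integers as formal differences: (a , b) stands for a − b.
  differences : RawRing 0ℓ 0ℓ
  differences = record
    { Carrier = ℕ Prod.× ℕ
    ; _≈_ = _≡_
    ; _+_ = λ { (a , b) (c , d) → a ℕ.+ c , b ℕ.+ d }
    ; _*_ = λ { (a , b) (c , d) → a ℕ.* c ℕ.+ b ℕ.* d , a ℕ.* d ℕ.+ b ℕ.* c }
    ; -_ = λ { (a , b) → b , a }
    ; 0# = 0 , 0
    ; 1# = 1 , 0
    }

  ⟦_⟧ᵈ : ℕ Prod.× ℕ → Carrier
  ⟦ a , b ⟧ᵈ = a × 1# - b × 1#

  private
    +-homo : ∀ x y z w → (x + y) - (z + w) ≈ (x - z) + (y - w)
    +-homo x y z w = begin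
      (x + y) - (z + w)       ≈⟨ +-congˡ (⁻¹-∙-comm z w) ⟨
      (x + y) + (- z + - w)   ≈⟨ interchange x y (- z) (- w) ⟩
      (x - z) + (y - w)       ∎

    *-homo : ∀ x y z w → (x * z + y * w) - (x * w + y * z) ≈ (x - y) * (z - w)
    *-homo x y z w = begin
      (x * z + y * w) - (x * w + y * z)             ≈⟨ +-homo _ _ _ _ ⟩
      (x * z - x * w) + (y * w - y * z)             ≈⟨ +-cong (x[y-z]≈xy-xz x z w) (x[y-z]≈xy-xz y w z) ⟨
      x * (z - w) + y * (w - z)                     ≈⟨ +-congˡ (*-congˡ (neg z w)) ⟨
      x * (z - w) + y * - (z - w)                   ≈⟨ +-congˡ (-‿distribʳ-* y (z - w)) ⟨
      x * (z - w) + - (y * (z - w))                 ≈⟨ [y-z]x≈yx-zx (z - w) x y ⟨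
      (x - y) * (z - w)                             ∎
      where
      neg : ∀ a b → - (a - b) ≈ b - a
      neg a b = begin
        - (a - b)       ≈⟨ ⁻¹-∙-comm a (- b) ⟨
        - a + - - b     ≈⟨ +-comm _ _ ⟩
        - - b - a       ≈⟨ +-congʳ (⁻¹-involutive b) ⟩
        b - a           ∎

    zero-homo : ⟦ 0 , 0 ⟧ᵈ ≈ 0#
    zero-homo = trans (+-congˡ -0#≈0#) (+-identityˡ 0#)

    one-homo : ⟦ 1 , 0 ⟧ᵈ ≈ 1#
    one-homo = trans (+-cong (+-identityʳ 1#) -0#≈0#) (+-identityʳ 1#)

  -- Agrees with ⟦_⟧ᵈ, but makes the literals :0 and :1 below denote 0# and 1# definitionally.
  eval : ℕ Prod.× ℕ → Carrier
  eval (0 , 0) = 0#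
  eval (1 , 0) = 1#
  eval p       = ⟦ p ⟧ᵈ

  private
    eval≈ : ∀ p → eval p ≈ ⟦ p ⟧ᵈ
    eval≈ (0 , 0) = sym zero-homo
    eval≈ (1 , 0) = sym one-homo
    eval≈ (0 , ℕ.suc _) = refl
    eval≈ (1 , ℕ.suc _) = refl
    eval≈ (ℕ.suc (ℕ.suc _) , _) = refl

    morphism : differences -Raw-AlmostCommutative⟶ fromCommutativeRing R
    morphism = record
      { ⟦_⟧ = eval
      ; +-homo = λ { p@(a , b) q@(c , d) → trans (eval≈ (a ℕ.+ c , b ℕ.+ d)) (trans
          (trans (+-cong (×-homo-+ 1# a c) (-‿cong (×-homo-+ 1# b d))) (+-homo _ _ _ _))
          (sym (+-cong (eval≈ p) (eval≈ q)))) }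
      ; *-homo = λ { p@(a , b) q@(c , d) → trans (eval≈ (a ℕ.* c ℕ.+ b ℕ.* d , a ℕ.* d ℕ.+ b ℕ.* c)) (trans
          (trans
            (+-cong (trans (×-homo-+ 1# (a ℕ.* c) (b ℕ.* d)) (+-cong (×1-homo-* a c) (×1-homo-* b d)))
              (-‿cong (trans (×-homo-+ 1# (a ℕ.* d) (b ℕ.* c)) (+-cong (×1-homo-* a d) (×1-homo-* b c)))))
            (*-homo _ _ _ _))
          (sym (*-cong (eval≈ p) (eval≈ q)))) }
      ; -‿homo = λ { p@(a , b) → trans (eval≈ (b , a)) (trans
          (trans (trans (+-comm _ _) (+-congˡ (sym (⁻¹-involutive _)))) (⁻¹-∙-comm _ _))
          (-‿cong (sym (eval≈ p)))) }
      ; 0-homo = refl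
      ; 1-homo = refl
      }

    -- The test a + d = c + b is sufficient but not necessary, since the ring may have positive
    -- characteristic; so a failed comparison asserts nothing.
    equal? : ∀ p q → Maybe (eval p ≈ eval q)
    equal? (a , b) (c , d) = Maybe.map (λ eq → trans (eval≈ (a , b)) (trans (lemma eq) (sym (eval≈ (c , d))))) (dec⇒maybe ((a ℕ.+ d) ℕ.≟ (c ℕ.+ b)))
      where
      shift : ∀ x y z → x - y ≈ (x + z) - (y + z)
      shift x y z = sym (trans (+-homo x z y z) (trans (+-congˡ (-‿inverseʳ z)) (+-identityʳ _)))
      lemma : a ℕ.+ d ≡ c ℕ.+ b → ⟦ a , b ⟧ᵈ ≈ ⟦ c , d ⟧ᵈ
      lemma eq = begin
        a × 1# - b × 1#                           ≈⟨ shift _ _ _ ⟩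
        (a × 1# + d × 1#) - (b × 1# + d × 1#)     ≈⟨ +-congʳ (×-homo-+ 1# a d) ⟨
        (a ℕ.+ d) × 1# - (b × 1# + d × 1#)        ≈⟨ +-congʳ (×-congˡ eq) ⟩
        (c ℕ.+ b) × 1# - (b × 1# + d × 1#)        ≈⟨ +-cong (×-homo-+ 1# c b) (-‿cong (+-comm _ _)) ⟩
        (c × 1# + b × 1#) - (d × 1# + b × 1#)     ≈⟨ shift _ _ _ ⟨
        c × 1# - d × 1#                           ∎

  open Algebra.Solver.Ring differences (fromCommutativeRing R) morphism equal? public
    using (solve; _:=_; _:+_; _:*_; _:-_; :-_; con; Polynomial)

  :0 :1 : ∀ {n} → Polynomial n
  :0 = con (0 , 0)
  :1 = con (1 , 0)

-- Sums, products, and determinants expanded along the top row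

module Determinants (R : CommutativeRing 0ℓ 0ℓ) where

  open import Data.Nat using (ℕ; zero; suc)
  open import Data.Fin using (Fin; zero; suc; toℕ; punchIn)
  import Data.List as List
  open import Relation.Binary.PropositionalEquality as ≡ using (_≡_)
  open import Function using (_∘_; flip)
  import Data.List.Properties as ListP
  import Algebra.Properties.CommutativeMonoid.Sum
  import Algebra.Properties.Semiring.Sum
  import Algebra.Properties.Ring
  import Relation.Binary.Reasoning.Setoid
  import Defs

  open CommutativeRing R hiding (zero)
  open Defs.Ops 0# 1# _+_ _*_ -_ public
  open Algebra.Properties.Ring ring using (-0#≈0#)
  open Relation.Binary.Reasoning.Setoid setoid
  open RingSolver R using (solve; _:=_; _:+_; _:*_; _:-_; :-_; :1)

  private
    module ΣP = Algebra.Properties.CommutativeMonoid.Sum +-commutativeMonoid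
    module ΣR = Algebra.Properties.Semiring.Sum semiring
    module ΠP = Algebra.Properties.CommutativeMonoid.Sum *-commutativeMonoid

  -- Kept abstract so that the unifier does not unfold sums over Fin (suc n).
  abstract
    sum ∏ : ∀ {n} → (Fin n → Carrier) → Carrier
    sum = ΣP.sum
    ∏ = ΠP.sum

    sum-empty : (f : Fin 0 → Carrier) → sum f ≈ 0#
    sum-empty f = refl

    sum-suc : ∀ {n} (f : Fin (suc n) → Carrier) → sum f ≈ f zero + sum (f ∘ suc)
    sum-suc f = refl

    sum-cong : ∀ {n} {f g : Fin n → Carrier} → (∀ i → f i ≈ g i) → sum f ≈ sum g
    sum-cong = ΣP.sum-cong-≋

    sum-+ : ∀ {n} (f g : Fin n → Carrier) → sum (λ i → f i + g i) ≈ sum f + sum g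
    sum-+ = ΣP.∑-distrib-+

    sum-comm : ∀ {m n} (f : Fin m → Fin n → Carrier) →
      sum (λ i → sum (f i)) ≈ sum (λ j → sum (λ i → f i j))
    sum-comm = ΣP.∑-comm

    *-sum : ∀ {n} x (f : Fin n → Carrier) → x * sum f ≈ sum (λ i → x * f i)
    *-sum = ΣR.*-distribˡ-sum

    sum-* : ∀ {n} x (f : Fin n → Carrier) → sum f * x ≈ sum (λ i → f i * x)
    sum-* = ΣR.*-distribʳ-sum

    ∏-empty : (f : Fin 0 → Carrier) → ∏ f ≈ 1#
    ∏-empty f = refl

    ∏-suc : ∀ {n} (f : Fin (suc n) → Carrier) → ∏ f ≈ f zero * ∏ (f ∘ suc)
    ∏-suc f = refl

    ∏-cong : ∀ {n} {f g : Fin n → Carrier} → (∀ i → f i ≈ g i) → ∏ f ≈ ∏ g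
    ∏-cong = ΠP.sum-cong-≋

    ∏-* : ∀ {n} (f g : Fin n → Carrier) → ∏ (λ i → f i * g i) ≈ ∏ f * ∏ g
    ∏-* = ΠP.∑-distrib-+

    sum-zero : ∀ {n} (f : Fin n → Carrier) → (∀ i → f i ≈ 0#) → sum f ≈ 0#
    sum-zero {n} f f≈0 = trans (sum-cong f≈0) (ΣP.sum-replicate-zero n)

  sum-neg : ∀ {n} (f : Fin n → Carrier) → sum (λ i → - f i) ≈ - sum f
  sum-neg {zero}  f = trans (sum-empty _) (trans (sym -0#≈0#) (-‿cong (sym (sum-empty f))))
  sum-neg {suc n} f = begin
    sum (λ i → - f i)                      ≈⟨ sum-suc _ ⟩
    - f zero + sum (λ i → - f (suc i))     ≈⟨ +-congˡ (sum-neg (f ∘ suc)) ⟩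
    - f zero + - sum (f ∘ suc)             ≈⟨ solve 2 (λ a b → :- a :+ :- b := :- (a :+ b)) refl _ _ ⟩
    - (f zero + sum (f ∘ suc))             ≈⟨ -‿cong (sum-suc f) ⟨
    - sum f                                ∎

  sumL-tabulate : ∀ {n} (f : Fin n → Carrier) → sumL (List.tabulate f) ≈ sum f
  sumL-tabulate {zero}  f = sym (sum-empty f)
  sumL-tabulate {suc n} f = trans (+-congˡ (sumL-tabulate (f ∘ suc))) (sym (sum-suc f))

  prodL-tabulate : ∀ {n} (f : Fin n → Carrier) → prodL (List.tabulate f) ≈ ∏ f
  prodL-tabulate {zero}  f = sym (∏-empty f)
  prodL-tabulate {suc n} f = trans (*-congˡ (prodL-tabulate (f ∘ suc))) (sym (∏-suc f))

  prodL-allFin : ∀ {n} (f : Fin n → Carrier) → prodL (List.map f (List.allFin n)) ≈ ∏ f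
  prodL-allFin {n} f = trans
    (reflexive (≡.cong prodL (ListP.map-tabulate (λ i → i) f))) (prodL-tabulate f)

  Matrix : ℕ → Set
  Matrix n = Fin n → Fin n → Carrier

  minor : ∀ {n} → Fin (suc n) → Matrix (suc n) → Matrix n
  minor k M i j = M (suc i) (punchIn k j)

  sgn : ∀ {n} → Fin n → Carrier
  sgn k = sign (toℕ k)

  -- This trades the list sum in the definition of `det` for the abstract `sum`, on which all later
  -- determinant proofs work.
  det-expand : ∀ {n} (M : Matrix (suc n)) →
    det M ≈ sum (λ k → sgn k * (M zero k * det (minor k M)))
  det-expand {n} M = trans
    (reflexive (≡.cong sumL (ListP.map-tabulate (λ i → i) (λ k → sgn k * (M zero k * det (minor k M))))))
    (sumL-tabulate {suc n} _)

  det-cong : ∀ {n} {M M′ : Matrix n} → (∀ i j → M i j ≈ M′ i j) → det M ≈ det M′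
  det-cong {zero}  eq = refl
  det-cong {suc n} {M} {M′} eq = trans (det-expand M) (trans
    (sum-cong (λ k → *-congˡ (*-cong (eq zero k) (det-cong (λ i j → eq (suc i) (punchIn k j))))))
    (sym (det-expand M′)))

  -- In the expansion, the minor without column k contributes the product of the other factors, and
  -- `extract` restores the missing `c k` from the entry of the top row.
  scale-columns : ∀ {n} (c : Fin n → Carrier) (M : Matrix n) →
    det (λ i j → c j * M i j) ≈ ∏ c * det M
  scale-columns {zero}  c M = trans (sym (*-identityˡ 1#)) (*-congʳ (sym (∏-empty c)))
  scale-columns {suc n} c M = begin
    det (λ i j → c j * M i j)
      ≈⟨ det-expand (λ i j → c j * M i j) ⟩
    sum (λ k → sgn k * (c k * M zero k * det (λ i j → c (punchIn k j) * minor k M i j)))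
      ≈⟨ sum-cong (λ k → trans (*-congˡ (*-congˡ (scale-columns (c ∘ punchIn k) (minor k M))))
           (trans (shuffle (sgn k) (c k) (M zero k) _ _) (*-congʳ (extract k c)))) ⟩
    sum (λ k → ∏ c * (sgn k * (M zero k * det (minor k M))))
      ≈⟨ *-sum (∏ c) _ ⟨
    ∏ c * sum (λ k → sgn k * (M zero k * det (minor k M)))
      ≈⟨ *-congˡ (det-expand M) ⟨
    ∏ c * det M ∎
    where
    shuffle : ∀ s a m p d → s * (a * m * (p * d)) ≈ (a * p) * (s * (m * d))
    shuffle = solve 5 (λ s a m p d → s :* (a :* m :* (p :* d)) := (a :* p) :* (s :* (m :* d))) refl
    extract : ∀ {m} (k : Fin (suc m)) (c : Fin (suc m) → Carrier) → c k * ∏ (c ∘ punchIn k) ≈ ∏ c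
    extract zero c = sym (∏-suc c)
    extract {suc m} (suc k) c = begin
      c (suc k) * ∏ (c ∘ punchIn (suc k))                    ≈⟨ *-congˡ (∏-suc _) ⟩
      c (suc k) * (c zero * ∏ (c ∘ suc ∘ punchIn k))         ≈⟨ solve 3 (λ a b p → a :* (b :* p) := b :* (a :* p)) refl _ _ _ ⟩
      c zero * (c (suc k) * ∏ (c ∘ suc ∘ punchIn k))         ≈⟨ *-congˡ (extract k (c ∘ suc)) ⟩
      c zero * ∏ (c ∘ suc)                                   ≈⟨ ∏-suc c ⟨
      ∏ c                                                    ∎

  scale-rows : ∀ {n} (c : Fin n → Carrier) (M : Matrix n) →
    det (λ i j → c i * M i j) ≈ ∏ c * det M
  scale-rows {zero}  c M = trans (sym (*-identityˡ 1#)) (*-congʳ (sym (∏-empty c)))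
  scale-rows {suc n} c M = begin
    det (λ i j → c i * M i j)
      ≈⟨ det-expand (λ i j → c i * M i j) ⟩
    sum (λ k → sgn k * (c zero * M zero k * det (λ i j → c (suc i) * minor k M i j)))
      ≈⟨ sum-cong (λ k → trans (*-congˡ (*-congˡ (scale-rows (c ∘ suc) (minor k M))))
           (trans (shuffle (sgn k) (c zero) (M zero k) _ _) (*-congʳ (sym (∏-suc c))))) ⟩
    sum (λ k → ∏ c * (sgn k * (M zero k * det (minor k M))))
      ≈⟨ *-sum (∏ c) _ ⟨
    ∏ c * sum (λ k → sgn k * (M zero k * det (minor k M)))
      ≈⟨ *-congˡ (det-expand M) ⟨
    ∏ c * det M ∎
    where
    shuffle : ∀ s a m p d → s * (a * m * (p * d)) ≈ (a * p) * (s * (m * d))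
    shuffle = solve 5 (λ s a m p d → s :* (a :* m :* (p :* d)) := (a :* p) :* (s :* (m :* d))) refl

  -- The signed sum over ordered pairs of distinct columns k, p; the last argument of H
  -- enumerates the remaining columns.
  pairSum : ∀ {n} → (Fin (suc (suc n)) → Fin (suc (suc n)) → (Fin n → Fin (suc (suc n))) → Carrier) → Carrier
  pairSum H = sum (λ k → sum (λ k′ → sgn k * (sgn k′ * H k (punchIn k k′) (punchIn k ∘ punchIn k′))))

  private
    Pairing : ℕ → Set
    Pairing n = Fin (suc (suc n)) → Fin (suc (suc n)) → (Fin n → Fin (suc (suc n))) → Carrier

    -- Enumerations of the remaining columns often agree only pointwise, and functions are not
    -- extensional here; this hypothesis lets one replace the other.
    Extensional : ∀ {n} → Pairing n → Set
    Extensional H = ∀ k p {e e′} → (∀ i → e i ≡ e′ i) → H k p e ≈ H k p e′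

    lift : ∀ {n} → (Fin n → Fin (suc (suc n))) → Fin (suc n) → Fin (suc (suc (suc n)))
    lift e zero    = zero
    lift e (suc i) = suc (e i)

    -- The restriction to pairs that avoid column 0. Column 0 then always comes first among the
    -- remaining columns, which makes induction on the number of columns possible.
    lower : ∀ {n} → Pairing (suc n) → Pairing n
    lower H k p e = H (suc k) (suc p) (lift e)

    lower-ext : ∀ {n} (H : Pairing (suc n)) → Extensional H → Extensional (lower H)
    lower-ext H ext k p eq = ext (suc k) (suc p) λ { zero → ≡.refl ; (suc i) → ≡.cong suc (eq i) }

    -- The pairs that involve column 0.
    boundary : ∀ {n} → Pairing n → Carrier
    boundary H = sum (λ k → sgn k * (H zero (suc k) (suc ∘ punchIn k) - H (suc k) zero (suc ∘ punchIn k)))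

    pairSum-tail : ∀ {n} → Pairing n → Carrier
    pairSum-tail {zero}  H = 0#
    pairSum-tail {suc n} H = pairSum (lower H)

    -- The pairs (0, k + 1) and (k + 1, 0) leave the same remaining columns but carry opposite
    -- signs, because deleting column 0 shifts the later column down by one place. For pairs without
    -- column 0 the two extra signs cancel.
    pairSum-split : ∀ {n} (H : Pairing n) → Extensional H → pairSum H ≈ boundary H + pairSum-tail H
    pairSum-split {n} H ext = begin
      pairSum H
        ≈⟨ trans (sum-suc _) (+-congˡ (sum-cong {suc n} (λ k → sum-suc _))) ⟩
      sum (λ k′ → 1# * (sgn k′ * H₀ k′)) + sum (λ k → - sgn k * (1# * H₁ k) + T k)
        ≈⟨ +-congˡ (sum-+ {suc n} (λ k → - sgn k * (1# * H₁ k)) T) ⟩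
      sum (λ k′ → 1# * (sgn k′ * H₀ k′)) + (sum (λ k → - sgn k * (1# * H₁ k)) + sum {suc n} T)
        ≈⟨ +-assoc _ _ _ ⟨
      sum (λ k′ → 1# * (sgn k′ * H₀ k′)) + sum (λ k → - sgn k * (1# * H₁ k)) + sum {suc n} T
        ≈⟨ +-congʳ (sum-+ (λ k′ → 1# * (sgn k′ * H₀ k′)) (λ k → - sgn k * (1# * H₁ k))) ⟨
      sum (λ k → 1# * (sgn k * H₀ k) + - sgn k * (1# * H₁ k)) + sum {suc n} T
        ≈⟨ +-cong (sum-cong (λ k → combine (sgn k) (H₀ k) (H₁ k))) (tail H ext) ⟩
      boundary H + pairSum-tail H ∎
      where
      H₀ H₁ T : Fin (suc n) → Carrier
      H₀ k = H zero (suc k) (suc ∘ punchIn k)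
      H₁ k = H (suc k) zero (suc ∘ punchIn k)
      T k = sum (λ k′ → sgn (suc k) * (sgn (suc k′) * H (suc k) (punchIn (suc k) (suc k′)) (punchIn (suc k) ∘ punchIn (suc k′))))
      combine : ∀ s a b → 1# * (s * a) + - s * (1# * b) ≈ s * (a - b)
      combine = solve 3 (λ s a b → :1 :* (s :* a) :+ :- s :* (:1 :* b) := s :* (a :- b)) refl
      tail : ∀ {n} (H : Pairing n) → Extensional H →
        sum (λ k → sum (λ k′ → sgn (suc k) * (sgn (suc k′) * H (suc k) (suc (punchIn k k′)) (punchIn (suc k) ∘ punchIn (suc k′)))))
          ≈ pairSum-tail H
      tail {zero}  H ext = trans (sum-suc _) (trans (+-cong (sum-empty _) (sum-empty _)) (+-identityʳ 0#))
      tail {suc n} H ext = sum-cong {suc (suc n)} (λ k → sum-cong {suc n} (λ k′ → trans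
        (solve 3 (λ a b c → :- a :* (:- b :* c) := a :* (b :* c)) refl (sgn k) (sgn k′) _)
        (*-congˡ (*-congˡ (ext (suc k) (suc (punchIn k k′)) λ { zero → ≡.refl ; (suc i) → ≡.refl })))))

  -- This is the antisymmetry of the determinant under an exchange of two rows. The pairs with
  -- column 0 are negated termwise, and `lower` hands the rest to the induction.
  pairSum-flip : ∀ {n} (H : Pairing n) → Extensional H → pairSum (flip H) ≈ - pairSum H
  pairSum-flip {n} H ext = begin
    pairSum (flip H)                              ≈⟨ pairSum-split (flip H) (flip ext) ⟩
    boundary (flip H) + pairSum-tail (flip H)     ≈⟨ +-cong flipped (tail H ext) ⟩
    - boundary H + - pairSum-tail H               ≈⟨ solve 2 (λ a b → :- a :+ :- b := :- (a :+ b)) refl _ _ ⟩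
    - (boundary H + pairSum-tail H)               ≈⟨ -‿cong (pairSum-split H ext) ⟨
    - pairSum H                                   ∎
    where
    flipped : boundary (flip H) ≈ - boundary H
    flipped = trans
      (sum-cong (λ k → solve 3 (λ s a b → s :* (a :- b) := :- (s :* (b :- a))) refl (sgn k) _ _))
      (sum-neg {suc n} _)
    tail : ∀ {n} (H : Pairing n) → Extensional H → pairSum-tail (flip H) ≈ - pairSum-tail H
    tail {zero}  H ext = sym -0#≈0#
    tail {suc n} H ext = pairSum-flip (lower H) (lower-ext H ext)

  -- `pairSum-flip` would only show that twice the sum vanishes; the induction is repeated because 2
  -- may be a zero divisor.
  pairSum-symmetric : ∀ {n} (H : Pairing n) → Extensional H → (∀ k p e → H k p e ≈ H p k e) → pairSum H ≈ 0#
  pairSum-symmetric {n} H ext symm = begin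
    pairSum H                           ≈⟨ pairSum-split H ext ⟩
    boundary H + pairSum-tail H         ≈⟨ +-cong (sum-zero {suc n} _ vanish) (tail H ext symm) ⟩
    0# + 0#                             ≈⟨ +-identityʳ 0# ⟩
    0#                                  ∎
    where
    vanish : ∀ k → sgn k * (H zero (suc k) (suc ∘ punchIn k) - H (suc k) zero (suc ∘ punchIn k)) ≈ 0#
    vanish k = trans (*-congˡ (trans (+-congʳ (symm zero (suc k) _)) (-‿inverseʳ _))) (zeroʳ (sgn k))
    tail : ∀ {n} (H : Pairing n) → Extensional H → (∀ k p e → H k p e ≈ H p k e) → pairSum-tail H ≈ 0#
    tail {zero}  H ext symm = refl
    tail {suc n} H ext symm = pairSum-symmetric (lower H) (lower-ext H ext) (λ k p e → symm (suc k) (suc p) (lift e))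

-- Rank-one updates of determinants and the Cauchy-Binet formula

module CauchyBinet (R : CommutativeRing 0ℓ 0ℓ) where

  open import Data.Nat using (ℕ; zero; suc)
  open import Data.Fin using (Fin; zero; suc; punchIn)
  open import Data.Vec as Vec using (Vec; []; _∷_)
  open import Relation.Binary.PropositionalEquality as ≡ using (_≡_)
  open import Function using (_∘_; flip)
  import Relation.Binary.Reasoning.Setoid

  open CommutativeRing R hiding (zero)
  open Determinants R
  open Relation.Binary.Reasoning.Setoid setoid
  open RingSolver R using (solve; _:=_; _:+_; _:*_; _:-_; :-_; :0)

  remove : ∀ {n} → Fin (suc n) → Fin (suc n) → Matrix (suc n) → Matrix n
  remove j k M r c = M (punchIn j r) (punchIn k c)

  -- The bilinear form given by the matrix of cofactors of `M`: the correction term in the matrix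
  -- determinant lemma.
  adjugateForm : ∀ {n} → Matrix n → (Fin n → Carrier) → (Fin n → Carrier) → Carrier
  adjugateForm {zero}  M a b = 0#
  adjugateForm {suc n} M a b = sum (λ j → sum (λ k → sgn j * (sgn k * (a j * b k * det (remove j k M)))))

  private
    *-move : ∀ {n} x (f : Fin n → Carrier) (g : Fin n → Carrier) → (∀ i → x * f i ≈ g i) → x * sum f ≈ sum g
    *-move x f g eq = trans (*-sum x f) (sum-cong eq)

    det-sub-ext : ∀ {n m} (M : Fin n → Fin m → Carrier) {e e′ : Fin n → Fin m} →
      (∀ i → e i ≡ e′ i) → det (λ r c → M r (e c)) ≈ det (λ r c → M r (e′ c))
    det-sub-ext M eq = det-cong (λ r c → reflexive (≡.cong (M r) (eq c)))

    module _ {n} (M : Matrix (suc n)) (a b : Fin (suc n) → Carrier) where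
      -- Expanding an updated matrix along row 0 gives four kinds of products. Here `cross` pairs an
      -- old entry of row 0 with the correction of its minor, and `square` uses the rank-one part in
      -- both places. `lower` is the part of the adjugate form that omits a row other than row 0.
      cross square : Fin (suc n) → Carrier
      cross k  = sgn k * (M zero k * adjugateForm (minor k M) (a ∘ suc) (b ∘ punchIn k))
      square k = sgn k * (a zero * b k * adjugateForm (minor k M) (a ∘ suc) (b ∘ punchIn k))
      lower : Fin n → Carrier
      lower j = sum (λ k → sgn (suc j) * (sgn k * (a (suc j) * b k * det (remove (suc j) k M))))

    -- Both sums range over ordered pairs of columns, on which the summand is
    -- respectively flipped and symmetric.
    sum-cross : ∀ {n} (M : Matrix (suc n)) a b →
      sum (cross M a b) ≈ sum {n} (λ j → sum (λ k → sgn (suc j) * (sgn k * (a (suc j) * b k * det (remove (suc j) k M)))))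
    sum-cross {zero} M a b = trans
      (sum-zero (cross M a b) λ k → trans (*-congˡ (zeroʳ (M zero k))) (zeroʳ (sgn k)))
      (sym (sum-empty _))
    sum-cross {suc n} M a b = begin
      sum (cross M a b)
        ≈⟨ sum-cong (λ k → trans (sym (*-assoc _ _ _)) (*-move (sgn k * M zero k) _ (λ j → sum (λ k′ → term j k k′))
             λ j → *-move (sgn k * M zero k) _ _ λ k′ → shuffle (sgn k) (M zero k) (sgn j) (sgn k′) (a (suc j)) (b (punchIn k k′)) _)) ⟩
      sum (λ k → sum (λ j → sum (λ k′ → term j k k′)))
        ≈⟨ sum-comm (λ k j → sum (λ k′ → term j k k′)) ⟩
      sum (λ j → sum (λ k → sum (λ k′ → term j k k′)))
        ≈⟨ sum-cong (λ j → trans (sym (pull j (H j))) (trans (*-congˡ (negate j))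
             (trans (pull′ j) (sum-cong λ k → expand j k)))) ⟩
      sum (λ j → sum (λ k → sgn (suc j) * (sgn k * (a (suc j) * b k * det (remove (suc j) k M))))) ∎
      where
      D : Fin (suc n) → (Fin n → Fin (suc (suc n))) → Carrier
      D j e = det (λ r c → M (suc (punchIn j r)) (e c))
      H : Fin (suc n) → Fin (suc (suc n)) → Fin (suc (suc n)) → (Fin n → Fin (suc (suc n))) → Carrier
      H j k p e = M zero k * b p * D j e
      term : Fin (suc n) → Fin (suc (suc n)) → Fin (suc n) → Carrier
      term j k k′ = sgn j * a (suc j) * (sgn k * (sgn k′ * H j k (punchIn k k′) (punchIn k ∘ punchIn k′)))
      shuffle : ∀ s m t u x y d → s * m * (t * (u * (x * y * d))) ≈ t * x * (s * (u * (m * y * d)))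
      shuffle = solve 7 (λ s m t u x y d → s :* m :* (t :* (u :* (x :* y :* d))) := t :* x :* (s :* (u :* (m :* y :* d)))) refl
      pull : ∀ j (G : _) → sgn j * a (suc j) * pairSum G ≈
        sum (λ k → sum (λ k′ → sgn j * a (suc j) * (sgn k * (sgn k′ * G k (punchIn k k′) (punchIn k ∘ punchIn k′)))))
      pull j G = *-move _ _ _ λ k → *-sum _ _
      -- On the left, row 0 chooses its column before `b` does; in the cofactor expansion `b`
      -- chooses first. Exchanging the roles costs the sign that turns `sgn j` into `sgn (suc j)`.
      negate : ∀ j → pairSum (H j) ≈ - pairSum (flip (H j))
      negate j = pairSum-flip (flip (H j)) (λ k p eq → *-congˡ (det-sub-ext (λ r → M (suc (punchIn j r))) eq))
      pull′ : ∀ j → sgn j * a (suc j) * (- pairSum (flip (H j))) ≈ sum (λ k → sum (λ k′ → - (sgn j * a (suc j)) * (sgn k * (sgn k′ * H j (punchIn k k′) k (punchIn k ∘ punchIn k′)))))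
      pull′ j = trans (solve 2 (λ x y → x :* (:- y) := :- x :* y) refl _ _) (*-move _ _ _ λ k → *-sum _ _)
      expand : ∀ j k → sum (λ k′ → - (sgn j * a (suc j)) * (sgn k * (sgn k′ * H j (punchIn k k′) k (punchIn k ∘ punchIn k′)))) ≈ sgn (suc j) * (sgn k * (a (suc j) * b k * det (remove (suc j) k M)))
      expand j k = sym (trans
        (solve 5 (λ s t x y d → :- s :* (t :* (x :* y :* d)) := :- s :* t :* x :* y :* d) refl (sgn j) (sgn k) (a (suc j)) (b k) _)
        (trans (*-congˡ (det-expand (remove (suc j) k M)))
          (*-move _ _ _ λ k′ → regroup (sgn j) (sgn k) (a (suc j)) (b k) (sgn k′) (M zero (punchIn k k′)) _)))
        where
        regroup : ∀ s t x y u m d → - s * t * x * y * (u * (m * d)) ≈ - (s * x) * (t * (u * (m * y * d)))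
        regroup = solve 7 (λ s t x y u m d → :- s :* t :* x :* y :* (u :* (m :* d)) := :- (s :* x) :* (t :* (u :* (m :* y :* d)))) refl

    sum-square : ∀ {n} (M : Matrix (suc n)) a b → sum (square M a b) ≈ 0#
    sum-square {zero} M a b = sum-zero (square M a b) λ k → trans (*-congˡ (zeroʳ (a zero * b k))) (zeroʳ (sgn k))
    sum-square {suc n} M a b = begin
      sum (square M a b)
        ≈⟨ sum-cong (λ k → trans (sym (*-assoc _ _ _)) (*-move (sgn k * (a zero * b k)) _ (λ j → sum (λ k′ → term j k k′))
             λ j → *-move (sgn k * (a zero * b k)) _ _ λ k′ → shuffle (sgn k) (a zero) (b k) (sgn j) (sgn k′) (a (suc j)) (b (punchIn k k′)) _)) ⟩
      sum (λ k → sum (λ j → sum (λ k′ → term j k k′)))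
        ≈⟨ sum-comm (λ k j → sum (λ k′ → term j k k′)) ⟩
      sum (λ j → sum (λ k → sum (λ k′ → term j k k′)))
        ≈⟨ sum-zero _ (λ j → trans (sym (*-move _ _ _ λ k → *-sum _ _)) (trans (*-congˡ (vanish j)) (zeroʳ _))) ⟩
      0# ∎
      where
      H : Fin (suc n) → Fin (suc (suc n)) → Fin (suc (suc n)) → (Fin n → Fin (suc (suc n))) → Carrier
      H j k p e = b k * b p * det (λ r c → M (suc (punchIn j r)) (e c))
      term : Fin (suc n) → Fin (suc (suc n)) → Fin (suc n) → Carrier
      term j k k′ = a zero * sgn j * a (suc j) * (sgn k * (sgn k′ * H j k (punchIn k k′) (punchIn k ∘ punchIn k′)))
      shuffle : ∀ s z m t u x y d → s * (z * m) * (t * (u * (x * y * d))) ≈ z * t * x * (s * (u * (m * y * d)))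
      shuffle = solve 8 (λ s z m t u x y d → s :* (z :* m) :* (t :* (u :* (x :* y :* d))) := z :* t :* x :* (s :* (u :* (m :* y :* d)))) refl
      vanish : ∀ j → pairSum (H j) ≈ 0#
      vanish j = pairSum-symmetric (H j)
        (λ k p eq → *-congˡ (det-sub-ext (λ r → M (suc (punchIn j r))) eq))
        (λ k p e → *-congʳ (*-comm (b k) (b p)))

  -- The correction is linear in `a` and in `b` because terms that use the rank-one part in two rows
  -- cancel in pairs. In Cauchy-Binet, each new summation index is such an update.
  det-rank-one : ∀ {n} (M : Matrix n) (a b : Fin n → Carrier) →
    det (λ i j → M i j + a i * b j) ≈ det M + adjugateForm M a b
  det-rank-one {zero}  M a b = sym (+-identityʳ 1#)
  det-rank-one {suc n} M a b = begin
    det (λ i j → M i j + a i * b j)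
      ≈⟨ det-expand (λ i j → M i j + a i * b j) ⟩
    sum (λ k → sgn k * ((M zero k + a zero * b k) * det (λ i j → minor k M i j + a (suc i) * b (punchIn k j))))
      ≈⟨ sum-cong (λ k → trans (*-congˡ (*-congˡ (det-rank-one (minor k M) (a ∘ suc) (b ∘ punchIn k))))
           (multiply-out (sgn k) (M zero k) (a zero) (b k) _ _)) ⟩
    sum (λ k → (plain k + top k) + (cross M a b k + square M a b k))
      ≈⟨ trans (sum-+ _ _) (+-cong (sum-+ _ _) (sum-+ _ _)) ⟩
    (sum plain + sum top) + (sum (cross M a b) + sum (square M a b))
      ≈⟨ +-cong (+-congʳ (sym (det-expand M))) (+-cong (sum-cross M a b) (sum-square M a b)) ⟩
    (det M + sum top) + (sum (lower M a b) + 0#)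
      ≈⟨ solve 3 (λ d t l → (d :+ t) :+ (l :+ :0) := d :+ (t :+ l)) refl _ _ _ ⟩
    det M + (sum top + sum (lower M a b))
      ≈⟨ +-congˡ (+-congʳ (sum-cong (λ k → sym (*-identityˡ _)))) ⟩
    det M + (sum (λ k → 1# * top k) + sum (lower M a b))
      ≈⟨ +-congˡ (sum-suc _) ⟨
    det M + adjugateForm M a b ∎
    where
    plain top : Fin (suc n) → Carrier
    plain k = sgn k * (M zero k * det (minor k M))
    top k = sgn k * (a zero * b k * det (minor k M))
    multiply-out : ∀ s m x y d c → s * ((m + x * y) * (d + c)) ≈
      (s * (m * d) + s * (x * y * d)) + (s * (m * c) + s * (x * y * c))
    multiply-out = solve 6 (λ s m x y d c → s :* ((m :+ x :* y) :* (d :+ c)) :=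
      (s :* (m :* d) :+ s :* (x :* y :* d)) :+ (s :* (m :* c) :+ s :* (x :* y :* c))) refl

  det-zero : ∀ {n} (M : Matrix (suc n)) → (∀ j → M zero j ≈ 0#) → det M ≈ 0#
  det-zero M eq = trans (det-expand M) (sum-zero _ λ k → trans (*-congˡ (trans (*-congʳ (eq k)) (zeroˡ _))) (zeroʳ _))

  rangeSum : ℕ → (ℕ → Carrier) → Carrier
  rangeSum zero    f = 0#
  rangeSum (suc N) f = f N + rangeSum N f

  -- Runs over the strictly decreasing vectors with entries below the bound, split by whether the
  -- first entry is the largest admissible one.
  strictSum : ∀ n → ℕ → (Vec ℕ n → Carrier) → Carrier
  strictSum zero    N       H = H []
  strictSum (suc n) zero    H = 0#
  strictSum (suc n) (suc N) H = strictSum n N (λ l → H (N ∷ l)) + strictSum (suc n) N H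

  strictSum-cong : ∀ n N {G H : Vec ℕ n → Carrier} → (∀ l → G l ≈ H l) → strictSum n N G ≈ strictSum n N H
  strictSum-cong zero    N       eq = eq []
  strictSum-cong (suc n) zero    eq = refl
  strictSum-cong (suc n) (suc N) eq = +-cong (strictSum-cong n N (λ l → eq (N ∷ l))) (strictSum-cong (suc n) N eq)

  *-strictSum : ∀ n N x (H : Vec ℕ n → Carrier) → strictSum n N (λ l → x * H l) ≈ x * strictSum n N H
  *-strictSum zero    N       x H = refl
  *-strictSum (suc n) zero    x H = sym (zeroʳ x)
  *-strictSum (suc n) (suc N) x H = trans
    (+-cong (*-strictSum n N x (λ l → H (N ∷ l))) (*-strictSum (suc n) N x H)) (sym (distribˡ x _ _))

  strictSum-sum : ∀ n N {m} (H : Fin m → Vec ℕ n → Carrier) →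
    strictSum n N (λ l → sum (λ i → H i l)) ≈ sum (λ i → strictSum n N (H i))
  strictSum-sum zero    N       H = refl
  strictSum-sum (suc n) zero    H = sym (sum-zero _ (λ _ → refl))
  strictSum-sum (suc n) (suc N) H = trans
    (+-cong (strictSum-sum n N (λ i l → H i (N ∷ l))) (strictSum-sum (suc n) N H)) (sym (sum-+ _ _))

  -- Induction on the range of the summation index. Vectors headed by the new index N put it in the
  -- top row of both determinants; expanding there and applying the formula to the minors yields
  -- exactly the adjugate form by which the right side grows.
  cauchy-binet : ∀ n N (A B : ℕ → Fin n → Carrier) →
    strictSum n N (λ l → det (λ i → A (Vec.lookup l i)) * det (λ i → B (Vec.lookup l i)))
      ≈ det (λ i j → rangeSum N (λ l → A l i * B l j))
  cauchy-binet zero    N       A B = *-identityˡ 1#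
  cauchy-binet (suc n) zero    A B = sym (det-zero {n} (λ i j → 0#) (λ _ → refl))
  cauchy-binet (suc n) (suc N) A B = begin
    strictSum n N (λ l → dA (N ∷ l) * dB (N ∷ l)) + strictSum (suc n) N (λ l → dA l * dB l)
      ≈⟨ +-cong (strictSum-cong n N expand) (cauchy-binet (suc n) N A B) ⟩
    strictSum n N (λ l → sum (λ j → sum (λ k → coef j k * pair j k l))) + det M
      ≈⟨ +-congʳ (trans (strictSum-sum n N _) (sum-cong λ j → trans (strictSum-sum n N _) (sum-cong λ k →
           trans (*-strictSum n N (coef j k) (pair j k)) (trans
             (*-congˡ (cauchy-binet n N (λ l c → A l (punchIn j c)) (λ l c → B l (punchIn k c))))
             (regroup (sgn j) (sgn k) (A N j) (B N k) _))))) ⟩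
    adjugateForm M (A N) (B N) + det M
      ≈⟨ +-comm _ _ ⟩
    det M + adjugateForm M (A N) (B N)
      ≈⟨ det-rank-one M (A N) (B N) ⟨
    det (λ i j → M i j + A N i * B N j)
      ≈⟨ det-cong {suc n} (λ i j → +-comm (M i j) (A N i * B N j)) ⟩
    det (λ i j → A N i * B N j + M i j) ∎
    where
    M : Matrix (suc n)
    M i j = rangeSum N (λ l → A l i * B l j)
    dA dB : Vec ℕ (suc n) → Carrier
    dA l = det (λ i → A (Vec.lookup l i))
    dB l = det (λ i → B (Vec.lookup l i))
    coef : Fin (suc n) → Fin (suc n) → Carrier
    coef j k = sgn j * sgn k * (A N j * B N k)
    mA mB : Fin (suc n) → Vec ℕ n → Carrier
    mA j l = det (λ i c → A (Vec.lookup l i) (punchIn j c))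
    mB k l = det (λ i c → B (Vec.lookup l i) (punchIn k c))
    pair : Fin (suc n) → Fin (suc n) → Vec ℕ n → Carrier
    pair j k l = mA j l * mB k l
    regroup : ∀ s t x y d → s * t * (x * y) * d ≈ s * (t * (x * y * d))
    regroup = solve 5 (λ s t x y d → s :* t :* (x :* y) :* d := s :* (t :* (x :* y :* d))) refl
    multiply : ∀ s x d t y e → s * (x * d) * (t * (y * e)) ≈ s * t * (x * y) * (d * e)
    multiply = solve 6 (λ s x d t y e → s :* (x :* d) :* (t :* (y :* e)) := s :* t :* (x :* y) :* (d :* e)) refl
    expand : ∀ l → dA (N ∷ l) * dB (N ∷ l) ≈ sum (λ j → sum (λ k → coef j k * pair j k l))
    expand l = trans (*-cong (det-expand (λ i → A (Vec.lookup (N ∷ l) i))) (det-expand (λ i → B (Vec.lookup (N ∷ l) i)))) (trans (sum-* _ _)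
      (sum-cong λ j → *-move _ _ _ λ k → multiply (sgn j) (A N j) (mA j l) (sgn k) (B N k) (mB k l)))

-- Row operations and Vandermonde determinants

module Vandermonde (R : CommutativeRing 0ℓ 0ℓ) where

  open import Data.Nat as ℕ using (ℕ; zero; suc; _∸_)
  open import Data.Fin using (Fin; zero; suc; toℕ; punchIn)
  open import Data.List as List using (List; []; _∷_)
  open import Data.Product using (_×_; _,_)
  open import Data.Bool using (true; false; if_then_else_)
  open import Relation.Binary.PropositionalEquality as ≡ using (_≡_)
  open import Function using (_∘_)
  import Data.List.Properties as ListP
  import Relation.Binary.Reasoning.Setoid
  open import Defs using (pairsLt)

  open CommutativeRing R hiding (zero)
  open Determinants R
  open Relation.Binary.Reasoning.Setoid setoid
  open RingSolver R using (solve; _:=_; _:+_; _:*_; _:-_; :-_)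

  -- Expansion along both top rows gives a signed sum over pairs of columns whose summand is
  -- symmetric when the rows agree.
  det-equal-rows : ∀ {n} (M : Matrix (suc (suc n))) → (∀ j → M zero j ≈ M (suc zero) j) → det M ≈ 0#
  det-equal-rows {n} M eq = begin
    det M
      ≈⟨ det-expand M ⟩
    sum (λ k → sgn k * (M zero k * det (minor k M)))
      ≈⟨ sum-cong (λ k → trans (*-congˡ (*-congˡ (det-expand (minor k M)))) (trans (sym (*-assoc _ _ _))
           (trans (*-sum _ _) (sum-cong λ k′ → regroup k k′)))) ⟩
    pairSum H
      ≈⟨ pairSum-symmetric H (λ k p e≡e′ → *-congˡ (det-cong λ r c → reflexive (≡.cong (M (suc (suc r))) (e≡e′ c))))
           (λ k p e → *-congʳ (*-comm _ _)) ⟩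
    0# ∎
    where
    H : Fin (suc (suc n)) → Fin (suc (suc n)) → (Fin n → Fin (suc (suc n))) → Carrier
    H k p e = M zero k * M zero p * det (λ r c → M (suc (suc r)) (e c))
    shuffle : ∀ s m t p d → s * m * (t * (p * d)) ≈ s * (t * (m * p * d))
    shuffle = solve 5 (λ s m t p d → s :* m :* (t :* (p :* d)) := s :* (t :* (m :* p :* d))) refl
    regroup : ∀ k k′ → sgn k * M zero k * (sgn k′ * (M (suc zero) (punchIn k k′) * det (minor k′ (minor k M))))
      ≈ sgn k * (sgn k′ * H k (punchIn k k′) (punchIn k ∘ punchIn k′))
    regroup k k′ = trans (shuffle (sgn k) (M zero k) (sgn k′) _ _)
      (*-congˡ (*-congˡ (*-congʳ (*-congˡ (sym (eq (punchIn k k′)))))))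

  -- The determinant with rows r (n−1), …, r 1, r 0 from top to bottom.
  descending : ∀ n → (ℕ → Fin n → Carrier) → Carrier
  descending n r = det (λ i j → r (n ∸ suc (toℕ i)) j)

  restrict : ∀ {n} → Fin (suc n) → (ℕ → Fin (suc n) → Carrier) → ℕ → Fin n → Carrier
  restrict j r k c = r k (punchIn j c)

  descending-expand : ∀ n (r : ℕ → Fin (suc n) → Carrier) →
    descending (suc n) r ≈ sum (λ j → sgn j * (r n j * descending n (restrict j r)))
  descending-expand n r = det-expand (λ i j → r (suc n ∸ suc (toℕ i)) j)

  descending-cong : ∀ n {r r′ : ℕ → Fin n → Carrier} → (∀ k j → r k j ≈ r′ k j) → descending n r ≈ descending n r′
  descending-cong n eq = det-cong (λ i j → eq (n ∸ suc (toℕ i)) j)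

  -- All additions happen at once and use the old rows, so this is multiplication by a unitriangular
  -- bidiagonal matrix.
  rowOp : ∀ {n} → Carrier → (ℕ → Fin n → Carrier) → ℕ → Fin n → Carrier
  rowOp e r zero    j = r zero j
  rowOp e r (suc k) j = r (suc k) j + e * r k j

  private
    restrict-rowOp : ∀ {n} e (r : ℕ → Fin (suc n) → Carrier) j k c → restrict j (rowOp e r) k c ≈ rowOp e (restrict j r) k c
    restrict-rowOp e r j zero    c = refl
    restrict-rowOp e r j (suc k) c = refl

  -- The induction restores the rows within every minor of the top row. What the top row has gained
  -- is then a multiple of an old row that still stands directly below it.
  descending-rowOp : ∀ n e (r : ℕ → Fin n → Carrier) → descending n (rowOp e r) ≈ descending n r
  descending-rowOp zero    e r = refl
  descending-rowOp (suc n) e r = begin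
    descending (suc n) (rowOp e r)
      ≈⟨ descending-expand n (rowOp e r) ⟩
    sum (λ j → sgn j * (rowOp e r n j * descending n (restrict j (rowOp e r))))
      ≈⟨ sum-cong (λ j → *-congˡ (*-congˡ (trans
           (descending-cong n (restrict-rowOp e r j)) (descending-rowOp n e (restrict j r))))) ⟩
    sum (λ j → sgn j * (rowOp e r n j * descending n (restrict j r)))
      ≈⟨ top n r ⟩
    sum (λ j → sgn j * (r n j * descending n (restrict j r)))
      ≈⟨ descending-expand n r ⟨
    descending (suc n) r ∎
    where
    top : ∀ n (r : ℕ → Fin (suc n) → Carrier) → sum (λ j → sgn j * (rowOp e r n j * descending n (restrict j r)))
      ≈ sum (λ j → sgn j * (r n j * descending n (restrict j r)))
    top zero    r = refl
    top (suc n) r = begin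
      sum (λ j → sgn j * ((r (suc n) j + e * r n j) * descending (suc n) (restrict j r)))
        ≈⟨ sum-cong (λ j → multiply-out (sgn j) (r (suc n) j) (r n j) _) ⟩
      sum (λ j → sgn j * (r (suc n) j * descending (suc n) (restrict j r)) + e * (sgn j * (r n j * descending (suc n) (restrict j r))))
        ≈⟨ trans (sum-+ _ _) (+-congˡ (sym (*-sum e _))) ⟩
      sum (λ j → sgn j * (r (suc n) j * descending (suc n) (restrict j r))) + e * sum (λ j → sgn j * (r n j * descending (suc n) (restrict j r)))
        ≈⟨ +-congˡ (*-congˡ (trans (sym (det-expand doubled)) (det-equal-rows doubled (λ _ → refl)))) ⟩
      sum (λ j → sgn j * (r (suc n) j * descending (suc n) (restrict j r))) + e * 0#
        ≈⟨ trans (+-congˡ (zeroʳ e)) (+-identityʳ _) ⟩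
      sum (λ j → sgn j * (r (suc n) j * descending (suc n) (restrict j r))) ∎
      where
      -- Row n occurs twice, as the new top row and as the old second row, so the determinant
      -- vanishes.
      doubled : Matrix (suc (suc n))
      doubled zero    j = r n j
      doubled (suc i) j = r (suc n ∸ suc (toℕ i)) j
      multiply-out : ∀ s x y d → s * ((x + e * y) * d) ≈ s * (x * d) + e * (s * (y * d))
      multiply-out s x y d = solve 5 (λ e s x y d → s :* ((x :+ e :* y) :* d) := s :* (x :* d) :+ e :* (s :* (y :* d))) refl e s x y d

  -- Column 0 meets only the bottom row. As expansion runs along the top, that corner is reached by
  -- induction, each row above it contributing one sign.
  descending-column : ∀ n (r : ℕ → Fin (suc n) → Carrier) → (∀ k → r (suc k) zero ≈ 0#) →
    descending (suc n) r ≈ sign n * (r zero zero * descending n (λ k j → r (suc k) (suc j)))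
  descending-column zero r vanish = trans (descending-expand zero r)
    (trans (sum-suc _) (trans (+-congˡ (sum-empty _)) (+-identityʳ _)))
  descending-column (suc n) r vanish = begin
    descending (suc (suc n)) r
      ≈⟨ descending-expand (suc n) r ⟩
    sum (λ j → sgn j * (r (suc n) j * descending (suc n) (restrict j r)))
      ≈⟨ sum-suc _ ⟩
    1# * (r (suc n) zero * _) + sum (λ j → - sgn j * (r (suc n) (suc j) * descending (suc n) (restrict (suc j) r)))
      ≈⟨ +-cong (*-congˡ (trans (*-congʳ (vanish n)) (zeroˡ _)))
           (sum-cong λ j → trans (*-congˡ (*-congˡ (descending-column n (restrict (suc j) r) vanish)))
              (shuffle (sgn j) (r (suc n) (suc j)) (sign n) (r zero zero) _)) ⟩
    1# * 0# + sum (λ j → - sign n * r zero zero * (sgn j * (r (suc n) (suc j) * descending n (restrict j r′))))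
      ≈⟨ trans (+-congʳ (zeroʳ 1#)) (+-identityˡ _) ⟩
    sum (λ j → - sign n * r zero zero * (sgn j * (r (suc n) (suc j) * descending n (restrict j r′))))
      ≈⟨ *-sum _ _ ⟨
    - sign n * r zero zero * sum (λ j → sgn j * (r′ n j * descending n (restrict j r′)))
      ≈⟨ *-congˡ (descending-expand n r′) ⟨
    - sign n * r zero zero * descending (suc n) r′
      ≈⟨ *-assoc _ _ _ ⟩
    - sign n * (r zero zero * descending (suc n) r′) ∎
    where
    r′ : ℕ → Fin (suc n) → Carrier
    r′ k j = r (suc k) (suc j)
    shuffle : ∀ s x t z d → - s * (x * (t * (z * d))) ≈ - t * z * (s * (x * d))
    shuffle = solve 5 (λ s x t z d → :- s :* (x :* (t :* (z :* d))) := :- t :* z :* (s :* (x :* d))) refl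

  pairProduct : ∀ {n} → (Fin n → Fin n → Carrier) → Carrier
  pairProduct {zero}  f = 1#
  pairProduct {suc n} f = ∏ (λ j → f zero (suc j)) * pairProduct (λ i j → f (suc i) (suc j))

  pairProduct-cong : ∀ {n} {f g : Fin n → Fin n → Carrier} → (∀ i j → f i j ≈ g i j) → pairProduct f ≈ pairProduct g
  pairProduct-cong {zero}  eq = refl
  pairProduct-cong {suc n} eq = *-cong (∏-cong λ j → eq zero (suc j)) (pairProduct-cong λ i j → eq (suc i) (suc j))

  pairProduct-* : ∀ {n} (f g : Fin n → Fin n → Carrier) →
    pairProduct (λ i j → f i j * g i j) ≈ pairProduct f * pairProduct g
  pairProduct-* {zero}  f g = sym (*-identityˡ 1#)
  pairProduct-* {suc n} f g = trans
    (*-cong (∏-* _ _) (pairProduct-* (λ i j → f (suc i) (suc j)) (λ i j → g (suc i) (suc j))))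
    (solve 4 (λ a b c d → (a :* b) :* (c :* d) := (a :* c) :* (b :* d)) refl _ _ _ _)

  private
    sign-∏ : ∀ {n} (f : Fin n → Carrier) → sign n * ∏ f ≈ ∏ (λ i → - f i)
    sign-∏ {zero}  f = trans (*-identityˡ _) (trans (∏-empty _) (sym (∏-empty _)))
    sign-∏ {suc n} f = begin
      - sign n * ∏ f                         ≈⟨ *-congˡ (∏-suc f) ⟩
      - sign n * (f zero * ∏ (f ∘ suc))      ≈⟨ solve 3 (λ s a p → :- s :* (a :* p) := :- a :* (s :* p)) refl _ _ _ ⟩
      - f zero * (sign n * ∏ (f ∘ suc))      ≈⟨ *-congˡ (sign-∏ (f ∘ suc)) ⟩
      - f zero * ∏ (λ i → - f (suc i))       ≈⟨ ∏-suc _ ⟨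
      ∏ (λ i → - f i)                        ∎

  -- A Vandermonde determinant for the monic polynomials in w = α + β given by a
  -- three-term recurrence: subtracting w₀ times the next row and adding c times the
  -- one after it turns row p (k + 1) into (w − w₀) p k.
  vandermonde : ∀ n c (α β : Fin n → Carrier) (p : ℕ → Fin n → Carrier) →
    (∀ j → α j * β j ≈ c) → (∀ j → p 0 j ≈ 1#) → (∀ j → p 1 j ≈ α j + β j) →
    (∀ k j → p (suc (suc k)) j ≈ (α j + β j) * p (suc k) j - c * p k j) →
    descending n p ≈ pairProduct (λ i j → (α i + β i) - (α j + β j))
  vandermonde zero    c α β p αβ p₀ p₁ p₂ = refl
  vandermonde (suc n) c α β p αβ p₀ p₁ p₂ = begin
    descending (suc n) p
      ≈⟨ descending-rowOp (suc n) (- α zero) p ⟨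
    descending (suc n) (rowOp (- α zero) p)
      ≈⟨ descending-rowOp (suc n) (- β zero) (rowOp (- α zero) p) ⟨
    descending (suc n) reduced
      ≈⟨ descending-column n reduced (λ k → trans (reduced-suc k zero) (trans (*-congʳ (-‿inverseʳ (w zero))) (zeroˡ _))) ⟩
    sign n * (p 0 zero * descending n (λ k j → reduced (suc k) (suc j)))
      ≈⟨ *-congˡ (trans (*-congʳ (p₀ zero)) (*-identityˡ _)) ⟩
    sign n * descending n (λ k j → reduced (suc k) (suc j))
      ≈⟨ *-congˡ (trans (descending-cong n (λ k j → reduced-suc k (suc j))) (scale-columns (λ j → w (suc j) - w zero) _)) ⟩
    sign n * (∏ (λ j → w (suc j) - w zero) * descending n (λ k j → p k (suc j)))
      ≈⟨ *-assoc _ _ _ ⟨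
    sign n * ∏ (λ j → w (suc j) - w zero) * descending n (λ k j → p k (suc j))
      ≈⟨ *-cong (trans (sign-∏ {n} _) (∏-cong λ j → solve 2 (λ a b → :- (a :- b) := b :- a) refl (w (suc j)) (w zero)))
           (vandermonde n c (α ∘ suc) (β ∘ suc) (λ k j → p k (suc j)) (αβ ∘ suc) (p₀ ∘ suc) (p₁ ∘ suc) (λ k j → p₂ k (suc j))) ⟩
    ∏ (λ j → w zero - w (suc j)) * pairProduct (λ i j → w (suc i) - w (suc j)) ∎
    where
    w : Fin (suc n) → Carrier
    w j = α j + β j
    -- Two simple operations compose to subtracting (α₀ + β₀) times the next row and adding α₀ β₀ =
    -- c times the one after it. This is why the variable w is presented as α + β.
    reduced : ℕ → Fin (suc n) → Carrier
    reduced = rowOp (- β zero) (rowOp (- α zero) p)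
    reduced-suc : ∀ k j → reduced (suc k) j ≈ (w j - w zero) * p k j
    -- No row lies below row 0, so the initial values of `p` take the place of the recurrence, as if
    -- row -1 were zero.
    reduced-suc zero j = begin
      (p 1 j + - α zero * p 0 j) + - β zero * p 0 j
        ≈⟨ +-cong (+-cong (trans (p₁ j) (sym (trans (*-congˡ (p₀ j)) (*-identityʳ (w j))))) refl) refl ⟩
      (w j * p 0 j + - α zero * p 0 j) + - β zero * p 0 j
        ≈⟨ solve 4 (λ w a b p → (w :* p :+ :- a :* p) :+ :- b :* p := (w :- (a :+ b)) :* p) refl (w j) (α zero) (β zero) (p 0 j) ⟩
      (w j - w zero) * p 0 j ∎
    reduced-suc (suc k) j = begin
      (p (suc (suc k)) j + - α zero * p (suc k) j) + - β zero * (p (suc k) j + - α zero * p k j)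
        ≈⟨ +-congʳ (+-congʳ (trans (p₂ k j) (+-congˡ (-‿cong (*-congʳ (sym (αβ zero))))))) ⟩
      ((w j * p (suc k) j - α zero * β zero * p k j) + - α zero * p (suc k) j) + - β zero * (p (suc k) j + - α zero * p k j)
        ≈⟨ solve 5 (λ w a b p q → ((w :* p :- a :* b :* q) :+ :- a :* p) :+ :- b :* (p :+ :- a :* q) := (w :- (a :+ b)) :* p)
             refl (w j) (α zero) (β zero) (p (suc k) j) (p k j) ⟩
      (w j - w zero) * p (suc k) j ∎

  prodL-++ : ∀ xs ys → prodL (xs List.++ ys) ≈ prodL xs * prodL ys
  prodL-++ []       ys = sym (*-identityˡ _)
  prodL-++ (x ∷ xs) ys = trans (*-congˡ (prodL-++ xs ys)) (sym (*-assoc _ _ _))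

  prodL-concatMap : ∀ {A B : Set} (f : B → Carrier) (g : A → List B) xs →
    prodL (List.map f (List.concatMap g xs)) ≈ prodL (List.map (λ x → prodL (List.map f (g x))) xs)
  prodL-concatMap f g []       = refl
  prodL-concatMap f g (x ∷ xs) = trans
    (reflexive (≡.cong prodL (ListP.map-++ f (g x) (List.concatMap g xs))))
    (trans (prodL-++ (List.map f (g x)) _) (*-congˡ (prodL-concatMap f g xs)))

  prodL-pairsLt : ∀ n (f : Fin n × Fin n → Carrier) →
    prodL (List.map f (pairsLt n)) ≈ pairProduct (λ i j → f (i , j))
  prodL-pairsLt n f = trans (prodL-concatMap f _ (List.allFin n)) (trans (prodL-allFin {n} _) (trans
    (∏-cong λ i → trans (prodL-concatMap f _ (List.allFin n)) (prodL-allFin {n} _)) (cells n f)))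
    where
    cell : ∀ n (f : Fin n × Fin n → Carrier) → Fin n → Fin n → Carrier
    cell n f i j = prodL (List.map f (if toℕ i ℕ.<ᵇ toℕ j then (i , j) ∷ [] else []))
    shifted : ∀ {n} (f : Fin (suc n) × Fin (suc n) → Carrier) i j →
      cell (suc n) f (suc i) (suc j) ≈ cell n (λ { (a , b) → f (suc a , suc b) }) i j
    shifted f i j with toℕ i ℕ.<ᵇ toℕ j
    ... | true  = refl
    ... | false = refl
    cells : ∀ n (f : Fin n × Fin n → Carrier) → ∏ (λ i → ∏ (cell n f i)) ≈ pairProduct (λ i j → f (i , j))
    cells zero    f = ∏-empty _
    cells (suc n) f = trans (∏-suc _) (*-cong
      (trans (∏-suc _) (trans (*-identityˡ _) (∏-cong λ j → *-identityʳ _)))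
      (trans (∏-cong λ i → trans (∏-suc _) (trans (*-identityˡ _) (∏-cong λ j → shifted f i j))) (cells n _)))

-- The ring of Laurent polynomials and the regularity of y - ȳ

module Laurent (n : ℕ) where

  open import Data.Nat as ℕ using (zero; suc; z≤n; s≤s)
  import Data.Nat.Properties as ℕP
  open import Data.Integer as ℤ using (ℤ; +_; -[1+_]; 0ℤ; 1ℤ; -1ℤ)
  import Data.Integer.Properties as ℤP
  open import Data.Integer.Solver using (module +-*-Solver)
  open import Data.Fin as Fin using (zero; suc)
  open import Data.Vec as Vec using ([]; _∷_; _[_]≔_)
  import Data.Vec.Properties as VecP
  open import Data.List as List using ([]; _∷_; length)
  open import Data.Product using (_×_; _,_)
  import Data.Product.Properties as ProdP
  open import Data.Bool using (true; false; if_then_else_)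
  open import Data.Empty using (⊥-elim)
  open import Relation.Nullary using (yes; no)
  open import Relation.Nullary.Decidable using (⌊_⌋)
  open import Relation.Binary using (DecidableEquality)
  open import Relation.Binary.PropositionalEquality
  open +-*-Solver using (solve; _:=_; _:+_; _:*_; _:-_; :-_; con)

  _≟ₘ_ : DecidableEquality (Mono n)
  _≟ₘ_ = ProdP.≡-dec ℕ._≟_ (ProdP.≡-dec ℕ._≟_ (VecP.≡-dec ℤ._≟_))

  δ : Mono n → Mono n → ℤ
  δ m m′ = if monoEq m′ m then 1ℤ else 0ℤ

  -- The pairing of a Laurent polynomial with a weight on monomials: equality of
  -- coefficients is the same as equality of all pairings, for which products and
  -- sums are easy to compute.
  ev : (Mono n → ℤ) → Laur n → ℤ
  ev w []            = 0ℤ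
  ev w ((c , m) ∷ p) = c ℤ.* w m ℤ.+ ev w p

  infix 4 _≈_
  -- A record instead of a function type, so that `p` and `q` remain visible in the type of a proof
  -- and can be inferred.
  record _≈_ (p q : Laur n) : Set where
    constructor mk
    field pairing : ∀ w → ev w p ≡ ev w q
  open _≈_ public

  coeff-ev : ∀ p m → coeffL p m ≡ ev (δ m) p
  coeff-ev []             m = refl
  coeff-ev ((c , m′) ∷ p) m = cong₂ ℤ._+_ (lemma (monoEq m′ m)) (coeff-ev p m)
    where
    lemma : ∀ b → (if b then c else 0ℤ) ≡ c ℤ.* (if b then 1ℤ else 0ℤ)
    lemma true  = sym (ℤP.*-identityʳ c)
    lemma false = sym (ℤP.*-zeroʳ c)

  ev-cong : ∀ {w v} → (∀ m → w m ≡ v m) → ∀ p → ev w p ≡ ev v p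
  ev-cong eq []            = refl
  ev-cong eq ((c , m) ∷ p) = cong₂ (λ x y → c ℤ.* x ℤ.+ y) (eq m) (ev-cong eq p)

  ev-++ : ∀ w p q → ev w (p +L q) ≡ ev w p ℤ.+ ev w q
  ev-++ w []            q = sym (ℤP.+-identityˡ _)
  ev-++ w ((c , m) ∷ p) q = trans (cong (λ x → c ℤ.* w m ℤ.+ x) (ev-++ w p q)) (sym (ℤP.+-assoc (c ℤ.* w m) _ _))

  ev-neg : ∀ w p → ev w (-L p) ≡ ℤ.- ev w p
  ev-neg w []            = refl
  ev-neg w ((c , m) ∷ p) = trans (cong (λ x → ℤ.- c ℤ.* w m ℤ.+ x) (ev-neg w p))
    (solve 3 (λ c x y → :- c :* x :+ :- y := :- (c :* x :+ y)) refl c (w m) (ev w p))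

  ev-+ : ∀ w v p → ev (λ m → w m ℤ.+ v m) p ≡ ev w p ℤ.+ ev v p
  ev-+ w v []            = refl
  ev-+ w v ((c , m) ∷ p) = trans (cong (λ x → c ℤ.* (w m ℤ.+ v m) ℤ.+ x) (ev-+ w v p))
    (solve 5 (λ c a b x y → c :* (a :+ b) :+ (x :+ y) := (c :* a :+ x) :+ (c :* b :+ y)) refl c (w m) (v m) (ev w p) (ev v p))

  ev-* : ∀ a w p → ev (λ m → a ℤ.* w m) p ≡ a ℤ.* ev w p
  ev-* a w []            = sym (ℤP.*-zeroʳ a)
  ev-* a w ((c , m) ∷ p) = trans (cong (λ x → c ℤ.* (a ℤ.* w m) ℤ.+ x) (ev-* a w p))
    (solve 4 (λ a c x y → c :* (a :* x) :+ a :* y := a :* (c :* x :+ y)) refl a c (w m) (ev w p))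

  ev-0 : ∀ p → ev (λ _ → 0ℤ) p ≡ 0ℤ
  ev-0 []            = refl
  ev-0 ((c , m) ∷ p) = trans (cong₂ ℤ._+_ (ℤP.*-zeroʳ c) (ev-0 p)) refl

  ev-comm : ∀ (f : Mono n → Mono n → ℤ) p q →
    ev (λ m → ev (f m) q) p ≡ ev (λ m′ → ev (λ m → f m m′) p) q
  ev-comm f []            q = sym (ev-0 q)
  ev-comm f ((c , m) ∷ p) q = trans (cong₂ ℤ._+_ (sym (ev-* c (f m) q)) (ev-comm f p q)) (sym (ev-+ _ _ q))

  private
    -- The function is arbitrary and described only by its values, because the pattern-matching
    -- functions inside `_*L_` cannot be written down again; unification supplies them.
    ev-map : ∀ w (f : ℤ × Mono n → ℤ × Mono n) a m → (∀ b m′ → f (b , m′) ≡ (a ℤ.* b , monoMul m m′)) →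
      ∀ q → ev w (List.map f q) ≡ a ℤ.* ev (λ m′ → w (monoMul m m′)) q
    ev-map w f a m eq []             = sym (ℤP.*-zeroʳ a)
    ev-map w f a m eq ((b , m′) ∷ q) rewrite eq b m′ | ev-map w f a m eq q =
      solve 4 (λ a b x y → a :* b :* x :+ a :* y := a :* (b :* x :+ y)) refl a b (w (monoMul m m′)) _

    ev-concatMap : ∀ w (F : ℤ × Mono n → Laur n) q →
      (∀ a m → ev w (F (a , m)) ≡ a ℤ.* ev (λ m′ → w (monoMul m m′)) q) →
      ∀ p → ev w (List.concatMap F p) ≡ ev (λ m → ev (λ m′ → w (monoMul m m′)) q) p
    ev-concatMap w F q eq []            = refl
    ev-concatMap w F q eq ((a , m) ∷ p) = trans (ev-++ w (F (a , m)) (List.concatMap F p))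
      (cong₂ ℤ._+_ (eq a m) (ev-concatMap w F q eq p))

  ev-product : ∀ w p q → ev w (p *L q) ≡ ev (λ m → ev (λ m′ → w (monoMul m m′)) q) p
  ev-product w p q = ev-concatMap w _ q (λ a m → ev-map w _ a m (λ _ _ → refl) q) p

  private
    remove : Mono n → Laur n → Laur n
    remove m [] = []
    remove m ((c , m′) ∷ p) with m′ ≟ₘ m
    ... | yes _ = remove m p
    ... | no  _ = (c , m′) ∷ remove m p

    length-remove : ∀ m p → length (remove m p) ℕ.≤ length p
    length-remove m [] = z≤n
    length-remove m ((c , m′) ∷ p) with m′ ≟ₘ m
    ... | yes _ = ℕP.m≤n⇒m≤1+n (length-remove m p)
    ... | no  _ = s≤s (length-remove m p)

    ev-remove : ∀ w m p → ev w p ≡ coeffL p m ℤ.* w m ℤ.+ ev w (remove m p)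
    ev-remove w m [] = refl
    ev-remove w m ((c , m′) ∷ p) with m′ ≟ₘ m
    ... | yes refl = trans (cong (λ x → c ℤ.* w m ℤ.+ x) (ev-remove w m p))
      (solve 4 (λ c k x y → c :* x :+ (k :* x :+ y) := (c :+ k) :* x :+ y) refl c (coeffL p m) (w m) (ev w (remove m p)))
    ... | no _ = trans (cong (λ x → c ℤ.* w m′ ℤ.+ x) (ev-remove w m p))
      (solve 5 (λ c k x y z → c :* z :+ (k :* x :+ y) := (con 0ℤ :+ k) :* x :+ (c :* z :+ y)) refl c (coeffL p m) (w m) (ev w (remove m p)) (w m′))

    -- All terms with the monomial of the head are collected: together they contribute that
    -- coefficient, which is zero, and removing them leaves the other coefficients zero. The bound
    -- `k` on the length makes the recursion structural.
    ev-vanish : ∀ k p → length p ℕ.≤ k → (∀ m → coeffL p m ≡ 0ℤ) → ∀ w → ev w p ≡ 0ℤ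
    ev-vanish k       []                _         eq w = refl
    ev-vanish (suc k) p′@((c , m) ∷ p) (s≤s len) eq w = begin
      ev w p′                                          ≡⟨ ev-remove w m p′ ⟩
      coeffL p′ m ℤ.* w m ℤ.+ ev w (remove m p′)       ≡⟨ cong (λ x → x ℤ.* w m ℤ.+ ev w (remove m p′)) (eq m) ⟩
      0ℤ ℤ.+ ev w (remove m p′)                        ≡⟨ ℤP.+-identityˡ _ ⟩
      ev w (remove m p′)                               ≡⟨ ev-vanish k (remove m p′) short vanish w ⟩
      0ℤ                                               ∎
      where
      open ≡-Reasoning
      short : length (remove m p′) ℕ.≤ k
      short with m ≟ₘ m
      ... | yes _  = ℕP.≤-trans (length-remove m p) len
      ... | no m≢m = ⊥-elim (m≢m refl)
      vanish : ∀ m₁ → coeffL (remove m p′) m₁ ≡ 0ℤ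
      vanish m₁ = begin
        coeffL (remove m p′) m₁                                  ≡⟨ coeff-ev (remove m p′) m₁ ⟩
        ev (δ m₁) (remove m p′)                                  ≡⟨ ℤP.+-identityˡ _ ⟨
        0ℤ ℤ.* δ m₁ m ℤ.+ ev (δ m₁) (remove m p′)                ≡⟨ cong (λ x → x ℤ.* δ m₁ m ℤ.+ ev (δ m₁) (remove m p′)) (eq m) ⟨
        coeffL p′ m ℤ.* δ m₁ m ℤ.+ ev (δ m₁) (remove m p′)       ≡⟨ ev-remove (δ m₁) m p′ ⟨
        ev (δ m₁) p′                                             ≡⟨ coeff-ev p′ m₁ ⟨
        coeffL p′ m₁                                             ≡⟨ eq m₁ ⟩
        0ℤ                                                       ∎

  ev-sub : ∀ w p q → ev w (p -L q) ≡ ev w p ℤ.- ev w q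
  ev-sub w p q = trans (ev-++ w p (-L q)) (cong (λ x → ev w p ℤ.+ x) (ev-neg w q))

  -- A pairing is defined on lists with possibly repeated monomials; that it depends on the
  -- coefficients alone follows by applying `ev-vanish` to the difference.
  fromL : ∀ {p q : Laur n} → p ≈L q → p ≈ q
  fromL {p} {q} eq = mk λ w → ℤP.i-j≡0⇒i≡j (ev w p) (ev w q)
    (trans (sym (ev-sub w p q)) (ev-vanish (length (p -L q)) (p -L q) ℕP.≤-refl
      (λ m → trans (coeff-ev (p -L q) m) (trans (ev-sub (δ m) p q)
        (ℤP.i≡j⇒i-j≡0 (trans (sym (coeff-ev p m)) (trans (eq m) (coeff-ev q m)))))) w))

  toL : ∀ {p q : Laur n} → p ≈ q → p ≈L q
  toL {p} {q} eq m = trans (coeff-ev p m) (trans (pairing eq (δ m)) (sym (coeff-ev q m)))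

  monoMul-assoc : ∀ (m m′ m″ : Mono n) → monoMul (monoMul m m′) m″ ≡ monoMul m (monoMul m′ m″)
  monoMul-assoc (a , b , e) (a′ , b′ , e′) (a″ , b″ , e″) =
    cong₂ _,_ (ℕP.+-assoc a a′ a″) (cong₂ _,_ (ℕP.+-assoc b b′ b″) (VecP.zipWith-assoc ℤP.+-assoc e e′ e″))

  monoMul-comm : ∀ (m m′ : Mono n) → monoMul m m′ ≡ monoMul m′ m
  monoMul-comm (a , b , e) (a′ , b′ , e′) =
    cong₂ _,_ (ℕP.+-comm a a′) (cong₂ _,_ (ℕP.+-comm b b′) (VecP.zipWith-comm ℤP.+-comm e e′))

  monoMul-identity : ∀ (m : Mono n) → monoMul (0 , 0 , Vec.replicate n 0ℤ) m ≡ m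
  monoMul-identity (a , b , e) = cong (λ e → a , b , e) (VecP.zipWith-identityˡ ℤP.+-identityˡ e)

  private
    product-cong : ∀ {p p′ q q′} → p ≈ p′ → q ≈ q′ → p *L q ≈ p′ *L q′
    product-cong {p} {p′} {q} {q′} ep eq = mk λ w → trans (ev-product w p q) (trans (pairing ep _)
      (trans (ev-cong (λ m → pairing eq (λ m′ → w (monoMul m m′))) p′) (sym (ev-product w p′ q′))))

    product-comm : ∀ p q → p *L q ≈ q *L p
    product-comm p q = mk λ w → trans (ev-product w p q) (trans
      (ev-comm (λ m m′ → w (monoMul m m′)) p q)
      (trans (ev-cong (λ m′ → ev-cong (λ m → cong w (monoMul-comm m m′)) p) q) (sym (ev-product w q p))))

    product-identity : ∀ p → 1L *L p ≈ p
    product-identity p = mk λ w → trans (ev-product w 1L p) (trans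
      (trans (ℤP.+-identityʳ _) (ℤP.*-identityˡ _)) (ev-cong (λ m → cong w (monoMul-identity m)) p))

    product-assoc : ∀ p q r → (p *L q) *L r ≈ p *L (q *L r)
    product-assoc p q r = mk λ w → begin
      ev w ((p *L q) *L r)
        ≡⟨ ev-product w (p *L q) r ⟩
      ev (λ m → ev (λ m″ → w (monoMul m m″)) r) (p *L q)
        ≡⟨ ev-product _ p q ⟩
      ev (λ m → ev (λ m′ → ev (λ m″ → w (monoMul (monoMul m m′) m″)) r) q) p
        ≡⟨ ev-cong (λ m → trans
             (ev-cong (λ m′ → ev-cong (λ m″ → cong w (monoMul-assoc m m′ m″)) r) q)
             (sym (ev-product (λ m₁ → w (monoMul m m₁)) q r))) p ⟩
      ev (λ m → ev (λ m₁ → w (monoMul m m₁)) (q *L r)) p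
        ≡⟨ ev-product w p (q *L r) ⟨
      ev w (p *L (q *L r)) ∎
      where open ≡-Reasoning

    product-distribˡ : ∀ p q r → p *L (q +L r) ≈ (p *L q) +L (p *L r)
    product-distribˡ p q r = mk λ w → trans (ev-product w p (q +L r)) (trans
      (ev-cong (λ m → ev-++ (λ m′ → w (monoMul m m′)) q r) p) (trans
      (ev-+ _ _ p) (trans (cong₂ ℤ._+_ (sym (ev-product w p q)) (sym (ev-product w p r)))
      (sym (ev-++ w (p *L q) (p *L r))))))

    ≈-sym : ∀ {p q} → p ≈ q → q ≈ p
    ≈-sym e = mk λ w → sym (pairing e w)

    ≈-trans : ∀ {p q r} → p ≈ q → q ≈ r → p ≈ r
    ≈-trans e f = mk λ w → trans (pairing e w) (pairing f w)

    sum-cong : ∀ {p p′ q q′} → p ≈ p′ → q ≈ q′ → p +L q ≈ p′ +L q′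
    sum-cong {p} {p′} {q} {q′} ep eq = mk λ w → trans (ev-++ w p q)
      (trans (cong₂ ℤ._+_ (pairing ep w) (pairing eq w)) (sym (ev-++ w p′ q′)))

  laurent : CommutativeRing 0ℓ 0ℓ
  laurent = record
    { Carrier = Laur n
    ; _≈_ = _≈_
    ; _+_ = _+L_
    ; _*_ = _*L_
    ; -_ = -L_
    ; 0# = 0L
    ; 1# = 1L
    ; isCommutativeRing = record
      { isRing = record
        { +-isAbelianGroup = record
          { isGroup = record
            { isMonoid = record
              { isSemigroup = record
                { isMagma = record
                  { isEquivalence = record
                    { refl = mk λ _ → refl
                    ; sym = ≈-sym
                    ; trans = ≈-trans
                    }
                  ; ∙-cong = sum-cong
                  }
                ; assoc = λ p q r → mk λ w → trans (ev-++ w (p +L q) r) (trans (cong (ℤ._+ ev w r) (ev-++ w p q))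
                    (trans (ℤP.+-assoc (ev w p) (ev w q) (ev w r)) (sym (trans (ev-++ w p (q +L r)) (cong (λ x → ev w p ℤ.+ x) (ev-++ w q r))))))
                }
              ; identity = (λ p → mk λ w → refl) , (λ p → mk λ w → trans (ev-++ w p 0L) (ℤP.+-identityʳ _))
              }
            ; inverse = (λ p → mk λ w → trans (ev-++ w (-L p) p) (trans (cong (ℤ._+ ev w p) (ev-neg w p)) (ℤP.+-inverseˡ (ev w p))))
                      , (λ p → mk λ w → trans (ev-sub w p p) (ℤP.+-inverseʳ (ev w p)))
            ; ⁻¹-cong = λ {p} {q} e → mk λ w → trans (ev-neg w p) (trans (cong ℤ.-_ (pairing e w)) (sym (ev-neg w q)))
            }
          ; comm = λ p q → mk λ w → trans (ev-++ w p q) (trans (ℤP.+-comm (ev w p) (ev w q)) (sym (ev-++ w q p)))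
          }
        ; *-cong = product-cong
        ; *-assoc = product-assoc
        ; *-identity = product-identity , (λ p → ≈-trans (product-comm p 1L) (product-identity p))
        ; distrib = product-distribˡ , (λ p q r → ≈-trans (product-comm (q +L r) p) (≈-trans (product-distribˡ p q r) (sum-cong (product-comm p q) (product-comm p r))))
        }
      ; *-comm = product-comm
      }
    }

  private
    zipWith-tabulate : ∀ {k} (f g : Fin k → ℤ) →
      Vec.zipWith ℤ._+_ (Vec.tabulate f) (Vec.tabulate g) ≡ Vec.tabulate (λ i → f i ℤ.+ g i)
    zipWith-tabulate {zero}  f g = refl
    zipWith-tabulate {suc k} f g = cong (f zero ℤ.+ g zero ∷_) (zipWith-tabulate (λ i → f (suc i)) (λ i → g (suc i)))

    tabulate-const : ∀ {k} (f : Fin k → ℤ) → (∀ i → f i ≡ 0ℤ) → Vec.tabulate f ≡ Vec.replicate k 0ℤ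
    tabulate-const {zero}  f eq = refl
    tabulate-const {suc k} f eq = cong₂ _∷_ (eq zero) (tabulate-const (λ i → f (suc i)) (λ i → eq (suc i)))

    ≡⇒≈ : ∀ {p q} → p ≡ q → p ≈ q
    ≡⇒≈ refl = mk λ _ → refl

  yPow-* : ∀ j a b → yPow j a *L yPow j b ≈ yPow j (a ℤ.+ b)
  yPow-* j a b = ≡⇒≈ (cong (λ e → (1ℤ , 0 , 0 , e) ∷ []) (trans (zipWith-tabulate _ _)
    (VecP.tabulate-cong λ l → lemma ⌊ l Fin.≟ j ⌋)))
    where
    lemma : ∀ c → (if c then a else 0ℤ) ℤ.+ (if c then b else 0ℤ) ≡ (if c then a ℤ.+ b else 0ℤ)
    lemma true  = refl
    lemma false = refl

  yPow-0 : ∀ j → yPow j 0ℤ ≈ 1L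
  yPow-0 j = ≡⇒≈ (cong (λ e → (1ℤ , 0 , 0 , e) ∷ []) (tabulate-const _ λ l → lemma ⌊ l Fin.≟ j ⌋))
    where
    lemma : ∀ c → (if c then 0ℤ else 0ℤ) ≡ 0ℤ
    lemma true  = refl
    lemma false = refl

  tuPow-* : ∀ a b c d → tuPow {n} a b *L tuPow c d ≈ tuPow (a ℕ.+ c) (b ℕ.+ d)
  tuPow-* a b c d = ≡⇒≈ (cong (λ e → (1ℤ , a ℕ.+ c , b ℕ.+ d , e) ∷ []) (VecP.zipWith-identityˡ ℤP.+-identityˡ _))

  -- The weight h is chosen with h (d + 1) − h (d − 1) = [d = 0], so that pairing
  -- (y − ȳ) p with h (exponent of y) reads off a single coefficient of p.
  private
    odd : ℕ → ℤ
    odd 0             = 0ℤ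
    odd 1             = 1ℤ
    odd (suc (suc k)) = odd k

    h : ℤ → ℤ
    h (+ k)    = odd k
    h -[1+ k ] = 0ℤ

    h-step-zero : ∀ d → d ≢ 0ℤ → h (1ℤ ℤ.+ d) ≡ h (-1ℤ ℤ.+ d)
    h-step-zero (+ 0) d≢0           = ⊥-elim (d≢0 refl)
    h-step-zero (+ 1) _             = refl
    h-step-zero (+ suc (suc k)) _   = refl
    h-step-zero -[1+ 0 ] _          = refl
    h-step-zero -[1+ suc k ] _      = refl

    shift : Fin n → ℤ → Vec ℤ n → Vec ℤ n
    shift j k = Vec.zipWith ℤ._+_ (Vec.tabulate (λ l → if ⌊ l Fin.≟ j ⌋ then k else 0ℤ))

    lookup-shift : ∀ j k e l → Vec.lookup (shift j k e) l ≡ (if ⌊ l Fin.≟ j ⌋ then k else 0ℤ) ℤ.+ Vec.lookup e l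
    lookup-shift j k e l = trans (VecP.lookup-zipWith ℤ._+_ l (Vec.tabulate (λ l → if ⌊ l Fin.≟ j ⌋ then k else 0ℤ)) e)
      (cong (ℤ._+ Vec.lookup e l) (VecP.lookup∘tabulate _ l))

    ext : ∀ {k} {A : Set} (e e′ : Vec A k) → (∀ i → Vec.lookup e i ≡ Vec.lookup e′ i) → e ≡ e′
    ext []      []        eq = refl
    ext (x ∷ e) (x′ ∷ e′) eq = cong₂ _∷_ (eq zero) (ext e e′ (λ i → eq (suc i)))

    shift-update : ∀ j k e x → shift j k e [ j ]≔ x ≡ e [ j ]≔ x
    shift-update j k e x = ext _ _ same
      where
      same : ∀ l → Vec.lookup (shift j k e [ j ]≔ x) l ≡ Vec.lookup (e [ j ]≔ x) l
      same l with l Fin.≟ j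
      ... | yes refl = trans (VecP.lookup∘updateAt l (shift l k e)) (sym (VecP.lookup∘updateAt l e))
      ... | no  l≢j  = trans (VecP.lookup∘updateAt′ l j l≢j (shift j k e)) (trans (off l≢j) (sym (VecP.lookup∘updateAt′ l j l≢j e)))
        where
        off : l ≢ j → Vec.lookup (shift j k e) l ≡ Vec.lookup e l
        off l≢j with l Fin.≟ j | lookup-shift j k e l
        ... | yes l≡j | _  = ⊥-elim (l≢j l≡j)
        ... | no  _   | eq = trans eq (ℤP.+-identityˡ _)

    lookup-shift-self : ∀ j k e → Vec.lookup (shift j k e) j ≡ k ℤ.+ Vec.lookup e j
    lookup-shift-self j k e with j Fin.≟ j | lookup-shift j k e j
    ... | yes _  | eq = eq
    ... | no j≢j | _  = ⊥-elim (j≢j refl)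

    module _ (j : Fin n) (a₀ b₀ : ℕ) (e₀ : Vec ℤ n) where
      -- Overwriting the exponent of yⱼ by that of the target tests all the other exponents for
      -- equality, while `h` measures the distance of the overwritten one.
      weight : Mono n → ℤ
      weight (a , b , e) = h (Vec.lookup e j ℤ.- Vec.lookup e₀ j) ℤ.* δ (a₀ , b₀ , e₀) (a , b , e [ j ]≔ Vec.lookup e₀ j)

      weight-shift : ∀ k a b e → weight (a , b , shift j k e) ≡
        h (k ℤ.+ (Vec.lookup e j ℤ.- Vec.lookup e₀ j)) ℤ.* δ (a₀ , b₀ , e₀) (a , b , e [ j ]≔ Vec.lookup e₀ j)
      weight-shift k a b e = cong₂ (λ x v → h x ℤ.* δ (a₀ , b₀ , e₀) (a , b , v))
        (trans (cong (ℤ._- Vec.lookup e₀ j) (lookup-shift-self j k e)) (ℤP.+-assoc k _ _))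
        (shift-update j k e (Vec.lookup e₀ j))

      weight-difference : ∀ a b e →
        weight (a , b , shift j 1ℤ e) ℤ.- weight (a , b , shift j -1ℤ e) ≡ δ (a₀ , b₀ , e₀) (a , b , e)
      weight-difference a b e = trans (cong₂ ℤ._-_ (weight-shift 1ℤ a b e) (weight-shift -1ℤ a b e)) difference
        where
        d = Vec.lookup e j ℤ.- Vec.lookup e₀ j
        v = e [ j ]≔ Vec.lookup e₀ j
        difference : h (1ℤ ℤ.+ d) ℤ.* δ (a₀ , b₀ , e₀) (a , b , v) ℤ.- h (-1ℤ ℤ.+ d) ℤ.* δ (a₀ , b₀ , e₀) (a , b , v)
          ≡ δ (a₀ , b₀ , e₀) (a , b , e)
        difference with Vec.lookup e j ℤ.≟ Vec.lookup e₀ j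
        ... | yes eq rewrite ℤP.i≡j⇒i-j≡0 eq | sym eq | VecP.[]≔-lookup e j =
          solve 1 (λ x → con 1ℤ :* x :- con 0ℤ :* x := x) refl _
        ... | no ne rewrite h-step-zero d (λ d≡0 → ne (ℤP.i-j≡0⇒i≡j _ _ d≡0)) = trans (ℤP.+-inverseʳ (h (-1ℤ ℤ.+ d) ℤ.* δ (a₀ , b₀ , e₀) (a , b , v))) (sym off)
          where
          off : δ (a₀ , b₀ , e₀) (a , b , e) ≡ 0ℤ
          off with (a , b , e) ≟ₘ (a₀ , b₀ , e₀)
          ... | yes refl = ⊥-elim (ne refl)
          ... | no  _    = refl

  y-ȳ-regular : ∀ j p → (yL j -L ybarL j) *L p ≈ 0L → p ≈ 0L
  y-ȳ-regular j p eq = fromL λ { (a₀ , b₀ , e₀) → coefficient a₀ b₀ e₀ }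
    where
    coefficient : ∀ a₀ b₀ e₀ → coeffL p (a₀ , b₀ , e₀) ≡ 0ℤ
    coefficient a₀ b₀ e₀ = begin
      coeffL p (a₀ , b₀ , e₀)
        ≡⟨ coeff-ev p _ ⟩
      ev (δ (a₀ , b₀ , e₀)) p
        ≡⟨ ev-cong (λ { (a , b , e) → sym (weight-difference j a₀ b₀ e₀ a b e) }) p ⟩
      ev (λ m → plus m ℤ.- minus m) p
        ≡⟨ ev-cong (λ m → cong (λ x → plus m ℤ.+ x) (sym (ℤP.-1*i≡-i (minus m)))) p ⟩
      ev (λ m → plus m ℤ.+ -1ℤ ℤ.* minus m) p
        ≡⟨ trans (ev-+ plus (λ m → -1ℤ ℤ.* minus m) p) (cong (λ x → ev plus p ℤ.+ x) (ev-* -1ℤ minus p)) ⟩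
      ev plus p ℤ.+ -1ℤ ℤ.* ev minus p
        -- This is the shape to which `ev` reduces on the two-term list `yL j -L ybarL j`.
        ≡⟨ solve 2 (λ x y → x :+ con -1ℤ :* y := con 1ℤ :* x :+ (con -1ℤ :* y :+ con 0ℤ)) refl (ev plus p) (ev minus p) ⟩
      1ℤ ℤ.* ev plus p ℤ.+ (-1ℤ ℤ.* ev minus p ℤ.+ 0ℤ)
        ≡⟨ cong₂ (λ x y → 1ℤ ℤ.* x ℤ.+ (-1ℤ ℤ.* y ℤ.+ 0ℤ)) (ev-cong (λ { (a , b , e) → refl }) p) (ev-cong (λ { (a , b , e) → refl }) p) ⟩
      ev (λ m → ev (λ m′ → w (monoMul m m′)) p) (yL j -L ybarL j)
        ≡⟨ ev-product w (yL j -L ybarL j) p ⟨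
      ev w ((yL j -L ybarL j) *L p)
        ≡⟨ pairing eq w ⟩
      0ℤ ∎
      where
      open ≡-Reasoning
      w plus minus : Mono n → ℤ
      w = weight j a₀ b₀ e₀
      plus  (a , b , e) = w (a , b , shift j 1ℤ e)
      minus (a , b , e) = w (a , b , shift j -1ℤ e)

-- Formal power series and their truncations as commutative rings

module Series (R : CommutativeRing 0ℓ 0ℓ) where

  open import Data.Nat as ℕ using (zero; suc; _∸_)
  import Data.Nat.Properties as ℕP
  open import Data.Vec as Vec using (Vec; []; _∷_)
  import Data.Vec.Properties as VecP
  open import Data.List as List using (List; []; _∷_)
  import Data.List.Properties as ListP
  open import Data.Product using (∃; _,_)
  open import Data.Sum using (_⊎_; inj₁; inj₂)
  open import Data.Bool using (if_then_else_)
  open import Data.Empty using (⊥-elim)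
  open import Function using (_∘_; flip)
  open import Relation.Nullary using (yes; no)
  open import Relation.Nullary.Decidable using (⌊_⌋)
  open import Relation.Binary.PropositionalEquality as ≡ using (_≡_; _≢_)
  import Relation.Binary.Reasoning.Setoid
  import Algebra.Properties.CommutativeSemigroup

  open CommutativeRing R hiding (zero)
  open Defs.Ops 0# 1# _+_ _*_ -_ using (sumL)
  open Relation.Binary.Reasoning.Setoid setoid
  open Algebra.Properties.CommutativeSemigroup +-commutativeSemigroup using (interchange)

  -- The sum over all b + c = a. Giving c its own argument keeps truncated subtraction out of the
  -- ring laws.
  conv₁ : ℕ → (ℕ → ℕ → Carrier) → Carrier
  conv₁ zero    h = h 0 0
  conv₁ (suc a) h = h 0 (suc a) + conv₁ a (λ b c → h (suc b) c)

  conv₁-cong : ∀ a {h h′} → (∀ b c → b ℕ.+ c ≡ a → h b c ≈ h′ b c) → conv₁ a h ≈ conv₁ a h′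
  conv₁-cong zero    eq = eq 0 0 ≡.refl
  conv₁-cong (suc a) eq = +-cong (eq 0 (suc a) ≡.refl) (conv₁-cong a λ b c b+c≡a → eq (suc b) c (≡.cong suc b+c≡a))

  conv₁-+ : ∀ a h h′ → conv₁ a (λ b c → h b c + h′ b c) ≈ conv₁ a h + conv₁ a h′
  conv₁-+ zero    h h′ = refl
  conv₁-+ (suc a) h h′ = trans (+-congˡ (conv₁-+ a (λ b → h (suc b)) (λ b → h′ (suc b)))) (interchange _ _ _ _)

  conv₁-0 : ∀ a h → (∀ b c → h b c ≈ 0#) → conv₁ a h ≈ 0#
  conv₁-0 zero    h eq = eq 0 0
  conv₁-0 (suc a) h eq = trans (+-cong (eq 0 (suc a)) (conv₁-0 a _ λ b c → eq (suc b) c)) (+-identityˡ 0#)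

  conv₁-* : ∀ a x h → conv₁ a (λ b c → x * h b c) ≈ x * conv₁ a h
  conv₁-* zero    x h = refl
  conv₁-* (suc a) x h = trans (+-congˡ (conv₁-* a x (λ b → h (suc b)))) (sym (distribˡ x _ _))

  conv₁-last : ∀ a h → conv₁ (suc a) h ≈ conv₁ a (λ b c → h b (suc c)) + h (suc a) 0
  conv₁-last zero    h = refl
  conv₁-last (suc a) h = trans (+-congˡ (conv₁-last a (λ b → h (suc b)))) (sym (+-assoc _ _ _))

  conv₁-comm : ∀ a h → conv₁ a h ≈ conv₁ a (flip h)
  conv₁-comm zero    h = refl
  conv₁-comm (suc a) h = begin
    h 0 (suc a) + conv₁ a (λ b c → h (suc b) c)       ≈⟨ +-congˡ (conv₁-comm a _) ⟩
    h 0 (suc a) + conv₁ a (λ b c → h (suc c) b)       ≈⟨ +-comm _ _ ⟩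
    conv₁ a (λ b c → h (suc c) b) + h 0 (suc a)       ≈⟨ conv₁-last a (flip h) ⟨
    conv₁ (suc a) (flip h)                            ∎

  -- Both sides run over the triples with total `a`, grouped differently. Once the terms with d = 0
  -- are split off, the same statement with a smaller total remains.
  conv₁-assoc : ∀ a (h : ℕ → ℕ → ℕ → Carrier) →
    conv₁ a (λ b c → conv₁ b (λ d e → h d e c)) ≈ conv₁ a (λ d b → conv₁ b (λ e c → h d e c))
  conv₁-assoc zero    h = refl
  conv₁-assoc (suc a) h = begin
    h 0 0 (suc a) + conv₁ a (λ b c → h 0 (suc b) c + conv₁ b (λ d e → h (suc d) e c))
      ≈⟨ trans (+-congˡ (conv₁-+ a _ _)) (sym (+-assoc _ _ _)) ⟩
    conv₁ (suc a) (h 0) + conv₁ a (λ b c → conv₁ b (λ d e → h (suc d) e c))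
      ≈⟨ +-congˡ (conv₁-assoc a (λ d → h (suc d))) ⟩
    conv₁ (suc a) (h 0) + conv₁ a (λ d b → conv₁ b (λ e c → h (suc d) e c)) ∎

  conv : ∀ {n} → Vec ℕ n → (Vec ℕ n → Vec ℕ n → Carrier) → Carrier
  conv []      h = h [] []
  conv (a ∷ α) h = conv₁ a (λ b c → conv α (λ β γ → h (b ∷ β) (c ∷ γ)))

  -- The summands are compared only where the exponents add up to `α`; every degree bound on the
  -- factors of a product comes from this restriction.
  conv-cong : ∀ {n} (α : Vec ℕ n) {h h′} →
    (∀ β γ → Vec.zipWith ℕ._+_ β γ ≡ α → h β γ ≈ h′ β γ) → conv α h ≈ conv α h′
  conv-cong []      eq = eq [] [] ≡.refl
  conv-cong (a ∷ α) eq = conv₁-cong a λ b c b+c≡a → conv-cong α λ β γ β+γ≡α →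
    eq (b ∷ β) (c ∷ γ) (≡.cong₂ _∷_ b+c≡a β+γ≡α)

  sum-zipWith-+ : ∀ {n} (β γ : Vec ℕ n) → Vec.sum (Vec.zipWith ℕ._+_ β γ) ≡ Vec.sum β ℕ.+ Vec.sum γ
  sum-zipWith-+ []      []      = ≡.refl
  sum-zipWith-+ (b ∷ β) (c ∷ γ) = ≡.trans (≡.cong (b ℕ.+ c ℕ.+_) (sum-zipWith-+ β γ))
    (Algebra.Properties.CommutativeSemigroup.interchange ℕP.+-commutativeSemigroup b c _ _)

  degrees : ∀ {n} {α β γ : Vec ℕ n} → Vec.zipWith ℕ._+_ β γ ≡ α → Vec.sum β ℕ.+ Vec.sum γ ≡ Vec.sum α
  degrees {β = β} {γ} ≡.refl = ≡.sym (sum-zipWith-+ β γ)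

  conv-+ : ∀ {n} (α : Vec ℕ n) h h′ → conv α (λ β γ → h β γ + h′ β γ) ≈ conv α h + conv α h′
  conv-+ []      h h′ = refl
  conv-+ (a ∷ α) h h′ = trans (conv₁-cong a λ b c _ → conv-+ α _ _) (conv₁-+ a _ _)

  conv-0 : ∀ {n} (α : Vec ℕ n) h → (∀ β γ → h β γ ≈ 0#) → conv α h ≈ 0#
  conv-0 []      h eq = eq [] []
  conv-0 (a ∷ α) h eq = conv₁-0 a _ λ b c → conv-0 α _ λ β γ → eq (b ∷ β) (c ∷ γ)

  conv-* : ∀ {n} (α : Vec ℕ n) x h → conv α (λ β γ → x * h β γ) ≈ x * conv α h
  conv-* []      x h = refl
  conv-* (a ∷ α) x h = trans (conv₁-cong a λ b c _ → conv-* α x _) (conv₁-* a x _)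

  conv-comm : ∀ {n} (α : Vec ℕ n) h → conv α h ≈ conv α (flip h)
  conv-comm []      h = refl
  conv-comm (a ∷ α) h = trans (conv₁-comm a _) (conv₁-cong a λ b c _ → conv-comm α _)

  conv-conv₁ : ∀ {n} (α : Vec ℕ n) a (h : Vec ℕ n → Vec ℕ n → ℕ → ℕ → Carrier) →
    conv α (λ β γ → conv₁ a (h β γ)) ≈ conv₁ a (λ b c → conv α (λ β γ → h β γ b c))
  conv-conv₁ α zero    h = refl
  conv-conv₁ α (suc a) h = trans (conv-+ α _ _) (+-congˡ (conv-conv₁ α a (λ β γ b → h β γ (suc b))))

  conv-assoc : ∀ {n} (α : Vec ℕ n) (h : Vec ℕ n → Vec ℕ n → Vec ℕ n → Carrier) →
    conv α (λ β γ → conv β (λ δ ε → h δ ε γ)) ≈ conv α (λ δ β → conv β (λ ε γ → h δ ε γ))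
  conv-assoc []      h = refl
  conv-assoc (a ∷ α) h = begin
    conv₁ a (λ b c → conv α (λ β γ → conv₁ b (λ d e → conv β (λ δ ε → h (d ∷ δ) (e ∷ ε) (c ∷ γ)))))
      ≈⟨ conv₁-cong a (λ b c _ → conv-conv₁ α b _) ⟩
    conv₁ a (λ b c → conv₁ b (λ d e → conv α (λ β γ → conv β (λ δ ε → h (d ∷ δ) (e ∷ ε) (c ∷ γ)))))
      ≈⟨ conv₁-assoc a (λ d e c → conv α (λ β γ → conv β (λ δ ε → h (d ∷ δ) (e ∷ ε) (c ∷ γ)))) ⟩
    conv₁ a (λ d b → conv₁ b (λ e c → conv α (λ β γ → conv β (λ δ ε → h (d ∷ δ) (e ∷ ε) (c ∷ γ)))))
      ≈⟨ conv₁-cong a (λ d b _ → conv₁-cong b λ e c _ → conv-assoc α (λ δ ε γ → h (d ∷ δ) (e ∷ ε) (c ∷ γ))) ⟩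
    conv₁ a (λ d b → conv₁ b (λ e c → conv α (λ δ β → conv β (λ ε γ → h (d ∷ δ) (e ∷ ε) (c ∷ γ)))))
      ≈⟨ conv₁-cong a (λ d b _ → conv-conv₁ α b _) ⟨
    conv₁ a (λ d b → conv α (λ δ β → conv₁ b (λ e c → conv β (λ ε γ → h (d ∷ δ) (e ∷ ε) (c ∷ γ))))) ∎

  conv₁-single : ∀ e c h → (∀ b c → b ≢ e → h b c ≈ 0#) → conv₁ (e ℕ.+ c) h ≈ h e c
  conv₁-single zero    zero    h off = refl
  conv₁-single zero    (suc c) h off = trans (+-congˡ (conv₁-0 c _ λ b c → off (suc b) c λ ())) (+-identityʳ _)
  conv₁-single (suc e) c       h off = trans (+-cong (off 0 _ λ ())
    (conv₁-single e c (λ b → h (suc b)) λ b c b≢e → off (suc b) c (b≢e ∘ ℕP.suc-injective))) (+-identityˡ _)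

  conv-single : ∀ {n} (ε γ : Vec ℕ n) h → (∀ β γ → β ≢ ε → h β γ ≈ 0#) → conv (Vec.zipWith ℕ._+_ ε γ) h ≈ h ε γ
  conv-single []      []      h off = refl
  conv-single (e ∷ ε) (c ∷ γ) h off = trans
    (conv₁-single e c _ λ b c b≢e → conv-0 (Vec.zipWith ℕ._+_ ε γ) _ λ β γ → off _ _ (b≢e ∘ VecP.∷-injectiveˡ))
    (conv-single ε γ _ λ β γ β≢ε → off _ _ (β≢ε ∘ VecP.∷-injectiveʳ))

  -- The operations below repeat those on `PS` over an arbitrary coefficient ring and in the same
  -- form, so that over Laurent polynomials they coincide by computation.
  Series : ℕ → Set
  Series n = Vec ℕ n → Carrier

  infixl 6 _⊕_
  infixl 7 _⊛_
  _⊕_ _⊛_ : ∀ {n} → Series n → Series n → Series n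
  (f ⊕ g) α = f α + g α
  (f ⊛ g) α = sumL (List.map (λ β → f β * g (Vec.zipWith _∸_ α β)) (below α))

  ⊝_ : ∀ {n} → Series n → Series n
  (⊝ f) α = - f α

  mono : ∀ {n} → Vec ℕ n → Carrier → Series n
  mono e c α = if ⌊ VecP.≡-dec ℕ._≟_ α e ⌋ then c else 0#

  const : ∀ {n} → Carrier → Series n
  const = mono (Vec.replicate _ 0)

  private
    sumL-++ : ∀ xs ys → sumL (xs List.++ ys) ≈ sumL xs + sumL ys
    sumL-++ []       ys = sym (+-identityˡ _)
    sumL-++ (x ∷ xs) ys = trans (+-congˡ (sumL-++ xs ys)) (sym (+-assoc _ _ _))

    sumL-concatMap : ∀ {A B : Set} (f : B → Carrier) (g : A → List B) xs →
      sumL (List.map f (List.concatMap g xs)) ≈ sumL (List.map (λ x → sumL (List.map f (g x))) xs)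
    sumL-concatMap f g []       = refl
    sumL-concatMap f g (x ∷ xs) = trans
      (reflexive (≡.cong sumL (ListP.map-++ f (g x) (List.concatMap g xs))))
      (trans (sumL-++ (List.map f (g x)) _) (+-congˡ (sumL-concatMap f g xs)))

    sumL-map-cong : ∀ {A : Set} {f g : A → Carrier} → (∀ x → f x ≈ g x) → ∀ xs → sumL (List.map f xs) ≈ sumL (List.map g xs)
    sumL-map-cong eq []       = refl
    sumL-map-cong eq (x ∷ xs) = +-cong (eq x) (sumL-map-cong eq xs)

    sumL-upTo : ∀ a (h : ℕ → ℕ → Carrier) → sumL (List.map (λ b → h b (a ∸ b)) (List.upTo (suc a))) ≈ conv₁ a h
    sumL-upTo a h = trans (reflexive (≡.cong sumL (ListP.map-applyUpTo (λ b → b) (λ b → h b (a ∸ b)) (suc a)))) (go a h)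
      where
      go : ∀ a (h : ℕ → ℕ → Carrier) → sumL (List.applyUpTo (λ b → h b (a ∸ b)) (suc a)) ≈ conv₁ a h
      go zero    h = +-identityʳ _
      go (suc a) h = +-congˡ (go a (λ b → h (suc b)))

  sumL-below : ∀ {n} (α : Vec ℕ n) (h : Vec ℕ n → Vec ℕ n → Carrier) →
    sumL (List.map (λ β → h β (Vec.zipWith _∸_ α β)) (below α)) ≈ conv α h
  sumL-below []      h = +-identityʳ _
  sumL-below (a ∷ α) h = begin
    sumL (List.map H (List.concatMap (λ b → List.map (b ∷_) (below α)) (List.upTo (suc a))))
      ≈⟨ sumL-concatMap H (λ b → List.map (b ∷_) (below α)) (List.upTo (suc a)) ⟩
    sumL (List.map (λ b → sumL (List.map H (List.map (b ∷_) (below α)))) (List.upTo (suc a)))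
      ≈⟨ sumL-map-cong (λ b → trans (reflexive (≡.cong sumL (≡.sym (ListP.map-∘ (below α)))))
           (sumL-below α (λ β γ → h (b ∷ β) (a ∸ b ∷ γ)))) (List.upTo (suc a)) ⟩
    sumL (List.map (λ b → conv α (λ β γ → h (b ∷ β) (a ∸ b ∷ γ))) (List.upTo (suc a)))
      ≈⟨ sumL-upTo a (λ b c → conv α (λ β γ → h (b ∷ β) (c ∷ γ))) ⟩
    conv (a ∷ α) h ∎
    where
    H : Vec ℕ _ → Carrier
    H β = h β (Vec.zipWith _∸_ (a ∷ α) β)

  ⊛-conv : ∀ {n} (f g : Series n) α → (f ⊛ g) α ≈ conv α (λ β γ → f β * g γ)
  ⊛-conv f g α = sumL-below α (λ β γ → f β * g γ)

  mono-self : ∀ {n} (e : Vec ℕ n) c → mono e c e ≈ c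
  mono-self e c with VecP.≡-dec ℕ._≟_ e e
  ... | yes _  = refl
  ... | no e≢e = ⊥-elim (e≢e ≡.refl)

  mono-other : ∀ {n} {e α : Vec ℕ n} c → α ≢ e → mono e c α ≈ 0#
  mono-other {e = e} {α} c α≢e with VecP.≡-dec ℕ._≟_ α e
  ... | yes α≡e = ⊥-elim (α≢e α≡e)
  ... | no  _   = refl

  mono-⊛ : ∀ {n} (ε γ : Vec ℕ n) c (f : Series n) → (mono ε c ⊛ f) (Vec.zipWith ℕ._+_ ε γ) ≈ c * f γ
  mono-⊛ ε γ c f = trans (⊛-conv (mono ε c) f (Vec.zipWith ℕ._+_ ε γ)) (trans
    (conv-single ε γ (λ β γ → mono ε c β * f γ) λ β γ β≢ε → trans (*-congʳ (mono-other c β≢ε)) (zeroˡ _))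
    (*-congʳ (mono-self ε c)))

  private
    cancel-+ : ∀ {n} (ε γ γ′ : Vec ℕ n) → Vec.zipWith ℕ._+_ ε γ ≡ Vec.zipWith ℕ._+_ ε γ′ → γ ≡ γ′
    cancel-+ []      []      []        eq = ≡.refl
    cancel-+ (e ∷ ε) (c ∷ γ) (c′ ∷ γ′) eq =
      ≡.cong₂ _∷_ (ℕP.+-cancelˡ-≡ e c c′ (VecP.∷-injectiveˡ eq)) (cancel-+ ε γ γ′ (VecP.∷-injectiveʳ eq))

  split : ∀ {n} (ε α : Vec ℕ n) → (∃ λ γ → Vec.zipWith ℕ._+_ ε γ ≡ α) ⊎ (∀ γ → Vec.zipWith ℕ._+_ ε γ ≢ α)
  split []      []      = inj₁ ([] , ≡.refl)
  split (e ∷ ε) (a ∷ α) with split ε α | e ℕ.≤? a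
  ... | inj₂ miss     | _       = inj₂ λ { (c ∷ γ) eq → miss γ (VecP.∷-injectiveʳ eq) }
  ... | inj₁ (γ , eq) | yes e≤a = inj₁ (a ∸ e ∷ γ , ≡.cong₂ _∷_ (ℕP.m+[n∸m]≡n e≤a) eq)
  ... | inj₁ _        | no e≰a  = inj₂ λ { (c ∷ γ) eq → e≰a (≡.subst (e ℕ.≤_) (VecP.∷-injectiveˡ eq) (ℕP.m≤m+n e c)) }

  mono-⊛-miss : ∀ {n} (ε α : Vec ℕ n) c (f : Series n) → (∀ γ → Vec.zipWith ℕ._+_ ε γ ≢ α) → (mono ε c ⊛ f) α ≈ 0#
  mono-⊛-miss ε α c f miss = trans (⊛-conv (mono ε c) f α) (trans
    (conv-cong α λ β γ eq → trans (*-congʳ (mono-other c λ { ≡.refl → miss γ eq })) (zeroˡ _))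
    (conv-0 α (λ _ _ → 0#) λ _ _ → refl))

  mono-⊛-mono : ∀ {n} (ε ε′ : Vec ℕ n) c c′ α → (mono ε c ⊛ mono ε′ c′) α ≈ mono (Vec.zipWith ℕ._+_ ε ε′) (c * c′) α
  mono-⊛-mono ε ε′ c c′ α with split ε α
  ... | inj₂ miss = trans (mono-⊛-miss ε α c (mono ε′ c′) miss) (sym (mono-other (c * c′) λ eq → miss ε′ (≡.sym eq)))
  ... | inj₁ (γ , ≡.refl) = trans (mono-⊛ ε γ c (mono ε′ c′)) coefficient
    where
    coefficient : c * mono ε′ c′ γ ≈ mono (Vec.zipWith ℕ._+_ ε ε′) (c * c′) (Vec.zipWith ℕ._+_ ε γ)
    coefficient with VecP.≡-dec ℕ._≟_ γ ε′
    ... | yes ≡.refl = sym (mono-self (Vec.zipWith ℕ._+_ ε γ) (c * c′))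
    ... | no γ≢ε′    = trans (zeroʳ c) (sym (mono-other (c * c′) (γ≢ε′ ∘ cancel-+ ε γ ε′)))

  const-⊛ : ∀ {n} c (f : Series n) α → (const c ⊛ f) α ≈ c * f α
  const-⊛ {n} c f α = trans (reflexive (≡.cong (const c ⊛ f) (≡.sym (VecP.zipWith-identityˡ (λ _ → ≡.refl) α))))
    (mono-⊛ (Vec.replicate n 0) α c f)

  const-0 : ∀ {n} (α : Vec ℕ n) → const 0# α ≈ 0#
  const-0 {n} α with VecP.≡-dec ℕ._≟_ α (Vec.replicate n 0)
  ... | yes _ = refl
  ... | no  _ = refl

  infix 4 _≈[_]_
  -- Congruence modulo the series of order at least `k`. In particular, being congruent to zero
  -- expresses a lower bound on the order.
  record _≈[_]_ {n} (f : Series n) (k : ℕ) (g : Series n) : Set where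
    constructor mk
    field at : ∀ α → Vec.sum α ℕ.< k → f α ≈ g α
  open _≈[_]_ public

  module _ (n k : ℕ) where
    private
      ⊛-cong : ∀ {f f′ g g′ : Series n} → f ≈[ k ] f′ → g ≈[ k ] g′ → f ⊛ g ≈[ k ] f′ ⊛ g′
      ⊛-cong {f} {f′} {g} {g′} ef eg = mk λ α α<k → trans (⊛-conv f g α) (trans
        (conv-cong α λ β γ β+γ≡α → *-cong
          (at ef β (ℕP.≤-<-trans (≡.subst (Vec.sum β ℕ.≤_) (degrees β+γ≡α) (ℕP.m≤m+n _ _)) α<k))
          (at eg γ (ℕP.≤-<-trans (≡.subst (Vec.sum γ ℕ.≤_) (degrees β+γ≡α) (ℕP.m≤n+m _ _)) α<k)))
        (sym (⊛-conv f′ g′ α)))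

      ⊛-assoc : ∀ (f g h : Series n) α → ((f ⊛ g) ⊛ h) α ≈ (f ⊛ (g ⊛ h)) α
      ⊛-assoc f g h α = begin
        ((f ⊛ g) ⊛ h) α
          ≈⟨ ⊛-conv (f ⊛ g) h α ⟩
        conv α (λ β γ → (f ⊛ g) β * h γ)
          ≈⟨ conv-cong α (λ β γ _ → trans (*-congʳ (⊛-conv f g β)) (trans (*-comm _ _)
               (trans (sym (conv-* β (h γ) _)) (conv-cong β λ δ ε _ → trans (*-comm _ _) (*-assoc _ _ _))))) ⟩
        conv α (λ β γ → conv β (λ δ ε → f δ * (g ε * h γ)))
          ≈⟨ conv-assoc α (λ δ ε γ → f δ * (g ε * h γ)) ⟩
        conv α (λ δ β → conv β (λ ε γ → f δ * (g ε * h γ)))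
          ≈⟨ conv-cong α (λ δ β _ → trans (conv-* β (f δ) _) (*-congˡ (sym (⊛-conv g h β)))) ⟩
        conv α (λ δ β → f δ * (g ⊛ h) β)
          ≈⟨ ⊛-conv f (g ⊛ h) α ⟨
        (f ⊛ (g ⊛ h)) α ∎

      ⊛-comm : ∀ (f g : Series n) α → (f ⊛ g) α ≈ (g ⊛ f) α
      ⊛-comm f g α = trans (⊛-conv f g α) (trans (conv-comm α _)
        (trans (conv-cong α λ β γ _ → *-comm _ _) (sym (⊛-conv g f α))))

      ⊛-distribˡ : ∀ (f g h : Series n) α → (f ⊛ (g ⊕ h)) α ≈ (f ⊛ g) α + (f ⊛ h) α
      ⊛-distribˡ f g h α = trans (⊛-conv f (g ⊕ h) α) (trans (conv-cong α λ β γ _ → distribˡ _ _ _)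
        (trans (conv-+ α _ _) (sym (+-cong (⊛-conv f g α) (⊛-conv f h α)))))

    -- Only the equality depends on `k`; elements and operations do not, so one series can be
    -- discussed at several precisions.
    truncated : CommutativeRing 0ℓ 0ℓ
    truncated = record
      { Carrier = Series n
      ; _≈_ = _≈[ k ]_
      ; _+_ = _⊕_
      ; _*_ = _⊛_
      ; -_ = ⊝_
      ; 0# = const 0#
      ; 1# = const 1#
      ; isCommutativeRing = record
        { isRing = record
          { +-isAbelianGroup = record
            { isGroup = record
              { isMonoid = record
                { isSemigroup = record
                  { isMagma = record
                    { isEquivalence = record
                      { refl = mk λ _ _ → refl
                      ; sym = λ e → mk λ α α<k → sym (at e α α<k)
                      ; trans = λ e e′ → mk λ α α<k → trans (at e α α<k) (at e′ α α<k)
                      }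
                    ; ∙-cong = λ e e′ → mk λ α α<k → +-cong (at e α α<k) (at e′ α α<k)
                    }
                  ; assoc = λ f g h → mk λ α _ → +-assoc (f α) (g α) (h α)
                  }
                ; identity = (λ f → mk λ α _ → trans (+-congʳ (const-0 α)) (+-identityˡ (f α)))
                           , (λ f → mk λ α _ → trans (+-congˡ (const-0 α)) (+-identityʳ (f α)))
                }
              ; inverse = (λ f → mk λ α _ → trans (-‿inverseˡ (f α)) (sym (const-0 α)))
                        , (λ f → mk λ α _ → trans (-‿inverseʳ (f α)) (sym (const-0 α)))
              ; ⁻¹-cong = λ e → mk λ α α<k → -‿cong (at e α α<k)
              }
            ; comm = λ f g → mk λ α _ → +-comm (f α) (g α)
            }
          ; *-cong = ⊛-cong
          ; *-assoc = λ f g h → mk λ α _ → ⊛-assoc f g h α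
          ; *-identity = (λ f → mk λ α _ → trans (const-⊛ 1# f α) (*-identityˡ (f α)))
                       , (λ f → mk λ α _ → trans (⊛-comm f (const 1#) α) (trans (const-⊛ 1# f α) (*-identityˡ (f α))))
          ; distrib = (λ f g h → mk λ α _ → ⊛-distribˡ f g h α)
                    , (λ f g h → mk λ α _ → trans (⊛-comm (g ⊕ h) f α) (trans (⊛-distribˡ f g h α)
                        (+-cong (⊛-comm f g α) (⊛-comm f h α))))
          }
        ; *-comm = λ f g → mk λ α _ → ⊛-comm f g α
        }
      }

-- Constants, powers of variables, orders, cancellation and geometric series

module SeriesFacts (R : CommutativeRing 0ℓ 0ℓ) (n : ℕ) where

  open import Data.Nat as ℕ using (zero; suc)
  import Data.Nat.Properties as ℕP
  open import Data.Fin as Fin using (Fin; zero; suc; punchIn)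
  open import Data.Vec as Vec using (Vec; []; _∷_)
  import Data.Vec.Properties as VecP
  open import Data.List as List using ([]; _∷_; length)
  open import Data.List.Relation.Unary.All using (All; []; _∷_)
  open import Data.Product using (_,_)
  open import Data.Sum using (inj₁; inj₂)
  open import Data.Bool using (true; false; if_then_else_)
  open import Data.Empty using (⊥-elim)
  open import Relation.Nullary using (yes; no)
  open import Relation.Nullary.Decidable using (⌊_⌋)
  open import Relation.Binary.PropositionalEquality as ≡ using (_≡_; _≢_)
  import Defs

  open Series R
  private
    module C = CommutativeRing R
    module CO = Defs.Ops C.0# C.1# C._+_ C._*_ (C.-_)
    module S k = CommutativeRing (truncated n k)
  module SO = Defs.Ops {Series n} (const C.0#) (const C.1#) _⊕_ _⊛_ (⊝_)

  const-cong : ∀ {k a b} → a C.≈ b → const {n} a ≈[ k ] const b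
  const-cong {a = a} {b} eq = mk λ α _ → at′ α
    where
    at′ : ∀ α → const a α C.≈ const b α
    at′ α with VecP.≡-dec ℕ._≟_ α (Vec.replicate n 0)
    ... | yes _ = eq
    ... | no  _ = C.refl

  const-+ : ∀ k a b → const {n} (a C.+ b) ≈[ k ] const a ⊕ const b
  const-+ k a b = mk λ α _ → at′ α
    where
    at′ : ∀ α → const (a C.+ b) α C.≈ const a α C.+ const b α
    at′ α with VecP.≡-dec ℕ._≟_ α (Vec.replicate n 0)
    ... | yes _ = C.refl
    ... | no  _ = C.sym (C.+-identityˡ C.0#)

  const-neg : ∀ k a → const {n} (C.- a) ≈[ k ] ⊝ const a
  const-neg k a = mk λ α _ → at′ α
    where
    open import Algebra.Properties.Ring C.ring using (-0#≈0#)
    at′ : ∀ α → const (C.- a) α C.≈ C.- const a α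
    at′ α with VecP.≡-dec ℕ._≟_ α (Vec.replicate n 0)
    ... | yes _ = C.refl
    ... | no  _ = C.sym -0#≈0#

  const-sub : ∀ k a b → const {n} (a C.- b) ≈[ k ] const a ⊕ ⊝ const b
  const-sub k a b = S.trans k (const-+ k a (C.- b)) (S.+-congˡ k (const-neg k b))

  const-* : ∀ k a b → const {n} (a C.* b) ≈[ k ] const a ⊛ const b
  const-* k a b = mk λ α _ → C.sym (C.trans (mono-⊛-mono (Vec.replicate n 0) (Vec.replicate n 0) a b α)
    (C.reflexive (≡.cong (λ e → mono e (a C.* b) α) (VecP.zipWith-identityˡ (λ _ → ≡.refl) _))))

  const-prodL : ∀ k {A : Set} (f : A → C.Carrier) xs →
    const {n} (CO.prodL (List.map f xs)) ≈[ k ] SO.prodL (List.map (λ x → const (f x)) xs)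
  const-prodL k f []       = S.refl k
  const-prodL k f (x ∷ xs) = S.trans k (const-* k _ _) (S.*-congˡ k (const-prodL k f xs))

  const-sumL : ∀ k {A : Set} (f : A → C.Carrier) (g : A → Series n) → (∀ x → const (f x) ≈[ k ] g x) → ∀ xs →
    const {n} (CO.sumL (List.map f xs)) ≈[ k ] SO.sumL (List.map g xs)
  const-sumL k f g eq []       = S.refl k
  const-sumL k f g eq (x ∷ xs) = S.trans k (const-+ k _ _) (S.+-cong k (eq x) (const-sumL k f g eq xs))

  const-sign : ∀ k m → const {n} (CO.sign m) ≈[ k ] SO.sign m
  const-sign k zero    = S.refl k
  const-sign k (suc m) = S.trans k (const-neg k _) (S.-‿cong k (const-sign k m))

  const-det : ∀ k {m} (M : Fin m → Fin m → C.Carrier) → const {n} (CO.det M) ≈[ k ] SO.det (λ i j → const (M i j))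
  const-det k {zero}  M = S.refl k
  const-det k {suc m} M = const-sumL k
    (λ j → CO.sign (Fin.toℕ j) C.* (M zero j C.* CO.det (λ r c → M (suc r) (punchIn j c))))
    (λ j → SO.sign (Fin.toℕ j) ⊛ (const (M zero j) ⊛ SO.det (λ r c → const (M (suc r) (punchIn j c)))))
    (λ j → S.trans k (const-* k _ _) (S.*-cong k (const-sign k (Fin.toℕ j))
      (S.trans k (const-* k _ _) (S.*-congˡ k (const-det k (λ r c → M (suc r) (punchIn j c)))))))
    (List.allFin (suc m))

  expo : ∀ {m} → Fin m → ℕ → Vec ℕ m
  expo i k = Vec.tabulate (λ l → if ⌊ l Fin.≟ i ⌋ then k else 0)

  X^ : Fin n → ℕ → Series n
  X^ i k = mono (expo i k) C.1#

  X : Fin n → Series n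
  X i = X^ i 1

  private
    tabulate-const : ∀ {m} (f : Fin m → ℕ) → (∀ i → f i ≡ 0) → Vec.tabulate f ≡ Vec.replicate m 0
    tabulate-const {zero}  f eq = ≡.refl
    tabulate-const {suc m} f eq = ≡.cong₂ _∷_ (eq zero) (tabulate-const (λ i → f (suc i)) (λ i → eq (suc i)))

    zipWith-tabulate : ∀ {m} (f g h : Fin m → ℕ) → (∀ i → f i ℕ.+ g i ≡ h i) →
      Vec.zipWith ℕ._+_ (Vec.tabulate f) (Vec.tabulate g) ≡ Vec.tabulate h
    zipWith-tabulate {zero}  f g h eq = ≡.refl
    zipWith-tabulate {suc m} f g h eq = ≡.cong₂ _∷_ (eq zero)
      (zipWith-tabulate (λ i → f (suc i)) (λ i → g (suc i)) (λ i → h (suc i)) (λ i → eq (suc i)))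

    expo-+ : ∀ {m} (i : Fin m) a b → Vec.zipWith ℕ._+_ (expo i a) (expo i b) ≡ expo i (a ℕ.+ b)
    expo-+ i a b = zipWith-tabulate _ _ _ λ l → lemma ⌊ l Fin.≟ i ⌋
      where
      lemma : ∀ c → (if c then a else 0) ℕ.+ (if c then b else 0) ≡ (if c then a ℕ.+ b else 0)
      lemma true  = ≡.refl
      lemma false = ≡.refl

    expo-0 : ∀ {m} (i : Fin m) → expo i 0 ≡ Vec.replicate m 0
    expo-0 i = tabulate-const _ λ l → lemma ⌊ l Fin.≟ i ⌋
      where
      lemma : ∀ c → (if c then 0 else 0) ≡ 0
      lemma true  = ≡.refl
      lemma false = ≡.refl

    lookup-expo : ∀ {m} (i : Fin m) k → Vec.lookup (expo i k) i ≡ k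
    lookup-expo i k = ≡.trans (VecP.lookup∘tabulate _ i) lemma
      where
      lemma : (if ⌊ i Fin.≟ i ⌋ then k else 0) ≡ k
      lemma with i Fin.≟ i
      ... | yes _  = ≡.refl
      ... | no i≢i = ⊥-elim (i≢i ≡.refl)

    lookup-expo-other : ∀ {m} {i j : Fin m} k → j ≢ i → Vec.lookup (expo i k) j ≡ 0
    lookup-expo-other {i = i} {j} k j≢i = ≡.trans (VecP.lookup∘tabulate _ j) lemma
      where
      lemma : (if ⌊ j Fin.≟ i ⌋ then k else 0) ≡ 0
      lemma with j Fin.≟ i
      ... | yes j≡i = ⊥-elim (j≢i j≡i)
      ... | no  _   = ≡.refl

    sum-tabulate-0 : ∀ {m} (f : Fin m → ℕ) → (∀ i → f i ≡ 0) → Vec.sum (Vec.tabulate f) ≡ 0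
    sum-tabulate-0 {zero}  f eq = ≡.refl
    sum-tabulate-0 {suc m} f eq = ≡.cong₂ ℕ._+_ (eq zero) (sum-tabulate-0 (λ i → f (suc i)) (λ i → eq (suc i)))

    sum-expo : ∀ {m} (i : Fin m) k → Vec.sum (expo i k) ≡ k
    sum-expo {suc m} zero    k = ≡.trans (≡.cong (k ℕ.+_) (sum-tabulate-0 {m} (λ l → if ⌊ suc l Fin.≟ zero ⌋ then k else 0) λ _ → ≡.refl)) (ℕP.+-identityʳ k)
    sum-expo (suc i) k = ≡.trans (≡.cong Vec.sum (VecP.tabulate-cong shifted)) (sum-expo i k)
      where
      shifted : ∀ l → (if ⌊ suc l Fin.≟ suc i ⌋ then k else 0) ≡ (if ⌊ l Fin.≟ i ⌋ then k else 0)
      shifted l with l Fin.≟ i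
      ... | yes _ = ≡.refl
      ... | no  _ = ≡.refl

  X^-* : ∀ k i a b → X^ i a ⊛ X^ i b ≈[ k ] X^ i (a ℕ.+ b)
  X^-* k i a b = mk λ α _ → C.trans (mono-⊛-mono (expo i a) (expo i b) C.1# C.1# α)
    (C.trans (C.reflexive (≡.cong (λ e → mono e (C.1# C.* C.1#) α) (expo-+ i a b))) (unit α))
    where
    unit : ∀ α → mono (expo i (a ℕ.+ b)) (C.1# C.* C.1#) α C.≈ X^ i (a ℕ.+ b) α
    unit α with VecP.≡-dec ℕ._≟_ α (expo i (a ℕ.+ b))
    ... | yes _ = C.*-identityˡ C.1#
    ... | no  _ = C.refl

  X^-0 : ∀ k i → X^ i 0 ≈[ k ] const C.1#
  X^-0 k i = S.reflexive k (≡.cong (λ e → mono e C.1#) (expo-0 i))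

  0ₛ : Series n
  0ₛ = const C.0#

  zero-at : ∀ {f : Series n} {k} → f ≈[ k ] 0ₛ → ∀ α → Vec.sum α ℕ.< k → f α C.≈ C.0#
  zero-at eq α α<k = C.trans (at eq α α<k) (const-0 α)

  at-zero : ∀ {f : Series n} {k} → (∀ α → Vec.sum α ℕ.< k → f α C.≈ C.0#) → f ≈[ k ] 0ₛ
  at-zero eq = mk λ α α<k → C.trans (eq α α<k) (C.sym (const-0 α))

  weaken : ∀ {f g : Series n} {k k′} → k′ ℕ.≤ k → f ≈[ k ] g → f ≈[ k′ ] g
  weaken k′≤k eq = mk λ α α<k′ → at eq α (ℕP.<-≤-trans α<k′ k′≤k)

  X^-order : ∀ i k → X^ i k ≈[ k ] 0ₛ
  X^-order i k = at-zero λ α α<k → mono-other C.1# λ { ≡.refl → ℕP.<-irrefl (sum-expo i k) α<k }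

  -- If two degrees add up to less than a + b, then the one is below a or the other below b.
  ⊛-order : ∀ {a b} {f g : Series n} → f ≈[ a ] 0ₛ → g ≈[ b ] 0ₛ → f ⊛ g ≈[ a ℕ.+ b ] 0ₛ
  ⊛-order {a} {b} {f} {g} ef eg = at-zero λ α α<a+b → C.trans (⊛-conv f g α) (C.trans
    (conv-cong α λ β γ β+γ≡α → vanish β γ (≡.subst (ℕ._< a ℕ.+ b) (≡.sym (degrees β+γ≡α)) α<a+b))
    (conv-0 α (λ _ _ → C.0#) λ _ _ → C.refl))
    where
    vanish : ∀ β γ → Vec.sum β ℕ.+ Vec.sum γ ℕ.< a ℕ.+ b → f β C.* g γ C.≈ C.0#
    vanish β γ lt with Vec.sum β ℕ.<? a
    ... | yes β<a = C.trans (C.*-congʳ (zero-at ef β β<a)) (C.zeroˡ _)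
    ... | no  β≮a = C.trans (C.*-congˡ (zero-at eg γ (ℕP.+-cancelˡ-< a (Vec.sum γ) b
      (ℕP.≤-<-trans (ℕP.+-monoˡ-≤ (Vec.sum γ) (ℕP.≮⇒≥ β≮a)) lt)))) (C.zeroʳ _)

  sumL-order : ∀ k {A : Set} (f : A → Series n) → (∀ x → f x ≈[ k ] 0ₛ) → ∀ xs → SO.sumL (List.map f xs) ≈[ k ] 0ₛ
  sumL-order k f eq []       = S.refl k
  sumL-order k f eq (x ∷ xs) = S.trans k (S.+-cong k (eq x) (sumL-order k f eq xs)) (S.+-identityˡ k 0ₛ)

  total : ∀ {m} → (Fin m → ℕ) → ℕ
  total {zero}  r = 0
  total {suc m} r = r zero ℕ.+ total (λ i → r (suc i))

  -- Every term of the determinant has one factor from each row, so the orders of the rows add up.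
  det-order : ∀ {m} (r : Fin m → ℕ) (M : Fin m → Fin m → Series n) →
    (∀ i j → M i j ≈[ r i ] 0ₛ) → SO.det M ≈[ total r ] 0ₛ
  det-order {zero}  r M eq = mk λ _ ()
  det-order {suc m} r M eq = sumL-order _ _ (λ j → ⊛-order {0} {total r} (mk λ _ ()) (⊛-order (eq zero j)
    (det-order (λ i → r (suc i)) (λ i c → M (suc i) (punchIn j c)) (λ i c → eq (suc i) (punchIn j c))))) (List.allFin (suc m))

  -- Comparing coefficients of x_i x^α, the coefficient of x^α in f equals that of
  -- x_i x^α / x_j; iterating exhausts the exponent of x_j.
  difference-cancel : ∀ {i j} → i ≢ j → ∀ {k} {f : Series n} → (X i ⊕ ⊝ X j) ⊛ f ≈[ suc k ] 0ₛ → f ≈[ k ] 0ₛ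
  difference-cancel {i} {j} i≢j {k} {f} eq = at-zero λ α α<k → go (Vec.lookup α j) α ≡.refl α<k
    where
    open import Algebra.Properties.Ring C.ring using (x∙y⁻¹≈ε⇒x≈y)
    equal : ∀ α → Vec.sum α ℕ.< k → f α C.≈ (X j ⊛ f) (Vec.zipWith ℕ._+_ (expo i 1) α)
    equal α α<k = x∙y⁻¹≈ε⇒x≈y _ _ (C.trans
      (C.+-congʳ (C.sym (C.trans (mono-⊛ (expo i 1) α C.1# f) (C.*-identityˡ (f α)))))
      (C.trans (C.sym (at expand β β<)) (zero-at eq β β<)))
      where
      β = Vec.zipWith ℕ._+_ (expo i 1) α
      β< : Vec.sum β ℕ.< suc k
      β< = ≡.subst (ℕ._< suc k) (≡.sym (≡.trans (sum-zipWith-+ (expo i 1) α) (≡.cong (ℕ._+ Vec.sum α) (sum-expo i 1)))) (ℕ.s≤s α<k)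
      expand : (X i ⊕ ⊝ X j) ⊛ f ≈[ suc k ] (X i ⊛ f) ⊕ ⊝ (X j ⊛ f)
      expand = let open RingSolver (truncated n (suc k)) in
        solve 3 (λ a b f → (a :- b) :* f := a :* f :- b :* f) (S.refl (suc k)) (X i) (X j) f
    go : ∀ m α → Vec.lookup α j ≡ m → Vec.sum α ℕ.< k → f α C.≈ C.0#
    go m α αj≡m α<k with split (expo j 1) (Vec.zipWith ℕ._+_ (expo i 1) α)
    ... | inj₂ miss = C.trans (equal α α<k) (mono-⊛-miss (expo j 1) _ C.1# f miss)
    ... | inj₁ (γ , γ-eq) = C.trans (equal α α<k) (C.trans
      (C.trans (C.reflexive (≡.cong (X j ⊛ f) (≡.sym γ-eq))) (C.trans (mono-⊛ (expo j 1) γ C.1# f) (C.*-identityˡ (f γ))))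
      (descend m (≡.trans exponent αj≡m)))
      where
      exponent : suc (Vec.lookup γ j) ≡ Vec.lookup α j
      exponent = ≡.trans (≡.cong (ℕ._+ Vec.lookup γ j) (≡.sym (lookup-expo j 1)))
        (≡.trans (≡.sym (VecP.lookup-zipWith ℕ._+_ j (expo j 1) γ)) (≡.trans (≡.cong (λ v → Vec.lookup v j) γ-eq)
        (≡.trans (VecP.lookup-zipWith ℕ._+_ j (expo i 1) α) (≡.cong (ℕ._+ Vec.lookup α j) (lookup-expo-other 1 (λ j≡i → i≢j (≡.sym j≡i)))))))
      degree : Vec.sum γ ≡ Vec.sum α
      degree = ℕP.suc-injective (≡.trans (≡.cong (ℕ._+ Vec.sum γ) (≡.sym (sum-expo j 1)))
        (≡.trans (≡.sym (sum-zipWith-+ (expo j 1) γ)) (≡.trans (≡.cong Vec.sum γ-eq)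
        (≡.trans (sum-zipWith-+ (expo i 1) α) (≡.cong (ℕ._+ Vec.sum α) (sum-expo i 1))))))
      descend : ∀ m → suc (Vec.lookup γ j) ≡ m → f γ C.≈ C.0#
      descend zero    ()
      descend (suc m) eq = go m γ (ℕP.suc-injective eq) (≡.subst (ℕ._< k) (≡.sym degree) α<k)

  -- The loss of one degree is the degree of the factors xᵢ - xⱼ to which this is applied.
  Cancellable : Series n → Set
  Cancellable g = ∀ {k} {f : Series n} → g ⊛ f ≈[ suc k ] 0ₛ → f ≈[ k ] 0ₛ

  prodL-cancel : ∀ {gs} → All Cancellable gs → ∀ {k} {f : Series n} → SO.prodL gs ⊛ f ≈[ length gs ℕ.+ k ] 0ₛ → f ≈[ k ] 0ₛ
  prodL-cancel []       {k} {f} eq = S.trans k (S.sym k (S.*-identityˡ k f)) eq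
  prodL-cancel (c ∷ cs) {k} {f} eq = prodL-cancel cs (c (S.trans _ (S.sym _ (S.*-assoc _ _ _ f)) eq))

  -- A constant acts on each coefficient separately, so cancelling it costs no precision.
  const-cancel : ∀ {a} → (∀ b → a C.* b C.≈ C.0# → b C.≈ C.0#) → ∀ {k} {f : Series n} → const a ⊛ f ≈[ k ] 0ₛ → f ≈[ k ] 0ₛ
  const-cancel {a} regular {k} {f} eq = at-zero λ α α<k → regular (f α) (C.trans (C.sym (const-⊛ a f α)) (zero-at eq α α<k))

  module _ (k : ℕ) where
    open CauchyBinet (truncated n k) using (rangeSum)
    open RingSolver (truncated n k)

    -- The product telescopes to 1 minus the N-th term, which has order at least N and so vanishes
    -- modulo degree k. The powers of `a` enter through their recurrence, which admits any
    -- representation of them.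
    geometric : ∀ {N} → k ℕ.≤ N → ∀ i a (c : ℕ → C.Carrier) → c 0 C.≈ C.1# → (∀ l → c (suc l) C.≈ a C.* c l) →
      (const C.1# ⊕ ⊝ (X i ⊛ const a)) ⊛ rangeSum N (λ l → X^ i l ⊛ const (c l)) ≈[ k ] const C.1#
    geometric {N} k≤N i a c c₀ c₊ = S.trans k (partial N) (S.trans k
      (S.+-congˡ k (S.-‿cong k (S.trans k (S.*-congʳ k {const (c N)} (weaken k≤N (X^-order i N))) (S.zeroˡ k (const (c N))))))
      (solve 1 (λ x → x :- :0 := x) (S.refl k) (const C.1#)))
      where
      term : ℕ → Series n
      term l = X^ i l ⊛ const (c l)
      next : ∀ l → (X i ⊛ const a) ⊛ term l ≈[ k ] term (suc l)
      next l = S.trans k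
        (solve 4 (λ x a y c → (x :* a) :* (y :* c) := (x :* y) :* (a :* c)) (S.refl k) (X i) (const a) (X^ i l) (const (c l)))
        (S.*-cong k (X^-* k i 1 l) (S.trans k (S.sym k (const-* k a (c l))) (const-cong (C.sym (c₊ l)))))
      partial : ∀ m → (const C.1# ⊕ ⊝ (X i ⊛ const a)) ⊛ rangeSum m term ≈[ k ] const C.1# ⊕ ⊝ term m
      partial zero = S.trans k (S.zeroʳ k _) (S.trans k
        (solve 1 (λ x → :0 := x :- :1 :* x) (S.refl k) (const C.1#))
        (S.+-congˡ k (S.-‿cong k (S.*-cong k (S.sym k (X^-0 k i)) (const-cong (C.sym c₀))))))
      partial (suc m) = S.trans k
        (solve 3 (λ z t r → (:1 :- z) :* (t :+ r) := (t :- z :* t) :+ (:1 :- z) :* r) (S.refl k) (X i ⊛ const a) (term m) (rangeSum m term))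
        (S.trans k (S.+-cong k (S.+-congˡ k (S.-‿cong k (next m))) (partial m))
        (solve 2 (λ t u → (t :- u) :+ (:1 :- t) := :1 :- u) (S.refl k) (term m) (term (suc m))))

-- Sums over partitions and over strictly decreasing vectors

module Partitions (R : CommutativeRing 0ℓ 0ℓ) where

  open import Data.Nat as ℕ using (zero; suc; _∸_; _≤_; _<_; s≤s)
  import Data.Nat.Properties as ℕP
  open import Data.Fin using (zero; suc; toℕ)
  open import Data.Vec as Vec using ([]; _∷_)
  import Data.Vec.Properties as VecP
  open import Data.List as List using ([]; _∷_)
  open import Data.Bool using (Bool; true; false; if_then_else_; _∧_; T)
  import Data.Bool.Properties as BoolP
  open import Data.Product using (_,_; proj₂)
  open import Data.Unit using (tt)
  open import Data.Empty using (⊥-elim)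
  open import Function using (_∘_; Equivalence)
  open import Relation.Binary.PropositionalEquality as ≡ using (_≡_)
  import Relation.Binary.Reasoning.Setoid

  open CommutativeRing R hiding (zero)
  open Defs.Ops 0# 1# _+_ _*_ -_ using (sumL)
  open Series R hiding (at)
  open CauchyBinet R using (rangeSum; strictSum)
  open Relation.Binary.Reasoning.Setoid setoid

  rangeSum-cong : ∀ N {f g} → (∀ a → a < N → f a ≈ g a) → rangeSum N f ≈ rangeSum N g
  rangeSum-cong zero    eq = refl
  rangeSum-cong (suc N) eq = +-cong (eq N (ℕP.n<1+n N)) (rangeSum-cong N λ a a<N → eq a (ℕP.m≤n⇒m≤1+n a<N))

  rangeSum-* : ∀ N x f → rangeSum N (λ a → f a * x) ≈ rangeSum N f * x
  rangeSum-* zero    x f = sym (zeroˡ x)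
  rangeSum-* (suc N) x f = trans (+-congˡ (rangeSum-* N x f)) (sym (distribʳ x _ _))

  rangeSum-0 : ∀ N {f} → (∀ a → a < N → f a ≈ 0#) → rangeSum N f ≈ 0#
  rangeSum-0 zero    eq = refl
  rangeSum-0 (suc N) eq = trans (+-cong (eq N (ℕP.n<1+n N)) (rangeSum-0 N λ a a<N → eq a (ℕP.m≤n⇒m≤1+n a<N))) (+-identityˡ 0#)

  rangeSum-extend : ∀ m N {f} → (∀ a → N ≤ a → f a ≈ 0#) → rangeSum (m ℕ.+ N) f ≈ rangeSum N f
  rangeSum-extend zero    N eq = refl
  rangeSum-extend (suc m) N eq = trans (+-cong (eq (m ℕ.+ N) (ℕP.m≤n+m N m)) (rangeSum-extend m N eq)) (+-identityˡ _)

  rangeSum-shift : ∀ m n {f} → (∀ a → a < n → f a ≈ 0#) → rangeSum (m ℕ.+ n) f ≈ rangeSum m (λ a → f (a ℕ.+ n))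
  rangeSum-shift zero    n eq = rangeSum-0 n eq
  rangeSum-shift (suc m) n eq = +-congˡ (rangeSum-shift m n eq)

  rangeSum-extend′ : ∀ {M N f} → N ≤ M → (∀ a → N ≤ a → f a ≈ 0#) → rangeSum M f ≈ rangeSum N f
  rangeSum-extend′ {M} {N} {f} N≤M eq =
    trans (reflexive (≡.cong (λ k → rangeSum k f) (≡.sym (ℕP.m∸n+n≡m N≤M)))) (rangeSum-extend (M ∸ N) N eq)

  headLe : ∀ {n} → ℕ → Vec ℕ n → Bool
  headLe c []      = true
  headLe c (a ∷ l) = a ℕ.≤ᵇ c

  decB-∷ : ∀ {n} a (l : Vec ℕ n) → decB (a ∷ l) ≡ headLe a l ∧ decB l
  decB-∷ a []      = ≡.refl
  decB-∷ a (b ∷ l) = ≡.refl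

  -- Runs over the partitions with first part at most the given bound; each part bounds the next.
  weakSum : ∀ n → ℕ → (Vec ℕ n → Carrier) → Carrier
  weakSum zero    c H = H []
  weakSum (suc n) c H = rangeSum (suc c) (λ a → weakSum n a (λ l → H (a ∷ l)))

  private
    T-∷ : ∀ {n c a} {l : Vec ℕ n} → a < suc c → T (headLe a l ∧ decB l) → T (headLe c (a ∷ l) ∧ decB (a ∷ l))
    T-∷ {a = a} {l} (s≤s a≤c) t = Equivalence.from BoolP.T-∧ (ℕP.≤⇒≤ᵇ a≤c , ≡.subst T (≡.sym (decB-∷ a l)) t)

    weakSum-cong′ : ∀ n c {G H : Vec ℕ n → Carrier} → (∀ l → T (headLe c l ∧ decB l) → G l ≈ H l) → weakSum n c G ≈ weakSum n c H
    weakSum-cong′ zero    c eq = eq [] tt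
    weakSum-cong′ (suc n) c eq = rangeSum-cong (suc c) λ a a<c → weakSum-cong′ n a λ l t → eq (a ∷ l) (T-∷ {l = l} a<c t)

    weakSum-0 : ∀ n c {H : Vec ℕ n → Carrier} → (∀ l → T (headLe c l ∧ decB l) → H l ≈ 0#) → weakSum n c H ≈ 0#
    weakSum-0 zero    c eq = eq [] tt
    weakSum-0 (suc n) c eq = rangeSum-0 (suc c) λ a a<c → weakSum-0 n a λ l t → eq (a ∷ l) (T-∷ {l = l} a<c t)

  weakSum-cong : ∀ n c {G H : Vec ℕ n → Carrier} → (∀ l → IsPartition l → G l ≈ H l) → weakSum n c G ≈ weakSum n c H
  weakSum-cong n c eq = weakSum-cong′ n c λ l t → eq l (proj₂ (Equivalence.to BoolP.T-∧ t))

  weakSum-* : ∀ n c x (H : Vec ℕ n → Carrier) → weakSum n c (λ l → H l * x) ≈ weakSum n c H * x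
  weakSum-* zero    c x H = refl
  weakSum-* (suc n) c x H = trans (rangeSum-cong (suc c) λ a _ → weakSum-* n a x (λ l → H (a ∷ l)))
    (rangeSum-* (suc c) x (λ a → weakSum n a (λ l → H (a ∷ l))))

  -- A first part larger than `d` already makes the size exceed `d`, so the additional summands
  -- vanish.
  weakSum-extend : ∀ n {c d} {H : Vec ℕ n → Carrier} → d ≤ c →
    (∀ l → IsPartition l → d < Vec.sum l → H l ≈ 0#) → weakSum n c H ≈ weakSum n d H
  weakSum-extend zero    d≤c vanish = refl
  weakSum-extend (suc n) d≤c vanish = rangeSum-extend′ (s≤s d≤c) λ a d<a → weakSum-0 n a λ l t →
    vanish (a ∷ l) (≡.subst T (≡.sym (decB-∷ a l)) t) (ℕP.≤-trans d<a (ℕP.m≤m+n a (Vec.sum l)))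

  private
    conv₁-const : ∀ d f → conv₁ d (λ b _ → f b) ≈ rangeSum (suc d) f
    conv₁-const zero    f = sym (+-identityʳ _)
    conv₁-const (suc d) f = trans (conv₁-last d (λ b _ → f b)) (trans (+-comm _ _) (+-congˡ (conv₁-const d f)))

    -- The box keeps its side `d` in every coordinate while the bound `c` drops to the part just
    -- chosen; the filter discards what lies in between.
    box : ∀ n {c d} (H : Vec ℕ n → Carrier) → c ≤ d →
      conv (replicate n d) (λ β _ → if headLe c β ∧ decB β then H β else 0#) ≈ weakSum n c H
    box zero    H c≤d = refl
    box (suc n) {c} {d} H c≤d = begin
      conv₁ d (λ b _ → conv (replicate n d) (λ β _ → if (b ℕ.≤ᵇ c) ∧ decB (b ∷ β) then H (b ∷ β) else 0#))
        ≈⟨ conv₁-const d f ⟩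
      rangeSum (suc d) f
        ≈⟨ rangeSum-extend′ (s≤s c≤d) (λ b c<b → outside b (ℕP.<⇒≱ c<b)) ⟩
      rangeSum (suc c) f
        ≈⟨ rangeSum-cong (suc c) (λ { b (s≤s b≤c) → inside b b≤c }) ⟩
      rangeSum (suc c) (λ b → weakSum n b (λ l → H (b ∷ l))) ∎
      where
      f : ℕ → Carrier
      f b = conv (replicate n d) (λ β _ → if (b ℕ.≤ᵇ c) ∧ decB (b ∷ β) then H (b ∷ β) else 0#)
      outside : ∀ b → ℕ._≰_ b c → f b ≈ 0#
      outside b b≰c with b ℕ.≤ᵇ c in eq
      ... | false = conv-0 (replicate n d) _ λ _ _ → refl
      ... | true  = ⊥-elim (b≰c (ℕP.≤ᵇ⇒≤ b c (≡.subst T (≡.sym eq) tt)))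
      inside : ∀ b → b ≤ c → f b ≈ weakSum n b (λ l → H (b ∷ l))
      inside b b≤c with b ℕ.≤ᵇ c in eq
      ... | false = ⊥-elim (≡.subst T eq (ℕP.≤⇒≤ᵇ b≤c))
      ... | true  = trans
        (conv-cong (replicate n d) λ β _ _ → reflexive (≡.cong (if_then H (b ∷ β) else 0#) (decB-∷ b β)))
        (box n (λ l → H (b ∷ l)) (ℕP.≤-trans b≤c c≤d))

    headLe-box : ∀ {n d} (β γ : Vec ℕ n) → Vec.zipWith ℕ._+_ β γ ≡ replicate n d → T (headLe d β)
    headLe-box []      []      eq = tt
    headLe-box (b ∷ β) (c ∷ γ) eq = ℕP.≤⇒≤ᵇ (≡.subst (b ≤_) (VecP.∷-injectiveˡ eq) (ℕP.m≤m+n b c))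

    sumL-filterB : ∀ {A : Set} (p : A → Bool) (H : A → Carrier) xs →
      sumL (List.map H (filterB p xs)) ≈ sumL (List.map (λ x → if p x then H x else 0#) xs)
    sumL-filterB p H []       = refl
    sumL-filterB p H (x ∷ xs) with p x
    ... | true  = +-congˡ (sumL-filterB p H xs)
    ... | false = trans (sumL-filterB p H xs) (sym (+-identityˡ _))

  -- A bound on the size is exchanged for the weaker bound on the first part, which unlike the size
  -- translates into the range of a strictly decreasing sum. The partitions gained have size above
  -- `d`, where `H` vanishes.
  sumL-partitionsUpTo : ∀ n d (H : Vec ℕ n → Carrier) → (∀ l → IsPartition l → d < Vec.sum l → H l ≈ 0#) →
    sumL (List.map H (partitionsUpTo n d)) ≈ weakSum n d H
  sumL-partitionsUpTo n d H vanish = begin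
    sumL (List.map H (partitionsUpTo n d))
      ≈⟨ sumL-filterB (λ l → decB l ∧ (Vec.sum l ℕ.≤ᵇ d)) H (below (replicate n d)) ⟩
    sumL (List.map (λ l → if decB l ∧ (Vec.sum l ℕ.≤ᵇ d) then H l else 0#) (below (replicate n d)))
      ≈⟨ sumL-below (replicate n d) (λ β _ → if decB β ∧ (Vec.sum β ℕ.≤ᵇ d) then H β else 0#) ⟩
    conv (replicate n d) (λ β _ → if decB β ∧ (Vec.sum β ℕ.≤ᵇ d) then H β else 0#)
      ≈⟨ conv-cong (replicate n d) (λ β γ eq → same β (headLe-box β γ eq)) ⟩
    conv (replicate n d) (λ β _ → if headLe d β ∧ decB β then H β else 0#)
      ≈⟨ box n H ℕP.≤-refl ⟩
    weakSum n d H ∎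
    where
    same : ∀ β → T (headLe d β) → (if decB β ∧ (Vec.sum β ℕ.≤ᵇ d) then H β else 0#) ≈ (if headLe d β ∧ decB β then H β else 0#)
    same β t with headLe d β | decB β in dec | Vec.sum β ℕ.≤ᵇ d in le
    ... | true | false | _     = refl
    ... | true | true  | true  = refl
    ... | true | true  | false = sym (vanish β (≡.subst T (≡.sym dec) tt)
      (ℕP.≰⇒> λ sum≤d → ≡.subst T le (ℕP.≤⇒≤ᵇ sum≤d)))

  -- λᵢ ↦ λᵢ + n − 1 − i with indices from 0: partitions become strictly decreasing.
  staircase : ∀ {n} → Vec ℕ n → Vec ℕ n
  staircase []              = []
  staircase {suc n} (a ∷ l) = a ℕ.+ n ∷ staircase l

  lookup-staircase : ∀ {n} (l : Vec ℕ n) i → Vec.lookup (staircase l) i ≡ Vec.lookup l i ℕ.+ (n ∸ suc (toℕ i))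
  lookup-staircase (a ∷ l) zero    = ≡.refl
  lookup-staircase (a ∷ l) (suc i) = lookup-staircase l i

  private
    strictSum-range : ∀ n N H → strictSum (suc n) N H ≈ rangeSum N (λ b → strictSum n b (λ l → H (b ∷ l)))
    strictSum-range n zero    H = refl
    strictSum-range n (suc N) H = +-congˡ (strictSum-range n N H)

    strictSum-short : ∀ n N H → N < n → strictSum n N H ≈ 0#
    strictSum-short (suc n) zero    H _         = refl
    strictSum-short (suc n) (suc N) H (s≤s N<n) = trans
      (+-cong (strictSum-short n N _ N<n) (strictSum-short (suc n) N H (ℕP.m≤n⇒m≤1+n N<n))) (+-identityˡ 0#)

  -- A first part up to c becomes a first entry up to c + n - 1, and the bound of `strictSum` is
  -- exclusive. Heads too small to be followed by a strictly decreasing tail contribute nothing,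
  -- which accounts for the shift of the range.
  weakSum-strictSum : ∀ n c (H : Vec ℕ n → Carrier) → weakSum n c (H ∘ staircase) ≈ strictSum n (c ℕ.+ n) H
  weakSum-strictSum zero    c H = refl
  weakSum-strictSum (suc n) c H = begin
    rangeSum (suc c) (λ a → weakSum n a (λ l → H (a ℕ.+ n ∷ staircase l)))
      ≈⟨ rangeSum-cong (suc c) (λ a _ → weakSum-strictSum n a (λ l → H (a ℕ.+ n ∷ l))) ⟩
    rangeSum (suc c) (λ a → strictSum n (a ℕ.+ n) (λ l → H (a ℕ.+ n ∷ l)))
      ≈⟨ rangeSum-shift (suc c) n (λ a a<n → strictSum-short n a _ a<n) ⟨
    rangeSum (suc c ℕ.+ n) (λ b → strictSum n b (λ l → H (b ∷ l)))
      ≈⟨ strictSum-range n (suc c ℕ.+ n) H ⟨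
    strictSum (suc n) (suc c ℕ.+ n) H
      ≈⟨ reflexive (≡.cong (λ N → strictSum (suc n) N H) (≡.sym (ℕP.+-suc c n))) ⟩
    strictSum (suc n) (c ℕ.+ suc n) H ∎

-- The partial fraction identity for the matrix entries

module Identities (R : CommutativeRing 0ℓ 0ℓ) where

  import Relation.Binary.Reasoning.Setoid
  open import Data.Nat using (ℕ; zero; suc)

  open CommutativeRing R hiding (zero)
  open CauchyBinet R using (rangeSum)
  open Relation.Binary.Reasoning.Setoid setoid
  open RingSolver R using (solve; _:=_; _:+_; _:*_; _:-_; :-_; :0; :1)

  -- The elements g₁ to g₄ are inverses of the four linear factors, and `m` is known only after
  -- multiplication by all four. Both sides are therefore multiplied by the product of all dᵢ gᵢ,
  -- which is 1, and compared over the common denominator.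
  entry-expansion : ∀ x y z t u g₁ g₂ g₃ g₄ {m} → y * z ≈ 1# →
    (1# - x * y) * g₁ ≈ 1# → (1# - x * (t * y)) * g₂ ≈ 1# →
    (1# - x * z) * g₃ ≈ 1# → (1# - x * (t * z)) * g₄ ≈ 1# →
    m * ((1# - x * y) * ((1# - x * (t * y)) * ((1# - x * z) * (1# - x * (t * z)))))
      ≈ (1# - u) + (u - t) * (x * y + x * z) + (t * t - u) * (x * x) →
    (y * g₁ - z * g₃) - u * (y * g₂ - z * g₄) ≈ (y - z) * m
  entry-expansion x y z t u g₁ g₂ g₃ g₄ {m} yz≈1 e₁ e₂ e₃ e₄ em = begin
    (y * g₁ - z * g₃) - u * (y * g₂ - z * g₄)
      ≈⟨ attach (unit e₁ e₂) (unit e₃ e₄) ⟨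
    ((y * g₁ - z * g₃) - u * (y * g₂ - z * g₄)) * ((d₁ * g₁ * (d₂ * g₂)) * (d₃ * g₃ * (d₄ * g₄)))
      ≈⟨ solve 12 (λ y z u g₁ g₂ g₃ g₄ d₁ d₂ d₃ d₄ i →
           ((y :* g₁ :- z :* g₃) :- u :* (y :* g₂ :- z :* g₄)) :* ((d₁ :* g₁ :* (d₂ :* g₂)) :* (d₃ :* g₃ :* (d₄ :* g₄)))
           := ((y :* (d₁ :* g₁) :* (d₂ :* (d₃ :* d₄)) :- z :* (d₃ :* g₃) :* (d₁ :* (d₂ :* d₄)))
               :- u :* (y :* (d₂ :* g₂) :* (d₁ :* (d₃ :* d₄)) :- z :* (d₄ :* g₄) :* (d₁ :* (d₂ :* d₃))))
              :* (g₁ :* g₂ :* (g₃ :* g₄))) refl y z u g₁ g₂ g₃ g₄ d₁ d₂ d₃ d₄ 0# ⟩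
    ((y * (d₁ * g₁) * (d₂ * (d₃ * d₄)) - z * (d₃ * g₃) * (d₁ * (d₂ * d₄)))
      - u * (y * (d₂ * g₂) * (d₁ * (d₃ * d₄)) - z * (d₄ * g₄) * (d₁ * (d₂ * d₃)))) * (g₁ * g₂ * (g₃ * g₄))
      ≈⟨ *-congʳ (+-cong (+-cong (one e₁) (-‿cong (one e₃))) (-‿cong (*-congˡ (+-cong (one e₂) (-‿cong (one e₄)))))) ⟩
    ((y * (d₂ * (d₃ * d₄)) - z * (d₁ * (d₂ * d₄))) - u * (y * (d₁ * (d₃ * d₄)) - z * (d₁ * (d₂ * d₃)))) * (g₁ * g₂ * (g₃ * g₄))
      ≈⟨ *-congʳ numerator ⟩
    (y - z) * (m * (d₁ * (d₂ * (d₃ * d₄)))) * (g₁ * g₂ * (g₃ * g₄))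
      ≈⟨ solve 10 (λ a m d₁ d₂ d₃ d₄ g₁ g₂ g₃ g₄ → a :* (m :* (d₁ :* (d₂ :* (d₃ :* d₄)))) :* (g₁ :* g₂ :* (g₃ :* g₄))
           := (a :* m) :* ((d₁ :* g₁ :* (d₂ :* g₂)) :* (d₃ :* g₃ :* (d₄ :* g₄)))) refl (y - z) m d₁ d₂ d₃ d₄ g₁ g₂ g₃ g₄ ⟩
    ((y - z) * m) * ((d₁ * g₁ * (d₂ * g₂)) * (d₃ * g₃ * (d₄ * g₄)))
      ≈⟨ attach (unit e₁ e₂) (unit e₃ e₄) ⟩
    (y - z) * m ∎
    where
    d₁ = 1# - x * y
    d₂ = 1# - x * (t * y)
    d₃ = 1# - x * z
    d₄ = 1# - x * (t * z)
    unit : ∀ {a b} → a ≈ 1# → b ≈ 1# → a * b ≈ 1#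
    unit ea eb = trans (*-cong ea eb) (*-identityˡ 1#)
    attach : ∀ {a b c} → b ≈ 1# → c ≈ 1# → a * (b * c) ≈ a
    attach eb ec = trans (*-congˡ (unit eb ec)) (*-identityʳ _)
    one : ∀ {a b c} → b ≈ 1# → a * b * c ≈ a * c
    one eb = *-congʳ (trans (*-congˡ eb) (*-identityʳ _))
    numerator : (y * (d₂ * (d₃ * d₄)) - z * (d₁ * (d₂ * d₄))) - u * (y * (d₁ * (d₃ * d₄)) - z * (d₁ * (d₂ * d₃)))
      ≈ (y - z) * (m * (d₁ * (d₂ * (d₃ * d₄))))
    numerator = begin
      (y * (d₂ * (d₃ * d₄)) - z * (d₁ * (d₂ * d₄))) - u * (y * (d₁ * (d₃ * d₄)) - z * (d₁ * (d₂ * d₃)))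
        -- With the product y z left standing in the last term this is a polynomial identity; y z =
        -- 1 is applied only afterwards.
        ≈⟨ solve 5 (λ x y z t u →
             let d₁ = :1 :- x :* y ; d₂ = :1 :- x :* (t :* y) ; d₃ = :1 :- x :* z ; d₄ = :1 :- x :* (t :* z) in
             (y :* (d₂ :* (d₃ :* d₄)) :- z :* (d₁ :* (d₂ :* d₄))) :- u :* (y :* (d₁ :* (d₃ :* d₄)) :- z :* (d₁ :* (d₂ :* d₃)))
             := (y :- z) :* ((:1 :- u) :+ (u :- t) :* (x :* y :+ x :* z) :+ (t :* t :- u) :* (x :* x :* (y :* z)))) refl x y z t u ⟩
      (y - z) * ((1# - u) + (u - t) * (x * y + x * z) + (t * t - u) * (x * x * (y * z)))
        ≈⟨ *-congˡ (+-congˡ (*-congˡ (trans (*-congˡ yz≈1) (*-identityʳ _)))) ⟩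
      (y - z) * ((1# - u) + (u - t) * (x * y + x * z) + (t * t - u) * (x * x))
        ≈⟨ *-congˡ em ⟨
      (y - z) * (m * (d₁ * (d₂ * (d₃ * d₄)))) ∎

  rangeSum-combination : ∀ y z u N (f₁ f₂ f₃ f₄ : ℕ → Carrier) {f : ℕ → Carrier} →
    (∀ l → f l ≈ (y * f₁ l - z * f₃ l) - u * (y * f₂ l - z * f₄ l)) →
    rangeSum N f ≈ (y * rangeSum N f₁ - z * rangeSum N f₃) - u * (y * rangeSum N f₂ - z * rangeSum N f₄)
  rangeSum-combination y z u zero    f₁ f₂ f₃ f₄ eq =
    solve 3 (λ y z u → :0 := (y :* :0 :- z :* :0) :- u :* (y :* :0 :- z :* :0)) refl y z u
  rangeSum-combination y z u (suc N) f₁ f₂ f₃ f₄ eq = trans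
    (+-cong (eq N) (rangeSum-combination y z u N f₁ f₂ f₃ f₄ eq))
    (solve 11 (λ y z u a b c d a′ b′ c′ d′ →
      ((y :* a :- z :* c) :- u :* (y :* b :- z :* d)) :+ ((y :* a′ :- z :* c′) :- u :* (y :* b′ :- z :* d′))
        := (y :* (a :+ a′) :- z :* (c :+ c′)) :- u :* (y :* (b :+ b′) :- z :* (d :+ d′)))
      refl y z u (f₁ N) (f₂ N) (f₃ N) (f₄ N) (rangeSum N f₁) (rangeSum N f₂) (rangeSum N f₃) (rangeSum N f₄))

-- The symplectic denominator as a Vandermonde determinant

module Chebyshev (R : CommutativeRing 0ℓ 0ℓ) where

  open import Data.Nat as ℕ using (zero; suc)
  open import Data.List as List using ([]; _∷_)
  import Relation.Binary.Reasoning.Setoid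

  open CommutativeRing R hiding (zero)
  open Determinants R
  open Vandermonde R
  open Relation.Binary.Reasoning.Setoid setoid
  open RingSolver R using (solve; _:=_; _:+_; _:*_; _:-_; :-_; :1)

  -- Here `p k` and `q k` are the k-th powers of `y` and `ȳ`, fixed by recurrences only, so that
  -- monomials with a given exponent can serve as they are.
  module Skew {n : ℕ} (y ȳ : Fin n → Carrier) (yȳ≈1 : ∀ j → y j * ȳ j ≈ 1#)
    (p q : ℕ → Fin n → Carrier)
    (p₀ : ∀ j → p 0 j ≈ 1#) (p₊ : ∀ k j → p (suc k) j ≈ y j * p k j)
    (q₀ : ∀ j → q 0 j ≈ 1#) (q₊ : ∀ k j → q (suc k) j ≈ ȳ j * q k j) where

    antisym : ℕ → Fin n → Carrier
    antisym k j = p (suc k) j - q (suc k) j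

    -- (y^(k+1) − ȳ^(k+1)) / (y − ȳ) as a polynomial in y + ȳ.
    chebyshev : ℕ → Fin n → Carrier
    chebyshev 0             j = 1#
    chebyshev 1             j = y j + ȳ j
    chebyshev (suc (suc k)) j = (y j + ȳ j) * chebyshev (suc k) j - 1# * chebyshev k j

    private
      antisym-step : ∀ k j → antisym (suc (suc k)) j ≈ (y j + ȳ j) * antisym (suc k) j - 1# * antisym k j
      antisym-step k j = begin
        p (3 ℕ.+ k) j - q (3 ℕ.+ k) j
          ≈⟨ +-cong (p₊ (2 ℕ.+ k) j) (-‿cong (q₊ (2 ℕ.+ k) j)) ⟩
        y j * P - ȳ j * Q
          ≈⟨ solve 4 (λ a b p q → a :* p :- b :* q := (a :+ b) :* (p :- q) :- (b :* p :- a :* q)) refl (y j) (ȳ j) P Q ⟩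
        (y j + ȳ j) * (P - Q) - (ȳ j * P - y j * Q)
          ≈⟨ +-congˡ (-‿cong (+-cong (lower (yȳ≈1 j) (p₊ (suc k) j))
               (-‿cong (lower (trans (*-comm _ _) (yȳ≈1 j)) (q₊ (suc k) j))))) ⟩
        (y j + ȳ j) * (P - Q) - (p (suc k) j - q (suc k) j)
          ≈⟨ +-congˡ (-‿cong (*-identityˡ _)) ⟨
        (y j + ȳ j) * antisym (suc k) j - 1# * antisym k j ∎
        where
        P = p (2 ℕ.+ k) j
        Q = q (2 ℕ.+ k) j
        lower : ∀ {a b p p′} → a * b ≈ 1# → p ≈ a * p′ → b * p ≈ p′
        lower {a} {b} {p} {p′} ab≈1 eq = begin
          b * p           ≈⟨ *-congˡ eq ⟩
          b * (a * p′)    ≈⟨ solve 3 (λ a b p → b :* (a :* p) := (a :* b) :* p) refl a b p′ ⟩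
          (a * b) * p′    ≈⟨ *-congʳ ab≈1 ⟩
          1# * p′         ≈⟨ *-identityˡ p′ ⟩
          p′              ∎

    antisym-chebyshev : ∀ k j → antisym k j ≈ (y j - ȳ j) * chebyshev k j
    antisym-chebyshev 0 j = begin
      p 1 j - q 1 j                        ≈⟨ +-cong (p₊ 0 j) (-‿cong (q₊ 0 j)) ⟩
      y j * p 0 j - ȳ j * q 0 j            ≈⟨ +-cong (*-congˡ (p₀ j)) (-‿cong (*-congˡ (q₀ j))) ⟩
      y j * 1# - ȳ j * 1#                  ≈⟨ solve 2 (λ a b → a :* :1 :- b :* :1 := (a :- b) :* :1) refl (y j) (ȳ j) ⟩
      (y j - ȳ j) * 1#                     ∎
    antisym-chebyshev 1 j = begin
      p 2 j - q 2 j
        ≈⟨ +-cong (trans (p₊ 1 j) (*-congˡ (p₊ 0 j))) (-‿cong (trans (q₊ 1 j) (*-congˡ (q₊ 0 j)))) ⟩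
      y j * (y j * p 0 j) - ȳ j * (ȳ j * q 0 j)
        ≈⟨ +-cong (*-congˡ (*-congˡ (p₀ j))) (-‿cong (*-congˡ (*-congˡ (q₀ j)))) ⟩
      y j * (y j * 1#) - ȳ j * (ȳ j * 1#)
        ≈⟨ solve 2 (λ a b → a :* (a :* :1) :- b :* (b :* :1) := (a :- b) :* (a :+ b)) refl (y j) (ȳ j) ⟩
      (y j - ȳ j) * (y j + ȳ j) ∎
    antisym-chebyshev (suc (suc k)) j = begin
      antisym (suc (suc k)) j
        ≈⟨ antisym-step k j ⟩
      (y j + ȳ j) * antisym (suc k) j - 1# * antisym k j
        ≈⟨ +-cong (*-congˡ (antisym-chebyshev (suc k) j)) (-‿cong (*-congˡ (antisym-chebyshev k j))) ⟩
      (y j + ȳ j) * ((y j - ȳ j) * chebyshev (suc k) j) - 1# * ((y j - ȳ j) * chebyshev k j)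
        ≈⟨ solve 4 (λ w d p q → w :* (d :* p) :- :1 :* (d :* q) := d :* (w :* p :- :1 :* q)) refl (y j + ȳ j) (y j - ȳ j) (chebyshev (suc k) j) (chebyshev k j) ⟩
      (y j - ȳ j) * chebyshev (suc (suc k)) j ∎

    skew : Carrier
    skew = prodL (List.map (λ j → y j - ȳ j) (List.allFin n))

    w : Fin n → Carrier
    w j = y j + ȳ j

    -- This is the Weyl denominator formula of type C: after yⱼ - ȳⱼ is taken out of column j, the
    -- rows are monic polynomials in wⱼ of consecutive degrees.
    antisym-determinant : descending n antisym ≈ skew * pairProduct (λ i j → w i - w j)
    antisym-determinant = begin
      descending n antisym
        ≈⟨ descending-cong n antisym-chebyshev ⟩
      descending n (λ k j → (y j - ȳ j) * chebyshev k j)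
        ≈⟨ scale-columns (λ j → y j - ȳ j) _ ⟩
      ∏ (λ j → y j - ȳ j) * descending n chebyshev
        -- The constant of the recurrence is y ȳ = 1; it is written out as a factor in `chebyshev`,
        -- so the recurrence holds by reflexivity.
        ≈⟨ *-cong (sym (prodL-allFin (λ j → y j - ȳ j)))
             (vandermonde n 1# y ȳ chebyshev yȳ≈1 (λ _ → refl) (λ _ → refl) (λ _ _ → refl)) ⟩
      skew * pairProduct (λ i j → w i - w j) ∎

    skew-regular : (∀ j x → (y j - ȳ j) * x ≈ 0# → x ≈ 0#) → ∀ x → skew * x ≈ 0# → x ≈ 0#
    skew-regular regular = go (List.allFin n)
      where
      go : ∀ js x → prodL (List.map (λ j → y j - ȳ j) js) * x ≈ 0# → x ≈ 0#
      go []       x eq = trans (sym (*-identityˡ x)) eq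
      go (j ∷ js) x eq = go js x (regular j _ (trans (sym (*-assoc _ _ x)) eq))

    -- This identifies the y-part of the denominator in the theorem with the Vandermonde product in
    -- w.
    w-difference : ∀ i j → (y i - y j) * (1# - ȳ i * ȳ j) ≈ w i - w j
    w-difference i j = begin
      (y i - y j) * (1# - ȳ i * ȳ j)
        ≈⟨ solve 4 (λ a b c d → (a :- b) :* (:1 :- c :* d) := a :- b :- (a :* c) :* d :+ (b :* d) :* c) refl (y i) (y j) (ȳ i) (ȳ j) ⟩
      y i - y j - (y i * ȳ i) * ȳ j + (y j * ȳ j) * ȳ i
        ≈⟨ +-cong (+-congˡ (-‿cong (*-congʳ (yȳ≈1 i)))) (*-congʳ (yȳ≈1 j)) ⟩
      y i - y j - 1# * ȳ j + 1# * ȳ i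
        ≈⟨ solve 4 (λ a b c d → a :- b :- :1 :* d :+ :1 :* c := (a :+ c) :- (b :+ d)) refl (y i) (y j) (ȳ i) (ȳ j) ⟩
      w i - w j ∎

-- Powers of y and ȳ as Laurent monomials

module Symplectic (n : ℕ) where

  open import Algebra.Bundles using (CommutativeRing)
  open import Data.Nat using (suc)
  open import Data.Integer as ℤ using (+_; 1ℤ; -1ℤ)
  import Data.Integer.Properties as ℤP
  open import Relation.Binary.PropositionalEquality as ≡ using (_≡_)

  open Laurent n using (laurent; yPow-*; yPow-0; y-ȳ-regular)
  open CommutativeRing laurent hiding (zero)

  yȳ≈1 : ∀ j → yL j * ybarL j ≈ 1#
  yȳ≈1 j = trans (yPow-* j 1ℤ -1ℤ) (yPow-0 j)

  yPow-suc : ∀ k j → yPow j (+ suc k) ≈ yL j * yPow j (+ k)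
  yPow-suc k j = sym (yPow-* j 1ℤ (+ k))

  yPow-neg-suc : ∀ k j → yPow j (ℤ.- (+ suc k)) ≈ ybarL j * yPow j (ℤ.- (+ k))
  yPow-neg-suc k j = trans (reflexive (≡.cong (yPow j) (ℤP.neg-distrib-+ 1ℤ (+ k)))) (sym (yPow-* j -1ℤ (ℤ.- (+ k))))

  yPos yNeg : ℕ → Fin n → Laur n
  yPos k j = yPow j (+ k)
  yNeg k j = yPow j (ℤ.- (+ k))

-- The matrix entries as truncated power series

module EntryExpansion (R : CommutativeRing 0ℓ 0ℓ) (n : ℕ) where

  open import Data.Nat as ℕ using (suc)
  open import Data.Fin using (Fin)

  open Series R
  open SeriesFacts R n
  private
    module C = CommutativeRing R

  one : Series n
  one = const C.1#

  entryDenominator : Fin n → (t y z : C.Carrier) → Series n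
  entryDenominator i t y z =
    (one ⊕ ⊝ (X i ⊛ const y)) ⊛ ((one ⊕ ⊝ (X i ⊛ const (t C.* y)))
      ⊛ ((one ⊕ ⊝ (X i ⊛ const z)) ⊛ (one ⊕ ⊝ (X i ⊛ const (t C.* z)))))

  -- The square of t is a separate argument because the numerator is given with the monomial
  -- `tuPow 2 0`, which equals the product of t with itself only up to the equality of the ring.
  entryNumerator : Fin n → (t t² u y z : C.Carrier) → Series n
  entryNumerator i t t² u y z =
    const (C.1# C.- u) ⊕ const (u C.- t) ⊛ (X i ⊛ const y ⊕ X i ⊛ const z) ⊕ const (t² C.- u) ⊛ X^ i 2

  module _ (k : ℕ) where
    open CommutativeRing (truncated n k) hiding (zero)
    open CauchyBinet (truncated n k) using (rangeSum)
    open Identities (truncated n k) using (entry-expansion; rangeSum-combination)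
    open RingSolver (truncated n k) using (solve; _:=_; _:*_; _:-_; :1)

    -- The summand splits into four geometric progressions in x, with ratios x y, x t y, x z and x t
    -- z. Their truncated sums are the inverses that the partial fraction identity asks for.
    entry-series : ∀ {N} → k ℕ.≤ N → ∀ i t t² u y z (τ v p q : ℕ → C.Carrier) {m} →
      t² C.≈ t C.* t → y C.* z C.≈ C.1# →
      τ 0 C.≈ C.1# → (∀ l → τ (suc l) C.≈ t C.* τ l) → (∀ l → v l C.≈ u C.* τ l) →
      p 0 C.≈ C.1# → (∀ l → p (suc l) C.≈ y C.* p l) →
      q 0 C.≈ C.1# → (∀ l → q (suc l) C.≈ z C.* q l) →
      m ⊛ entryDenominator i t y z ≈[ k ] entryNumerator i t t² u y z →
      rangeSum N (λ l → const (C.1# C.- v l) ⊛ X^ i l ⊛ const (p (suc l) C.- q (suc l))) ≈[ k ] const (y C.- z) ⊛ m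
    entry-series {N} k≤N i t t² u y z τ v p q {m} t²≈ yz≈1 τ₀ τ₊ v≈ p₀ p₊ q₀ q₊ em =
      trans (sum-terms N) (trans
        (entry-expansion (X i) cy cz ct cu G₁ G₂ G₃ G₄ {m}
          (trans (sym (const-* k y z)) (const-cong yz≈1))
          (geometric k k≤N i y p p₀ p₊)
          (trans (*-congʳ {G₂} (shifted y)) (geometric k k≤N i (t C.* y) (λ l → τ l C.* p l) (start p p₀) (step p₊)))
          (geometric k k≤N i z q q₀ q₊)
          (trans (*-congʳ {G₄} (shifted z)) (geometric k k≤N i (t C.* z) (λ l → τ l C.* q l) (start q q₀) (step q₊)))
          (trans (*-congˡ (*-congˡ (*-cong (shifted y) (*-congˡ (shifted z))))) (trans em numerator)))
        (*-congʳ {m} (sym (const-sub k y z))))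
      where
      cy cz ct cu : Series n
      cy = const y
      cz = const z
      ct = const t
      cu = const u
      g₁ g₂ g₃ g₄ : ℕ → Series n
      g₁ l = X^ i l ⊛ const (p l)
      g₂ l = X^ i l ⊛ const (τ l C.* p l)
      g₃ l = X^ i l ⊛ const (q l)
      g₄ l = X^ i l ⊛ const (τ l C.* q l)
      G₁ G₂ G₃ G₄ : Series n
      G₁ = rangeSum N g₁
      G₂ = rangeSum N g₂
      G₃ = rangeSum N g₃
      G₄ = rangeSum N g₄
      shifted : ∀ a → one ⊕ ⊝ (X i ⊛ (ct ⊛ const a)) ≈[ k ] one ⊕ ⊝ (X i ⊛ const (t C.* a))
      shifted a = +-congˡ {one} (-‿cong (*-congˡ {X i} (sym (const-* k t a))))
      start : ∀ f → f 0 C.≈ C.1# → τ 0 C.* f 0 C.≈ C.1#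
      start f f₀ = C.trans (C.*-cong τ₀ f₀) (C.*-identityˡ C.1#)
      step : ∀ {a} {f : ℕ → C.Carrier} → (∀ l → f (suc l) C.≈ a C.* f l) → ∀ l → τ (suc l) C.* f (suc l) C.≈ (t C.* a) C.* (τ l C.* f l)
      step {a} {f} f₊ l = C.trans (C.*-cong (τ₊ l) (f₊ l))
        (CR.solve 4 (λ t s a f → (t CR.:* s) CR.:* (a CR.:* f) CR.:= (t CR.:* a) CR.:* (s CR.:* f)) C.refl t (τ l) a (f l))
        where module CR = RingSolver R
      numerator : entryNumerator i t t² u y z ≈[ k ] (one ⊕ ⊝ cu) ⊕ (cu ⊕ ⊝ ct) ⊛ (X i ⊛ cy ⊕ X i ⊛ cz) ⊕ (ct ⊛ ct ⊕ ⊝ cu) ⊛ (X i ⊛ X i)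
      numerator = +-cong (+-cong (const-sub k C.1# u) (*-congʳ {X i ⊛ cy ⊕ X i ⊛ cz} (const-sub k u t)))
        (*-cong (trans (const-sub k t² u) (+-congʳ {⊝ cu} (trans (const-cong t²≈) (const-* k t t)))) (sym (X^-* k i 1 1)))
      term : ∀ l → const (C.1# C.- v l) ⊛ X^ i l ⊛ const (p (suc l) C.- q (suc l)) ≈[ k ]
        (cy ⊛ g₁ l ⊕ ⊝ (cz ⊛ g₃ l)) ⊕ ⊝ (cu ⊛ (cy ⊛ g₂ l ⊕ ⊝ (cz ⊛ g₄ l)))
      term l = trans
        (*-cong (*-congʳ {X^ i l} (trans (const-sub k C.1# (v l)) (+-congˡ {one} (-‿cong (trans (const-cong (v≈ l)) (const-* k u (τ l)))))))
          (trans (const-sub k (p (suc l)) (q (suc l))) (+-cong (trans (const-cong (p₊ l)) (const-* k y (p l)))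
            (-‿cong (trans (const-cong (q₊ l)) (const-* k z (q l)))))))
        (trans
          (solve 7 (λ u s x y z p q → (:1 :- u :* s) :* x :* (y :* p :- z :* q) :=
              (y :* (x :* p) :- z :* (x :* q)) :- u :* (y :* (x :* (s :* p)) :- z :* (x :* (s :* q))))
            refl cu (const (τ l)) (X^ i l) cy cz (const (p l)) (const (q l)))
          (+-congˡ {cy ⊛ g₁ l ⊕ ⊝ (cz ⊛ g₃ l)} (-‿cong (*-congˡ {cu} (+-cong (*-congˡ {cy} (*-congˡ {X^ i l} (sym (const-* k (τ l) (p l)))))
            (-‿cong (*-congˡ {cz} (*-congˡ {X^ i l} (sym (const-* k (τ l) (q l)))))))))))
      sum-terms : ∀ N → rangeSum N (λ l → const (C.1# C.- v l) ⊛ X^ i l ⊛ const (p (suc l) C.- q (suc l))) ≈[ k ]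
        (cy ⊛ rangeSum N g₁ ⊕ ⊝ (cz ⊛ rangeSum N g₃)) ⊕ ⊝ (cu ⊛ (cy ⊛ rangeSum N g₂ ⊕ ⊝ (cz ⊛ rangeSum N g₄)))
      sum-terms N = rangeSum-combination cy cz cu N g₁ g₂ g₃ g₄ term

-- Alternants in the x's and the order of Schur polynomials

module Alternants (R : CommutativeRing 0ℓ 0ℓ) (n : ℕ) where

  open import Data.Nat as ℕ using (zero; suc; _∸_)
  import Data.Nat.Properties as ℕP
  open import Data.Fin using (zero; suc; toℕ)
  open import Data.Vec as Vec using ([]; _∷_)
  import Data.Vec.Properties as VecP
  open import Data.List as List using (List; []; _∷_; length)
  import Data.List.Properties as ListP
  open import Data.List.Relation.Unary.All as All using (All; []; _∷_)
  import Data.List.Relation.Unary.All.Properties as AllP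
  open import Data.Product using (_×_; _,_; proj₁; proj₂)
  open import Data.Bool using (true; false; if_then_else_; T)
  open import Data.Unit using (tt)
  open import Relation.Binary.PropositionalEquality as ≡ using (_≡_; _≢_)
  import Algebra.Properties.CommutativeSemigroup

  open Series R
  open SeriesFacts R n
  private
    module C = CommutativeRing R

  exponent : ∀ {m} → Vec ℕ m → Fin m → ℕ
  exponent {m} l i = Vec.lookup l i ℕ.+ (m ∸ suc (toℕ i))

  alternantₓ : Vec ℕ n → Series n
  alternantₓ l = SO.det (λ i j → X^ j (exponent l i))

  alternant-order : ∀ l → alternantₓ l ≈[ total (exponent l) ] 0ₛ
  alternant-order l = det-order (exponent l) (λ i j → X^ j (exponent l i)) (λ i j → X^-order j (exponent l i))

  difference : Fin n × Fin n → Series n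
  difference p = X (proj₁ p) ⊕ ⊝ X (proj₂ p)

  module _ (k : ℕ) where
    open CommutativeRing (truncated n k) hiding (zero)
    open Vandermonde (truncated n k) using (vandermonde; pairProduct; pairProduct-cong; prodL-pairsLt)
    open Determinants (truncated n k) using (det-cong)
    open RingSolver (truncated n k) using (solve; _:=_; _:+_; _:*_; _:-_; :0)

    -- The degenerate case β = 0, c = 0 of `vandermonde`: the three-term recurrence becomes
    -- multiplication by x.
    alternant-vandermonde : alternantₓ (replicate n 0) ≈[ k ] pairProduct (λ i j → difference (i , j))
    alternant-vandermonde = trans
      (trans (det-cong {n} λ i j → reflexive (≡.cong (X^ j) (≡.cong (ℕ._+ (n ∸ suc (toℕ i))) (VecP.lookup-replicate i 0))))
        (vandermonde n 0ₛ X (λ _ → 0ₛ) (λ e j → X^ j e) (λ j → zeroʳ (X j)) (X^-0 k)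
          (λ j → sym (+-identityʳ (X j))) recurrence))
      (pairProduct-cong λ i j → solve 2 (λ a b → (a :+ :0) :- (b :+ :0) := a :- b) refl (X i) (X j))
      where
      recurrence : ∀ e j → X^ j (suc (suc e)) ≈[ k ] (X j ⊕ 0ₛ) ⊛ X^ j (suc e) ⊕ ⊝ (0ₛ ⊛ X^ j e)
      recurrence e j = trans (sym (X^-* k j 1 (suc e)))
        (solve 3 (λ x a b → x :* a := (x :+ :0) :* a :- :0 :* b) refl (X j) (X^ j (suc e)) (X^ j e))

    alternant-product : alternantₓ (replicate n 0) ≈[ k ] SO.prodL (List.map difference (pairsLt n))
    alternant-product = trans alternant-vandermonde (sym (prodL-pairsLt n difference))

  private
    total-+ : ∀ {m} (f g : Fin m → ℕ) → total (λ i → f i ℕ.+ g i) ≡ total f ℕ.+ total g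
    total-+ {zero}  f g = ≡.refl
    total-+ {suc m} f g = ≡.trans (≡.cong (f zero ℕ.+ g zero ℕ.+_) (total-+ (λ i → f (suc i)) (λ i → g (suc i))))
      (Algebra.Properties.CommutativeSemigroup.interchange ℕP.+-commutativeSemigroup (f zero) (g zero) _ _)

    total-lookup : ∀ {m} (l : Vec ℕ m) → total (Vec.lookup l) ≡ Vec.sum l
    total-lookup []      = ≡.refl
    total-lookup (a ∷ l) = ≡.cong (a ℕ.+_) (total-lookup l)

    total-1 : ∀ m → total {m} (λ _ → 1) ≡ m
    total-1 zero    = ≡.refl
    total-1 (suc m) = ≡.cong suc (total-1 m)

    total-cong : ∀ {m} {f g : Fin m → ℕ} → (∀ i → f i ≡ g i) → total f ≡ total g
    total-cong {zero}  eq = ≡.refl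
    total-cong {suc m} eq = ≡.cong₂ ℕ._+_ (eq zero) (total-cong (λ i → eq (suc i)))

    length-concatMap : ∀ {A B : Set} {m} (g : A → List B) (f : Fin m → A) →
      length (List.concatMap g (List.tabulate f)) ≡ total (λ i → length (g (f i)))
    length-concatMap {m = zero}  g f = ≡.refl
    length-concatMap {m = suc m} g f = ≡.trans (ListP.length-++ (g (f zero)))
      (≡.cong (length (g (f zero)) ℕ.+_) (length-concatMap g (λ i → f (suc i))))

    cell : ∀ {m} → Fin m → Fin m → List (Fin m × Fin m)
    cell i j = if toℕ i ℕ.<ᵇ toℕ j then (i , j) ∷ [] else []

    length-cell-suc : ∀ {m} (i j : Fin m) → length (cell (suc i) (suc j)) ≡ length (cell i j)
    length-cell-suc i j with toℕ i ℕ.<ᵇ toℕ j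
    ... | true  = ≡.refl
    ... | false = ≡.refl

    total-cell : ∀ {m} (i : Fin m) → total (λ j → length (cell i j)) ≡ m ∸ suc (toℕ i)
    total-cell {suc m} zero    = total-1 m
    total-cell {suc m} (suc i) = ≡.trans (total-cong (length-cell-suc i)) (total-cell i)

    length-pairsLt : ∀ m → length (pairsLt m) ≡ total {m} (λ i → m ∸ suc (toℕ i))
    length-pairsLt m = ≡.trans (length-concatMap {m = m} (λ i → List.concatMap (cell i) (List.allFin m)) (λ i → i))
      (total-cong {m} λ i → ≡.trans (length-concatMap (cell i) (λ j → j)) (total-cell i))

    total-exponent : ∀ (l : Vec ℕ n) → total (exponent l) ≡ length (List.map difference (pairsLt n)) ℕ.+ Vec.sum l
    total-exponent l = ≡.trans (total-+ {n} (Vec.lookup l) (λ i → n ∸ suc (toℕ i)))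
      (≡.trans (ℕP.+-comm (total (Vec.lookup l)) (total {n} (λ i → n ∸ suc (toℕ i))))
      (≡.cong₂ ℕ._+_ (≡.trans (≡.sym (length-pairsLt n)) (≡.sym (ListP.length-map difference (pairsLt n)))) (total-lookup l)))

    pairsLt-distinct : All (λ p → proj₁ p ≢ proj₂ p) (pairsLt n)
    pairsLt-distinct = AllP.concat⁺ (AllP.map⁺ (All.universal (λ i → AllP.concat⁺ (AllP.map⁺ (All.universal (distinct i) (List.allFin n)))) (List.allFin n)))
      where
      distinct : ∀ (i j : Fin n) → All (λ p → proj₁ p ≢ proj₂ p) (cell i j)
      distinct i j with toℕ i ℕ.<ᵇ toℕ j in eq
      ... | false = []
      ... | true  = (λ i≡j → ℕP.<-irrefl (≡.cong toℕ i≡j) (ℕP.<ᵇ⇒< (toℕ i) (toℕ j) (≡.subst T (≡.sym eq) tt))) ∷ []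

  -- The alternant of `l` has order at least |l| plus the number of pairs i < j. The Vandermonde
  -- product has exactly that many linear factors, and cancelling each of them costs one degree.
  quotient-order : ∀ l {f : Series n} → (∀ k → f ⊛ alternantₓ (replicate n 0) ≈[ k ] alternantₓ l) → f ≈[ Vec.sum l ] 0ₛ
  quotient-order l {f} eq = prodL-cancel (AllP.map⁺ (All.map (λ i≢j {k} {g} → difference-cancel i≢j {k} {g}) pairsLt-distinct))
    (≡.subst (λ K → SO.prodL (List.map difference (pairsLt n)) ⊛ f ≈[ K ] 0ₛ) (total-exponent l)
      (S.trans (S.*-congʳ {f} (S.sym (alternant-product K))) (S.trans (S.*-comm (alternantₓ (replicate n 0)) f)
        (S.trans (eq K) (alternant-order l)))))
    where
    K = total (exponent l)
    module S = CommutativeRing (truncated n K)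

-- The identity over an abstract coefficient ring

module SymplecticCauchy (R : CommutativeRing 0ℓ 0ℓ) where

  open import Data.Nat as ℕ using (zero; suc; _∸_)
  import Data.Nat.Properties as ℕP
  open import Data.Fin using (zero; suc; toℕ)
  open import Data.Vec as Vec using (_∷_)
  import Data.Vec.Properties as VecP
  import Data.List as List
  open import Data.Product using (_×_; _,_)
  open import Function using (_∘_)
  open import Relation.Binary.PropositionalEquality as ≡ using (_≡_)
  import Algebra.Properties.Ring
  import Relation.Binary.Reasoning.Setoid

  open Series R
  private
    module C = CommutativeRing R
    module CD = Determinants R
    module CB = CauchyBinet R
    module CV = Vandermonde R
    module CP = Partitions R

  open Defs.Ops C.0# C.1# C._+_ C._*_ (C.-_) using (sumL; prodL; det)

  private
    rangeSum-at : ∀ n k N (f : ℕ → Series n) α →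
      CauchyBinet.rangeSum (truncated n k) N f α C.≈ CB.rangeSum N (λ a → f a α)
    rangeSum-at n k zero    f α = const-0 α
    rangeSum-at n k (suc N) f α = C.+-congˡ (rangeSum-at n k N f α)

    weakSum-at : ∀ {n} k m c (F : Vec ℕ m → Series n) α →
      Partitions.weakSum (truncated n k) m c F α C.≈ CP.weakSum m c (λ l → F l α)
    weakSum-at k zero    c F α = C.refl
    weakSum-at {n} k (suc m) c F α = C.trans
      (rangeSum-at n k (suc c) (λ a → Partitions.weakSum (truncated n k) m a (λ l → F (a ∷ l))) α)
      (CP.rangeSum-cong (suc c) λ a _ → weakSum-at k m a (λ l → F (a ∷ l)) α)

  partitionSum : ∀ {n} → (Vec ℕ n → Series n) → Series n
  partitionSum {n} F α = sumL (List.map (λ l → F l α) (partitionsUpTo n (Vec.sum α)))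

  -- The range of `partitionSum` varies with the coefficient, which rules out computing with it as a
  -- sum of ring elements. By the order hypothesis, one range serves all coefficients below degree
  -- `k`.
  partitionSum-weakSum : ∀ {n} k (F : Vec ℕ n → Series n) →
    (∀ l → IsPartition l → F l ≈[ Vec.sum l ] const C.0#) →
    partitionSum F ≈[ k ] Partitions.weakSum (truncated n k) n k F
  partitionSum-weakSum {n} k F order = mk λ α α<k →
    C.trans (CP.sumL-partitionsUpTo n (Vec.sum α) (λ l → F l α) (vanish α)) (C.sym
      (C.trans (weakSum-at k n k F α) (CP.weakSum-extend n (ℕP.<⇒≤ α<k) (vanish α))))
    where
    vanish : ∀ α l → IsPartition l → Vec.sum α ℕ.< Vec.sum l → F l α C.≈ C.0#
    vanish α l part lt = C.trans (at (order l part) α lt) (const-0 α)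

  n∸i : ∀ {m} (i : Fin m) → m ∸ toℕ i ≡ suc (m ∸ suc (toℕ i))
  n∸i {suc m} zero    = ≡.refl
  n∸i {suc m} (suc i) = n∸i i

  -- The sequences τ, v, p and q stand for the powers tˡ, u tˡ, yˡ and ȳˡ. The Laurent ring enters
  -- only through the listed equations and the regularity of y - ȳ.
  module Identity {n : ℕ} (t t² u : C.Carrier) (τ v : ℕ → C.Carrier)
    (y ȳ : Fin n → C.Carrier) (p q : ℕ → Fin n → C.Carrier)
    (t²≈ : t² C.≈ t C.* t)
    (τ₀ : τ 0 C.≈ C.1#) (τ₊ : ∀ l → τ (suc l) C.≈ t C.* τ l) (v≈ : ∀ l → v l C.≈ u C.* τ l)
    (yȳ≈1 : ∀ j → y j C.* ȳ j C.≈ C.1#)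
    (p₀ : ∀ j → p 0 j C.≈ C.1#) (p₊ : ∀ k j → p (suc k) j C.≈ y j C.* p k j)
    (q₀ : ∀ j → q 0 j C.≈ C.1#) (q₊ : ∀ k j → q (suc k) j C.≈ ȳ j C.* q k j)
    (regular : ∀ j x → (y j C.- ȳ j) C.* x C.≈ C.0# → x C.≈ C.0#)
    where

    open SeriesFacts R n
    open EntryExpansion R n
    open Alternants R n
    open Chebyshev.Skew R y ȳ yȳ≈1 p q p₀ p₊ q₀ q₊

    coefficient : Vec ℕ n → C.Carrier
    coefficient l = prodL (List.map (λ i → C.1# C.- v (exponent l i)) (List.allFin n))

    spNum : Vec ℕ n → C.Carrier
    spNum l = det (λ i j → let e = Vec.lookup l i ℕ.+ (n ∸ toℕ i) in p e j C.- q e j)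

    spDen : C.Carrier
    spDen = spNum (replicate n 0)

    yDifference : Fin n × Fin n → C.Carrier
    yDifference (i , j) = (y i C.- y j) C.* (C.1# C.- ȳ i C.* ȳ j)

    denominator : Series n
    denominator = SO.prodL (List.map (λ ij → difference ij ⊛ const (yDifference ij)) (pairsLt n))

    W : C.Carrier
    W = CV.pairProduct (λ i j → w i C.- w j)

    private
      antisym-≡ : ∀ j {e k} → e ≡ suc k → p e j C.- q e j C.≈ antisym k j
      antisym-≡ j ≡.refl = C.refl

      exponent-suc : ∀ (l : Vec ℕ n) i → Vec.lookup l i ℕ.+ (n ∸ toℕ i) ≡ suc (exponent l i)
      exponent-suc l i = ≡.trans (≡.cong (Vec.lookup l i ℕ.+_) (n∸i i)) (ℕP.+-suc _ _)

    spNum-antisym : ∀ l → spNum l C.≈ det (λ i → antisym (exponent l i))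
    spNum-antisym l = CD.det-cong (λ i j → antisym-≡ j (exponent-suc l i))

    spDen-factor : spDen C.≈ skew C.* W
    spDen-factor = C.trans
      (CD.det-cong (λ i j → antisym-≡ j (≡.trans (≡.cong (ℕ._+ (n ∸ toℕ i)) (VecP.lookup-replicate i 0)) (n∸i i))))
      antisym-determinant

    module _ (s : Vec ℕ n → Series n) (sp : Vec ℕ n → C.Carrier) (M : Fin n → Fin n → Series n)
      (s-eq : ∀ l → IsPartition l → ∀ k → s l ⊛ alternantₓ (replicate n 0) ≈[ k ] alternantₓ l)
      (sp-eq : ∀ l → IsPartition l → sp l C.* spDen C.≈ spNum l)
      (M-eq : ∀ i j k → M i j ⊛ entryDenominator i t (y j) (ȳ j) ≈[ k ] entryNumerator i t t² u (y j) (ȳ j))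
      where

      F : Vec ℕ n → Series n
      F l = const (coefficient l C.* sp l) ⊛ s l

      module _ (k : ℕ) where
        open CommutativeRing (truncated n k) hiding (zero)
        open Relation.Binary.Reasoning.Setoid setoid
        open Determinants (truncated n k) using (det-cong; scale-rows; scale-columns; ∏; prodL-allFin)
        open CauchyBinet (truncated n k) using (rangeSum; strictSum; cauchy-binet)
        open Partitions (truncated n k) using (weakSum; weakSum-cong; weakSum-*; weakSum-strictSum; staircase; lookup-staircase)
        open Vandermonde (truncated n k) using (pairProduct; pairProduct-*; prodL-pairsLt)
        open RingSolver (truncated n k) using (solve; _:=_; _:*_; _:-_)

        F-order : ∀ l → IsPartition l → F l ≈[ Vec.sum l ] 0ₛ
        F-order l part = ⊛-order {0} {Vec.sum l} {const (coefficient l C.* sp l)} {s l} (mk λ _ ()) (quotient-order l (s-eq l part))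

        denominator-factor : denominator ≈[ k ] alternantₓ (replicate n 0) ⊛ const W
        denominator-factor = begin
          denominator
            ≈⟨ prodL-pairsLt n (λ ij → difference ij ⊛ const (yDifference ij)) ⟩
          pairProduct (λ i j → difference (i , j) ⊛ const (yDifference (i , j)))
            ≈⟨ pairProduct-* (λ i j → difference (i , j)) (λ i j → const (yDifference (i , j))) ⟩
          pairProduct (λ i j → difference (i , j)) ⊛ pairProduct (λ i j → const (yDifference (i , j)))
            ≈⟨ *-cong (sym (alternant-vandermonde k)) (trans (sym (prodL-pairsLt n (λ ij → const (yDifference ij))))
                 (trans (sym (const-prodL k yDifference (pairsLt n)))
                 (const-cong (C.trans (CV.prodL-pairsLt n yDifference) (CV.pairProduct-cong w-difference))))) ⟩
          alternantₓ (replicate n 0) ⊛ const W ∎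

        A B : ℕ → Fin n → Series n
        A l j = const (C.1# C.- v l) ⊛ X^ j l
        B l j = const (antisym l j)

        det-A : ∀ l → SO.det (λ i → A (Vec.lookup (staircase l) i)) ≈[ k ] const (coefficient l) ⊛ alternantₓ l
        det-A l = begin
          SO.det (λ i → A (Vec.lookup (staircase l) i))
            ≈⟨ det-cong {n} (λ i j → reflexive (≡.cong (λ e → A e j) (lookup-staircase l i))) ⟩
          SO.det (λ i j → const (C.1# C.- v (exponent l i)) ⊛ X^ j (exponent l i))
            ≈⟨ scale-rows (λ i → const (C.1# C.- v (exponent l i))) (λ i j → X^ j (exponent l i)) ⟩
          ∏ (λ i → const (C.1# C.- v (exponent l i))) ⊛ alternantₓ l
            ≈⟨ *-congʳ {alternantₓ l} (trans (sym (prodL-allFin {n} (λ i → const (C.1# C.- v (exponent l i)))))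
                 (sym (const-prodL k (λ i → C.1# C.- v (exponent l i)) (List.allFin n)))) ⟩
          const (coefficient l) ⊛ alternantₓ l ∎

        det-B : ∀ l → SO.det (λ i → B (Vec.lookup (staircase l) i)) ≈[ k ] const (spNum l)
        det-B l = begin
          SO.det (λ i → B (Vec.lookup (staircase l) i))
            ≈⟨ det-cong {n} (λ i j → reflexive (≡.cong (λ e → B e j) (lookup-staircase l i))) ⟩
          SO.det (λ i j → const (antisym (exponent l i) j))
            ≈⟨ const-det k (λ i → antisym (exponent l i)) ⟨
          const (det (λ i → antisym (exponent l i)))
            ≈⟨ const-cong (spNum-antisym l) ⟨
          const (spNum l) ∎

        -- Each of the two denominators meets its quotient, so the defining equations of `s` and
        -- `sp` apply directly; the factors 1 - u tᵐ are absorbed into the rows of the first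
        -- determinant.
        summand : ∀ l → IsPartition l → F l ⊛ (alternantₓ (replicate n 0) ⊛ const spDen) ≈[ k ]
          SO.det (λ i → A (Vec.lookup (staircase l) i)) ⊛ SO.det (λ i → B (Vec.lookup (staircase l) i))
        summand l part = begin
          const (coefficient l C.* sp l) ⊛ s l ⊛ (Δ ⊛ const spDen)
            ≈⟨ *-congʳ {Δ ⊛ const spDen} (*-congʳ {s l} (const-* k (coefficient l) (sp l))) ⟩
          const (coefficient l) ⊛ const (sp l) ⊛ s l ⊛ (Δ ⊛ const spDen)
            ≈⟨ solve 5 (λ c a s d e → c :* a :* s :* (d :* e) := c :* (s :* d) :* (a :* e)) refl
                 (const (coefficient l)) (const (sp l)) (s l) Δ (const spDen) ⟩
          const (coefficient l) ⊛ (s l ⊛ Δ) ⊛ (const (sp l) ⊛ const spDen)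
            ≈⟨ *-cong (*-congˡ {const (coefficient l)} (s-eq l part k))
                 (trans (sym (const-* k (sp l) spDen)) (const-cong (sp-eq l part))) ⟩
          const (coefficient l) ⊛ alternantₓ l ⊛ const (spNum l)
            ≈⟨ *-cong (det-A l) (det-B l) ⟨
          SO.det (λ i → A (Vec.lookup (staircase l) i)) ⊛ SO.det (λ i → B (Vec.lookup (staircase l) i)) ∎
          where Δ = alternantₓ (replicate n 0)

        entry : ∀ i j → rangeSum (k ℕ.+ n) (λ l → A l i ⊛ B l j) ≈[ k ] const (y j C.- ȳ j) ⊛ M i j
        entry i j = entry-series k (ℕP.m≤m+n k n) i t t² u (y j) (ȳ j) τ v (λ l → p l j) (λ l → q l j)
          t²≈ (yȳ≈1 j) τ₀ τ₊ v≈ (p₀ j) (λ l → p₊ l j) (q₀ j) (λ l → q₊ l j) (M-eq i j k)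

        skewed : const skew ⊛ (partitionSum F ⊛ denominator) ≈[ k ] const skew ⊛ SO.det M
        skewed = begin
          const skew ⊛ (partitionSum F ⊛ denominator)
            ≈⟨ *-congˡ {const skew} (*-cong (partitionSum-weakSum k F F-order) denominator-factor) ⟩
          const skew ⊛ (weakSum n k F ⊛ (Δ ⊛ const W))
            ≈⟨ solve 4 (λ a f d w → a :* (f :* (d :* w)) := f :* (d :* (a :* w))) refl (const skew) (weakSum n k F) Δ (const W) ⟩
          weakSum n k F ⊛ (Δ ⊛ (const skew ⊛ const W))
            -- The factor `skew` is precisely what the y-part `W` of the given denominator lacks to
            -- become the symplectic one.
            ≈⟨ *-congˡ {weakSum n k F} (*-congˡ {Δ} (trans (sym (const-* k skew W)) (const-cong (C.sym spDen-factor)))) ⟩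
          weakSum n k F ⊛ (Δ ⊛ const spDen)
            ≈⟨ weakSum-* n k (Δ ⊛ const spDen) F ⟨
          weakSum n k (λ l → F l ⊛ (Δ ⊛ const spDen))
            ≈⟨ weakSum-cong n k summand ⟩
          weakSum n k (H ∘ staircase)
            -- Parts up to k give exponents up to k + n - 1. As k + n is at least k, the same range
            -- also makes the geometric series exact modulo degree k.
            ≈⟨ weakSum-strictSum n k H ⟩
          strictSum n (k ℕ.+ n) H
            ≈⟨ cauchy-binet n (k ℕ.+ n) A B ⟩
          SO.det (λ i j → rangeSum (k ℕ.+ n) (λ l → A l i ⊛ B l j))
            ≈⟨ det-cong {n} entry ⟩
          SO.det (λ i j → const (y j C.- ȳ j) ⊛ M i j)
            ≈⟨ scale-columns (λ j → const (y j C.- ȳ j)) M ⟩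
          ∏ (λ j → const (y j C.- ȳ j)) ⊛ SO.det M
            ≈⟨ *-congʳ {SO.det M} (trans (sym (prodL-allFin {n} (λ j → const (y j C.- ȳ j))))
                 (sym (const-prodL k (λ j → y j C.- ȳ j) (List.allFin n)))) ⟩
          const skew ⊛ SO.det M ∎
          where
          Δ = alternantₓ (replicate n 0)
          H : Vec ℕ n → Series n
          H m = SO.det (λ i → A (Vec.lookup m i)) ⊛ SO.det (λ i → B (Vec.lookup m i))

        symplectic-cauchy : partitionSum F ⊛ denominator ≈[ k ] SO.det M
        symplectic-cauchy = x∙y⁻¹≈ε⇒x≈y (partitionSum F ⊛ denominator) (SO.det M)
          (const-cancel (skew-regular regular) (begin
            const skew ⊛ (partitionSum F ⊛ denominator ⊕ ⊝ SO.det M)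
              ≈⟨ solve 3 (λ a b c → a :* (b :- c) := a :* b :- a :* c) refl (const skew) (partitionSum F ⊛ denominator) (SO.det M) ⟩
            const skew ⊛ (partitionSum F ⊛ denominator) ⊕ ⊝ (const skew ⊛ SO.det M)
              ≈⟨ x≈y⇒x∙y⁻¹≈ε skewed ⟩
            0ₛ ∎))
          where open Algebra.Properties.Ring ring using (x∙y⁻¹≈ε⇒x≈y; x≈y⇒x∙y⁻¹≈ε)

-- Specialization to Laurent polynomial coefficients

theorem9 : (n : ℕ)
    → (s : Vec ℕ n → PS n) (sp : Vec ℕ n → Laur n) (M : Fin n → Fin n → PS n)
    → (∀ l → IsPartition l → (s l *P alternant (replicate n 0)) ≈P alternant l)
    → (∀ l → IsPartition l → (sp l *L spDenominator) ≈L spNumerator l)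
    → (∀ i j → (M i j *P entryDen i j) ≈P entryNum i j)
    → (sumPartitions (λ l → constP (coeffFactor l *L sp l) *P s l) *P rhsDenominator)
        ≈P OpsP.det M
theorem9 n s sp M s-eq sp-eq M-eq α = toL (at
  -- The factors of `rhsDenominator` are given by matching on a pair, those of the abstract
  -- denominator by projections and a separate function; the two agree only once each pair is split,
  -- so the products are identified pointwise.
  (≡.subst (λ D → (sumPartitions (λ l → constP (coeffFactor l *L sp l) *P s l) *P D) ≈[ ℕ.suc (Vec.sum α) ] OpsP.det M)
    (≡.cong OpsP.prodL (ListP.map-cong (λ { (i , j) → ≡.refl }) (pairsLt n)))
    (symplectic-cauchy s sp M
      (λ l part k → mk λ β _ → fromL (s-eq l part β))
      (λ l part → fromL (sp-eq l part))
      (λ i j k → mk λ β _ → fromL (M-eq i j β))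
      -- The least truncation degree that still retains the coefficient of x^α.
      (ℕ.suc (Vec.sum α))))
  α (ℕP.n<1+n (Vec.sum α)))
  where
  open Laurent n
  open Symplectic n
  open CommutativeRing laurent using (refl; sym)
  open Series laurent using (at; mk; _≈[_]_)
  tPow tuPow₁ : ℕ → Laur n
  tPow l = tuPow l 0
  tuPow₁ l = tuPow l 1
  open SymplecticCauchy laurent
  open Identity tL (tuPow 2 0) uL tPow tuPow₁ yL ybarL yPos yNeg
    (sym (tuPow-* 1 0 1 0)) refl (λ l → sym (tuPow-* 1 0 l 0)) (λ l → sym (tuPow-* 0 1 l 0))
    yȳ≈1 yPow-0 yPow-suc yPow-0 yPow-neg-suc y-ȳ-regular
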